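{- For all integers $0\le k\le r$ there is a constant $\tau$ depending only on $k$ such that whenever $b=\binom{c_{k-1}}{k-1}+\dots+\binom{c_1}{1}$ for some integers $c_{k-1}>c_{k-2}>\dots>c_1\ge 0$, we have \[\binom{c_{k-1}}{k}+\dots+\binom{c_1}{2}\;\le\; f(r,k,b)\;\le\;\binom{c_{k-1}}{k}+\dots+\binom{c_1}{2}+\tau.\]
   Context: $\mathbb{N}^{(s)}$ denotes the family of all $s$-element subsets of $\mathbb{N}$. For integers $0\le k\le r$ and $b\ge 0$, $f(r,k,b)$ denotes the maximum of $|\mathcal{A}|$ over all pairs of families $\mathcal{A}\subset\mathbb{N}^{(r)}$, $\mathcal{B}\subset\mathbb{N}^{(r-1)}$ with $|\mathcal{B}|=b$ such that for every $A\in\mathcal{A}$ there exist $k$ distinct sets $B_1,\dots,B_k\in\mathcal{B}$ with $B_i\subset A$ for all $i$. Binomial coefficients $\binom{c}{i}$ with $c<i$ are $0$. -}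

module Defs where

open import Data.Fin using (Fin)
open import Data.List using (List; length)
open import Data.List.Membership.Propositional using () renaming (_∈_ to _∈ᴸ_)
open import Data.List.Relation.Binary.Subset.Propositional using () renaming (_⊆_ to _⊆ᴸ_)
open import Data.List.Relation.Unary.Linked using (Linked)
open import Data.List.Relation.Unary.Unique.Propositional using (Unique)
open import Data.Nat using (ℕ; suc; _≤_; _<_)
open import Data.Product using (_×_; Σ-syntax; ∃₂)
open import Function.Definitions using (Injective)
open import Relation.Binary.PropositionalEquality using (_≡_)

-- A finite subset of ℕ is stored as its strictly increasing enumeration.
-- The enumeration is unique and the sortedness proof is irrelevant, so
-- propositional equality of FinSets is equality of sets.
record FinSet : Set where
  constructor mkFinSet
  field
    elements : List ℕ
    .sorted  : Linked _<_ elements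

open FinSet public

∣_∣ : FinSet → ℕ
∣ A ∣ = length (elements A)

infix 4 _⊆_

_⊆_ : FinSet → FinSet → Set
A ⊆ B = elements A ⊆ᴸ elements B

-- Finite families of sets are duplicate-free lists, so that length is
-- cardinality.  Restricting to finite 𝒜 loses nothing: admissibility passes
-- to subfamilies of 𝒜, so if the finite admissible 𝒜 have bounded size then
-- no infinite one exists.
record Admissible (r k b : ℕ) (𝒜 ℬ : List FinSet) : Set where
  field
    𝒜-unique : Unique 𝒜
    ℬ-unique : Unique ℬ
    𝒜-sizes  : ∀ {A} → A ∈ᴸ 𝒜 → ∣ A ∣ ≡ r
    -- ∣ B ∣ ≡ r - 1, avoiding truncated subtraction at r ≡ 0.
    ℬ-sizes  : ∀ {B} → B ∈ᴸ ℬ → suc ∣ B ∣ ≡ r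
    ℬ-card   : length ℬ ≡ b
    covers   : ∀ {A} → A ∈ᴸ 𝒜 →
               Σ[ Bs ∈ (Fin k → FinSet) ]
                 (Injective _≡_ _≡_ Bs × (∀ i → Bs i ∈ᴸ ℬ × Bs i ⊆ A))

-- The maximum need not exist (e.g. when k ≡ 0 and r > 0), so f is given by
-- its graph: f[ r , k , b ]≡ m says that the maximum exists and equals m.
infix 4 f[_,_,_]≡_

f[_,_,_]≡_ : (r k b m : ℕ) → Set
f[ r , k , b ]≡ m =
  (∃₂ λ 𝒜 ℬ → Admissible r k b 𝒜 ℬ × length 𝒜 ≡ m) ×
  (∀ 𝒜 ℬ → Admissible r k b 𝒜 ℬ → length 𝒜 ≤ m)

{-# OPTIONS --safe #-}
module Submission where

-- A member A of 𝒜 splits into the part S(A) of k removable elements and the core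
-- A \ S(A).  If a core K lies in b₀ members of ℬ, the members of 𝒜 all of whose
-- selected facets contain K obey Kruskal–Katona in the link of K, at most b - b₀
-- further members contain K, and the others form a smaller instance on the
-- remaining b - b₀ members of ℬ.  Inequalities for the Kruskal–Katona function
-- then give the bound by induction, once b₀ is a positive fraction of b.
-- To find such a core when 𝒜 is large, remove members of ℬ of small degree, so
-- that walks A - w ↦ A - v inside ℬ branch n times at each of k - 1 steps.  If no
-- core were heavy, then most such walks could be prolonged to a k-th step, and ℬ
-- would have on the order of nᵏ members, far more than it has.

open import Defs
open import Data.Nat.Properties using (+-0-commutativeMonoid)
open import Algebra.Properties.CommutativeMonoid.Sum +-0-commutativeMonoid using (sum-syntax)
open import Data.Fin as Fin using (Fin; toℕ)
open import Data.Nat using (ℕ; _+_; _∸_; _≤_; _<_)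
open import Data.Nat.Combinatorics using (_C_)
open import Data.Product using (_×_; ∃-syntax)
open import Relation.Binary.Core using (_Preserves_⟶_)
open import Relation.Binary.PropositionalEquality using (_≡_)

open import Algebra.Properties.CommutativeMonoid.Sum +-0-commutativeMonoid using (sum-init-last; sum-cong-≗)
open import Data.Fin using (inject≤; inject₁; fromℕ)
open import Data.Fin.Properties using (inject≤-injective; toℕ-inject₁; toℕ-fromℕ; toℕ<n; toℕ-injective)
open import Data.Bool using (true; false)
open import Data.List using (List; []; _∷_; _++_; length; filter; map; upTo; take; concat; lookup; tabulate; cartesianProductWith)
open import Data.List.Properties using (≡-dec; length-++; length-filter; filter-notAll; length-take; length-map; length-tabulate)
open import Data.List.Membership.Propositional using (_∈_; _∉_; lose; find)
open import Data.List.Membership.Propositional.Properties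
open import Data.List.Relation.Unary.All as All using (All; []; _∷_)
open import Data.List.Relation.Unary.AllPairs as AllPairs using (AllPairs; []; _∷_)
open import Data.List.Relation.Unary.Any as Any using (Any; here; there)
import Data.List.Relation.Unary.Linked as Linked
import Data.List.Relation.Unary.Linked.Properties as Linkedₚ
open import Data.List.Relation.Unary.Unique.Propositional using (Unique)
import Data.List.Relation.Unary.Unique.Propositional.Properties as Uniqueₚ
open import Data.Nat hiding (∣_-_∣)
open import Data.Nat.Combinatorics using (nCk+nC[k+1]≡[n+1]C[k+1]; nC1≡n; nCn≡1; k>n⇒nCk≡0)
open import Data.Nat.DivMod using (m≡m%n+[m/n]*n; m%n<n)
open import Data.Nat.Induction using (<-wellFounded)
open import Data.Nat.ListAction using (sum)
open import Data.Nat.Properties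
open import Data.Nat.Tactic.RingSolver using (solve-∀)
open import Data.Product using (∃; ∃₂; _,_; proj₁; proj₂; Σ-syntax)
open import Data.Sum using (_⊎_; inj₁; inj₂)
open import Data.Unit using (⊤; tt)
open import Data.List.Membership.DecPropositional _≟_ using () renaming (_∈?_ to _∈ℕ?_)
open import Function using (_∘_; id)
open import Function.Definitions using (Injective)
open import Induction.WellFounded using (Acc; acc)
open import Level using (Level)
open import Relation.Binary.PropositionalEquality
  using (_≢_; refl; sym; trans; cong; cong₂; subst; subst₂; module ≡-Reasoning)
open import Relation.Nullary using (¬_; Dec; yes; no; does; contradiction; ¬?; recompute)
open import Relation.Nullary.Decidable using (decidable-stable; _×-dec_)
open import Relation.Unary using (Pred; Decidable)

-- Binomial coefficients and cascades

-- The error stays bounded because it is paid only once. Every core costs up to b₁ = b - b₀ further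
-- members, and these losses would add up along the induction. They are absorbed instead: when b₀ is
-- a positive fraction of b and b₁ exceeds a constant, kk b₀ + b₁ + kk b₁ ≤ kk (b₀ + b₁) holds
-- without any error term, so only the last level contributes to τ. The same orders of magnitude
-- produce the heavy core. If b is about C(M, k - 1), a family above the bound has average degree of
-- order M, so a minimum degree n of order M can be enforced, and nᵏ⁻¹ and b have the same order. A
-- contradiction needs nᵏ to beat n′ b by a constant factor only, where n′ is the degree below which
-- a class of members with the same core is dissolved. Taking n to be a large constant multiple of
-- n′ is enough, and both remain proportional to M. Hence the fraction 1 / Q of ℬ that contains the
-- core depends on k alone.

infix 6.5 _choose_

-- Opaque, because _C_ unfolds to a quotient of factorials.
opaque
  _choose_ : ℕ → ℕ → ℕ
  n choose k = n C k

  choose-C : ∀ n k → n choose k ≡ n C k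
  choose-C n k = refl

  pascal : ∀ n k → suc n choose suc k ≡ n choose suc k + n choose k
  pascal n k = trans (sym (nCk+nC[k+1]≡[n+1]C[k+1] n k)) (+-comm (n C k) _)

  choose-1 : ∀ n → n choose 1 ≡ n
  choose-1 = nC1≡n

  choose-0 : ∀ n → n choose 0 ≡ 1
  choose-0 n = refl

  choose-self : ∀ n → n choose n ≡ 1
  choose-self = nCn≡1

  choose-zero : ∀ {n k} → n < k → n choose k ≡ 0
  choose-zero = k>n⇒nCk≡0

choose-monoˡ-suc : ∀ n k → n choose k ≤ suc n choose k
choose-monoˡ-suc n zero = ≤-reflexive (trans (choose-0 n) (sym (choose-0 (suc n))))
choose-monoˡ-suc n (suc k) = subst (n choose suc k ≤_) (sym (pascal n k)) (m≤m+n _ _)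

choose-monoˡ-+ : ∀ n j k → n choose k ≤ (j + n) choose k
choose-monoˡ-+ n zero k = ≤-refl
choose-monoˡ-+ n (suc j) k = ≤-trans (choose-monoˡ-+ n j k) (choose-monoˡ-suc (j + n) k)

choose-monoˡ : ∀ {m n} k → m ≤ n → m choose k ≤ n choose k
choose-monoˡ {m} {n} k m≤n =
  subst (λ z → m choose k ≤ z choose k) (m∸n+n≡m m≤n) (choose-monoˡ-+ m (n ∸ m) k)

choose-pos : ∀ {n k} → k ≤ n → 0 < n choose k
choose-pos {n} {k} k≤n = subst (_≤ n choose k) (choose-self k) (choose-monoˡ k k≤n)

-- Subtraction-free form of the ratio (n - k) / (k + 1) between neighbouring coefficients; it also
-- covers n < k.
choose-absorb : ∀ n k → suc k * (n choose suc k) + k * (n choose k) ≡ n * (n choose k)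
choose-absorb n zero rewrite choose-1 n = solve-0 n (n choose 0) (choose-0 n)
  where
  solve-0 : ∀ n c → c ≡ 1 → n + 0 + 0 ≡ n * c
  solve-0 n _ refl = lem n where
    lem : ∀ n → n + 0 + 0 ≡ n * 1
    lem = solve-∀
choose-absorb zero (suc k) rewrite choose-zero {0} {suc (suc k)} (s≤s z≤n) | choose-zero {0} {suc k} (s≤s z≤n)
  | *-zeroʳ k = refl
choose-absorb (suc n) (suc k) rewrite pascal n (suc k) | pascal n k =
  alg n k (n choose k) (n choose suc k) (n choose suc (suc k)) (choose-absorb n k) (choose-absorb n (suc k))
  where
  alg : ∀ n k p q r → suc k * q + k * p ≡ n * p → suc (suc k) * r + suc k * q ≡ n * q →
        suc (suc k) * (r + q) + suc k * (q + p) ≡ suc n * (q + p)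
  alg n k p q r h₁ h₂ = begin
    suc (suc k) * (r + q) + suc k * (q + p)                         ≡⟨ l₁ k p q r ⟩
    (suc (suc k) * r + suc k * q) + (suc k * q + k * p) + (q + p)   ≡⟨ cong₂ (λ x y → x + y + (q + p)) h₂ h₁ ⟩
    n * q + n * p + (q + p)                                         ≡⟨ l₂ n p q ⟩
    suc n * (q + p)                                                 ∎
    where
    open ≡-Reasoning
    l₁ : ∀ k p q r → suc (suc k) * (r + q) + suc k * (q + p)
       ≡ (suc (suc k) * r + suc k * q) + (suc k * q + k * p) + (q + p)
    l₁ = solve-∀
    l₂ : ∀ n p q → n * q + n * p + (q + p) ≡ suc n * (q + p)
    l₂ = solve-∀

-- Counting up: the remainder grows until it would reach `a choose e`, and then Pascal's rule turns
-- the whole into `suc a choose suc e` with remainder 0. The start `a = e` represents 0.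
cascade : ∀ e x → ∃₂ λ a x′ → x ≡ a choose suc e + x′ × x′ < a choose e
cascade e zero = e , 0 , sym (trans (+-identityʳ _) (choose-zero ≤-refl)) , choose-pos ≤-refl
cascade e (suc x) with cascade e x
... | a , x′ , refl , x′< with m≤n⇒m<n∨m≡n x′<
... | inj₁ lt = a , suc x′ , sym (+-suc _ _) , lt
... | inj₂ eq = suc a , 0
      , trans (sym (+-suc _ x′)) (trans (cong (a choose suc e +_) eq)
          (trans (sym (pascal a e)) (sym (+-identityʳ _))))
      , ≤-trans (≤-trans (s≤s z≤n) x′<) (choose-monoˡ-suc a e)

cascade-below : ∀ e {a c x′ y} → x′ < a choose e → c choose suc e ≤ y → y ≡ a choose suc e + x′ → c ≤ a
cascade-below e {a} {c} {x′} x′< c≤ refl = ≮⇒≥ λ a<c → <-irrefl refl (begin-strict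
  a choose suc e + x′    <⟨ +-monoʳ-< (a choose suc e) x′< ⟩
  a choose suc e + a choose e ≡⟨ pascal a e ⟨
  suc a choose suc e     ≤⟨ choose-monoˡ (suc e) a<c ⟩
  c choose suc e         ≤⟨ c≤ ⟩
  a choose suc e + x′    ∎)
  where open ≤-Reasoning

cascade-unique : ∀ e {a c x′ y′} → x′ < a choose e → y′ < c choose e →
                 a choose suc e + x′ ≡ c choose suc e + y′ → a ≡ c × x′ ≡ y′
cascade-unique e {a} {c} {x′} {y′} x′< y′< eq
  with ≤-antisym {a} {c} (cascade-below e y′< (m≤m+n (a choose suc e) x′) eq)
                         (cascade-below e x′< (m≤m+n (c choose suc e) y′) (sym eq))
... | refl = refl , +-cancelˡ-≡ (a choose suc e) _ _ eq

-- Kruskal–Katona function: kk e x is the largest number of (e + 2)-sets all of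
-- whose (e + 1)-subsets lie in a family of x sets.
opaque
  kk : ℕ → ℕ → ℕ
  kk zero    x = x choose 2
  kk (suc e) x = proj₁ (cascade (suc e) x) choose (3 + e) + kk e (proj₁ (proj₂ (cascade (suc e) x)))

  kk-zero : ∀ x → kk 0 x ≡ x choose 2
  kk-zero x = refl

  kk-unfold : ∀ e {a x′} → x′ < a choose suc e → kk (suc e) (a choose (2 + e) + x′) ≡ a choose (3 + e) + kk e x′
  kk-unfold e {a} {x′} x′< with cascade (suc e) (a choose (2 + e) + x′)
  ... | c , y′ , eq , y′< with cascade-unique (suc e) {a} {c} x′< y′< eq
  ... | refl , refl = refl

kk-0 : ∀ e → kk e 0 ≡ 0
kk-0 zero = trans (kk-zero 0) (choose-zero (s≤s z≤n))
kk-0 (suc e) = begin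
  kk (suc e) 0                               ≡⟨ cong (kk (suc e)) (trans (+-identityʳ _) (choose-zero {suc e} ≤-refl)) ⟨
  kk (suc e) (suc e choose (2 + e) + 0)           ≡⟨ kk-unfold e {suc e} (choose-pos ≤-refl) ⟩
  suc e choose (3 + e) + kk e 0                   ≡⟨ cong₂ _+_ (choose-zero {suc e} {3 + e} (m≤n+m _ 1)) (kk-0 e) ⟩
  0                                          ∎
  where open ≡-Reasoning

kk-C : ∀ e a → kk e (a choose suc e) ≡ a choose (2 + e)
kk-C zero a = trans (kk-zero _) (cong (_choose 2) (choose-1 a))
kk-C (suc e) a with suc e ≤? a
... | yes e<a = begin
  kk (suc e) (a choose (2 + e))       ≡⟨ cong (kk (suc e)) (+-identityʳ _) ⟨
  kk (suc e) (a choose (2 + e) + 0)   ≡⟨ kk-unfold e (choose-pos e<a) ⟩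
  a choose (3 + e) + kk e 0           ≡⟨ cong (a choose (3 + e) +_) (kk-0 e) ⟩
  a choose (3 + e) + 0                ≡⟨ +-identityʳ _ ⟩
  a choose (3 + e)                    ∎
  where open ≡-Reasoning
... | no e≮a = begin
  kk (suc e) (a choose (2 + e))       ≡⟨ cong (kk (suc e)) (choose-zero (m≤n⇒m≤1+n (≰⇒> e≮a))) ⟩
  kk (suc e) 0                   ≡⟨ kk-0 (suc e) ⟩
  0                              ≡⟨ choose-zero (m≤n⇒m≤1+n (m≤n⇒m≤1+n (≰⇒> e≮a))) ⟨
  a choose (3 + e)                    ∎
  where open ≡-Reasoning

-- At equality the expansion is no longer the greedy one, but Pascal's rule on both sides gives the
-- same value. This boundary case lets a remainder be filled up completely.
kk-step : ∀ e a {x′} → x′ ≤ a choose suc e → kk (suc e) (a choose (2 + e) + x′) ≡ a choose (3 + e) + kk e x′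
kk-step e a {x′} x′≤ with m≤n⇒m<n∨m≡n x′≤
... | inj₁ x′<  = kk-unfold e x′<
... | inj₂ refl = begin
  kk (suc e) (a choose (2 + e) + a choose suc e)   ≡⟨ cong (kk (suc e)) (pascal a (suc e)) ⟨
  kk (suc e) (suc a choose (2 + e))           ≡⟨ kk-C (suc e) (suc a) ⟩
  suc a choose (3 + e)                        ≡⟨ pascal a (2 + e) ⟩
  a choose (3 + e) + a choose (2 + e)              ≡⟨ cong (a choose (3 + e) +_) (kk-C e a) ⟨
  a choose (3 + e) + kk e (a choose suc e)         ∎
  where open ≡-Reasoning

-- The remainder ranges over (0, C(a, e)] instead of [0, C(a, e)): in `kk-spread` the smaller
-- argument then always has something to give away, and in `kk-upper` the root `a` is strictly below
-- `N`.
cascade⁺ : ∀ e x → 0 < x → ∃₂ λ a x′ → x ≡ a choose suc e + x′ × 0 < x′ × x′ ≤ a choose e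
cascade⁺ e (suc x) _ with cascade e x
... | a , x′ , refl , x′< = a , suc x′ , sym (+-suc _ _) , s≤s z≤n , x′<

private
  C2-suc : ∀ n → suc n choose 2 ≡ n choose 2 + n
  C2-suc n = trans (pascal n 1) (cong (n choose 2 +_) (choose-1 n))

C2-convex : ∀ p X y → X ≤ y → (X + p) choose 2 + y choose 2 ≤ X choose 2 + (y + p) choose 2
C2-convex zero X y X≤y = ≤-reflexive (cong₂ (λ a b → a choose 2 + b choose 2) (+-identityʳ X) (sym (+-identityʳ y)))
C2-convex (suc p) X y X≤y = begin
  (X + suc p) choose 2 + y choose 2             ≡⟨ cong (λ z → z choose 2 + y choose 2) (+-suc X p) ⟩
  suc (X + p) choose 2 + y choose 2             ≡⟨ cong (_+ y choose 2) (C2-suc (X + p)) ⟩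
  (X + p) choose 2 + (X + p) + y choose 2       ≡⟨ l ((X + p) choose 2) (X + p) (y choose 2) ⟩
  (X + p) choose 2 + y choose 2 + (X + p)       ≤⟨ +-mono-≤ (C2-convex p X y X≤y) (+-monoˡ-≤ p X≤y) ⟩
  X choose 2 + (y + p) choose 2 + (y + p)       ≡⟨ +-assoc (X choose 2) _ _ ⟩
  X choose 2 + ((y + p) choose 2 + (y + p))     ≡⟨ cong (X choose 2 +_) (C2-suc (y + p)) ⟨
  X choose 2 + suc (y + p) choose 2             ≡⟨ cong (λ z → X choose 2 + z choose 2) (+-suc y p) ⟨
  X choose 2 + (y + suc p) choose 2             ∎
  where
  open ≤-Reasoning
  l : ∀ a b c → a + b + c ≡ a + c + b
  l = solve-∀

-- The remainder of the cascade of the smaller argument is moved to the larger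
-- one until an extreme pair X, Y is reached.
kk-spread : ∀ e x y X Y → x + y ≡ X + Y → x ≤ Y → y ≤ Y →
            X ≡ 0 ⊎ ∃ (λ N → Y ≡ N choose suc e) → kk e x + kk e y ≤ kk e X + kk e Y
kk-spread zero x y X Y eq x≤Y y≤Y _ with m≤n⇒∃[o]m+o≡n y≤Y
... | p , refl rewrite kk-zero x | kk-zero y | kk-zero X | kk-zero (y + p) | +-cancelʳ-≡ y x (X + p) (trans eq (trans (cong (X +_) (+-comm y p)) (sym (+-assoc X p y)))) =
  C2-convex p X y (+-cancelʳ-≤ p X y x≤Y)
kk-spread (suc e) = λ x y X Y eq x≤Y y≤Y ext → ordered x y X Y eq x≤Y y≤Y ext (≤-total x y)
  where
  open ≤-Reasoning
  -- The larger argument must not overshoot `Y`. If `X` is 0, then `Y` is the whole sum; if `Y` is a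
  -- binomial coefficient, its root exceeds `a`, so `Y` is at least `suc a choose (2 + e)`.
  cap : ∀ {a y X Y} → a choose (2 + e) ≤ y → y < Y → X ≡ 0 ⊎ ∃ (λ N → Y ≡ N choose (2 + e)) →
        ∀ {x* y*} → x* + y* ≡ X + Y → y* ≤ suc a choose (2 + e) → y* ≤ Y
  cap _ _ (inj₁ refl) {x*} {y*} refl _ = m≤n+m y* x*
  cap {a} a≤ y<Y (inj₂ (N , refl)) _ y*≤ = ≤-trans y*≤ (choose-monoˡ (2 + e) (≰⇒> λ N≤a →
    <-irrefl refl (<-≤-trans (≤-<-trans a≤ y<Y) (choose-monoˡ (2 + e) N≤a))))
  l : ∀ p q r s → (p + q) + (r + s) ≡ (p + r) + (q + s)
  l = solve-∀

  go : ∀ x y X Y → Acc _<_ x → x + y ≡ X + Y → x ≤ y → y ≤ Y → X ≡ 0 ⊎ ∃ (λ N → Y ≡ N choose (2 + e)) →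
       kk (suc e) x + kk (suc e) y ≤ kk (suc e) X + kk (suc e) Y
  go x y X Y (acc rs) eq x≤y y≤Y ext with m≤n⇒m<n∨m≡n y≤Y
  ... | inj₂ refl = ≤-reflexive (cong (λ z → kk (suc e) z + kk (suc e) y) (+-cancelʳ-≡ y x X eq))
  ... | inj₁ y<Y
    with cascade (suc e) y
       | cascade⁺ (suc e) x (≤-<-trans z≤n (≰⇒> λ x≤X → <-irrefl eq (+-mono-≤-< x≤X y<Y)))
  ... | a , y′ , refl , y′< | c , x′ , refl , 0<x′ , x′≤
    with x′ + y′ ≤? a choose suc e
  -- The remainders fit together below `a`: `x` gives up all of its remainder, which one level down
  -- is an extreme pair of the first kind.
  ... | yes small = begin
    kk (suc e) x + kk (suc e) y
      ≡⟨ cong₂ _+_ (kk-step e c x′≤) (kk-step e a (<⇒≤ y′<)) ⟩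
    (c choose (3 + e) + kk e x′) + (a choose (3 + e) + kk e y′)
      ≡⟨ l (c choose (3 + e)) _ _ _ ⟩
    (c choose (3 + e) + a choose (3 + e)) + (kk e x′ + kk e y′)
      ≤⟨ +-monoʳ-≤ (c choose (3 + e) + a choose (3 + e)) (kk-spread e x′ y′ 0 (x′ + y′) refl (m≤m+n x′ y′) (m≤n+m y′ x′) (inj₁ refl)) ⟩
    (c choose (3 + e) + a choose (3 + e)) + (kk e 0 + kk e (x′ + y′))
      ≡⟨ cong (λ z → (c choose (3 + e) + a choose (3 + e)) + (z + kk e (x′ + y′))) (kk-0 e) ⟩
    (c choose (3 + e) + a choose (3 + e)) + kk e (x′ + y′)
      ≡⟨ +-assoc (c choose (3 + e)) _ _ ⟩
    c choose (3 + e) + (a choose (3 + e) + kk e (x′ + y′))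
      ≡⟨ cong₂ _+_ (kk-C (suc e) c) (kk-step e a small) ⟨
    kk (suc e) (c choose (2 + e)) + kk (suc e) (a choose (2 + e) + (x′ + y′))
      ≤⟨ go _ _ X Y (rs (m<m+n _ 0<x′)) sum′
           (≤-trans (choose-monoˡ (2 + e) c≤a) (m≤m+n _ _))
           (cap {a} (m≤m+n _ y′) y<Y ext {c choose (2 + e)} sum′
             (≤-trans (+-monoʳ-≤ (a choose (2 + e)) small) (≤-reflexive (sym (pascal a (suc e)))))) ext ⟩
    kk (suc e) X + kk (suc e) Y ∎
    where
    c≤a : c ≤ a
    c≤a = cascade-below (suc e) y′< (≤-trans (m≤m+n _ x′) x≤y) refl
    l″ : ∀ p q r s → p + (q + (r + s)) ≡ (p + r) + (q + s)
    l″ = solve-∀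
    sum′ : c choose (2 + e) + (a choose (2 + e) + (x′ + y′)) ≡ X + Y
    sum′ = trans (l″ (c choose (2 + e)) _ x′ y′) eq
  -- The remainders overflow: that of `y` is filled up to `M`, so `y` becomes
  -- `suc a choose (2 + e)`, and one level down (`r`, `M`) is an extreme pair of the second kind.
  ... | no large = begin
    kk (suc e) x + kk (suc e) y
      ≡⟨ cong₂ _+_ (kk-step e c x′≤) (kk-step e a (<⇒≤ y′<)) ⟩
    (c choose (3 + e) + kk e x′) + (a choose (3 + e) + kk e y′)
      ≡⟨ l (c choose (3 + e)) _ _ _ ⟩
    (c choose (3 + e) + a choose (3 + e)) + (kk e x′ + kk e y′)
      ≤⟨ +-monoʳ-≤ (c choose (3 + e) + a choose (3 + e)) (kk-spread e x′ y′ r M (sym r+M) x′≤M (<⇒≤ y′<) (inj₂ (a , refl))) ⟩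
    (c choose (3 + e) + a choose (3 + e)) + (kk e r + kk e M)
      ≡⟨ l (c choose (3 + e)) _ _ _ ⟨
    (c choose (3 + e) + kk e r) + (a choose (3 + e) + kk e M)
      ≡⟨ cong₂ _+_ (kk-step e c (≤-trans (<⇒≤ r<x′) x′≤)) (kk-step e a ≤-refl) ⟨
    kk (suc e) (c choose (2 + e) + r) + kk (suc e) (a choose (2 + e) + M)
      ≤⟨ go _ _ X Y (rs (+-monoʳ-< (c choose (2 + e)) r<x′)) sum′
           (≤-trans (<⇒≤ (+-monoʳ-< (c choose (2 + e)) r<x′)) (≤-trans x≤y (<⇒≤ (+-monoʳ-< (a choose (2 + e)) y′<))))
           (cap {a} (m≤m+n _ y′) y<Y ext {c choose (2 + e) + r} sum′ (≤-reflexive (sym (pascal a (suc e))))) ext ⟩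
    kk (suc e) X + kk (suc e) Y ∎
    where
    c≤a : c ≤ a
    c≤a = cascade-below (suc e) y′< (≤-trans (m≤m+n _ x′) x≤y) refl
    M = a choose suc e
    r = (x′ + y′) ∸ M
    r+M : r + M ≡ x′ + y′
    r+M = m∸n+n≡m (<⇒≤ (≰⇒> large))
    x′≤M : x′ ≤ M
    x′≤M = ≤-trans x′≤ (choose-monoˡ (suc e) c≤a)
    r<x′ : r < x′
    r<x′ = +-cancelʳ-< M r x′ (subst (_< x′ + M) (sym r+M) (+-monoʳ-< x′ y′<))
    sum′ : (c choose (2 + e) + r) + (a choose (2 + e) + M) ≡ X + Y
    sum′ = trans (l (c choose (2 + e)) r _ M) (trans (cong (c choose (2 + e) + a choose (2 + e) +_) r+M)
             (trans (sym (l (c choose (2 + e)) x′ _ y′)) eq))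

  ordered : ∀ x y X Y → x + y ≡ X + Y → x ≤ Y → y ≤ Y → X ≡ 0 ⊎ ∃ (λ N → Y ≡ N choose (2 + e)) →
         x ≤ y ⊎ y ≤ x → kk (suc e) x + kk (suc e) y ≤ kk (suc e) X + kk (suc e) Y
  ordered x y X Y eq x≤Y y≤Y ext (inj₁ x≤y) = go x y X Y (<-wellFounded x) eq x≤y y≤Y ext
  ordered x y X Y eq x≤Y y≤Y ext (inj₂ y≤x) =
    subst (_≤ kk (suc e) X + kk (suc e) Y) (+-comm (kk (suc e) y) _)
      (go y x X Y (<-wellFounded y) (trans (+-comm y x) eq) y≤x x≤Y ext)

kk-superadditive : ∀ e x y → kk e x + kk e y ≤ kk e (x + y)
kk-superadditive e x y = subst (λ z → kk e x + kk e y ≤ z + kk e (x + y)) (kk-0 e)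
  (kk-spread e x y 0 (x + y) refl (m≤m+n x y) (m≤n+m y x) (inj₁ refl))

kk-mono : ∀ e {x y} → x ≤ y → kk e x ≤ kk e y
kk-mono e {x} x≤y with m≤n⇒∃[o]m+o≡n x≤y
... | o , refl = ≤-trans (m≤m+n _ _) (kk-superadditive e x o)

-- Inequalities for the Kruskal–Katona function

-- Write `y` as `N choose (2 + e)` plus `y′`; the next layer has room for `M = N choose suc e`. If
-- `x ≤ M`, the minimum is replaced by `kk e x`, and `x` and `y′` are merged one level down, by
-- superadditivity or, when they overflow, by `kk-spread` towards `M`. If `x > M`, the layer is
-- completed to `suc N choose (2 + e)`; unless `y′` and the rest of `x` fill the layer above as
-- well, the cap `y` becomes essential, which is the business of `top`.
kk-excess : ∀ e y x → kk (suc e) y + (y ⊓ kk e x) ≤ kk (suc e) (x + y)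
kk-excess e y x with cascade (suc e) y
... | N , y′ , refl , y′< with x ≤? N choose suc e
... | yes x≤M with x + y′ ≤? N choose suc e
... | yes fits = begin
  kk (suc e) (N choose (2 + e) + y′) + ((N choose (2 + e) + y′) ⊓ kk e x)
    ≤⟨ +-mono-≤ (≤-reflexive (kk-step e N (<⇒≤ y′<))) (m⊓n≤n (N choose (2 + e) + y′) _) ⟩
  N choose (3 + e) + kk e y′ + kk e x
    ≡⟨ +-assoc (N choose (3 + e)) _ _ ⟩
  N choose (3 + e) + (kk e y′ + kk e x)
    ≤⟨ +-monoʳ-≤ (N choose (3 + e)) (kk-superadditive e y′ x) ⟩
  N choose (3 + e) + kk e (y′ + x)
    ≡⟨ kk-step e N (≤-trans (≤-reflexive (+-comm y′ x)) fits) ⟨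
  kk (suc e) (N choose (2 + e) + (y′ + x))
    ≡⟨ cong (kk (suc e)) (l (N choose (2 + e)) y′ x) ⟩
  kk (suc e) (x + (N choose (2 + e) + y′)) ∎
  where
  open ≤-Reasoning
  l : ∀ p q r → p + (q + r) ≡ r + (p + q)
  l = solve-∀
... | no overflow = begin
  kk (suc e) (N choose (2 + e) + y′) + ((N choose (2 + e) + y′) ⊓ kk e x)
    ≤⟨ +-mono-≤ (≤-reflexive (kk-step e N (<⇒≤ y′<))) (m⊓n≤n (N choose (2 + e) + y′) _) ⟩
  N choose (3 + e) + kk e y′ + kk e x
    ≡⟨ +-assoc (N choose (3 + e)) _ _ ⟩
  N choose (3 + e) + (kk e y′ + kk e x)
    ≤⟨ +-monoʳ-≤ (N choose (3 + e)) (kk-spread e y′ x r M (trans (+-comm y′ x) (sym r+M)) (<⇒≤ y′<) x≤M (inj₂ (N , refl))) ⟩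
  N choose (3 + e) + (kk e r + kk e M)
    ≡⟨ cong (λ z → N choose (3 + e) + (kk e r + z)) (kk-C e N) ⟩
  N choose (3 + e) + (kk e r + N choose (2 + e))
    ≡⟨ l (N choose (3 + e)) _ _ ⟩
  (N choose (3 + e) + N choose (2 + e)) + kk e r
    ≡⟨ cong (_+ kk e r) (pascal N (2 + e)) ⟨
  suc N choose (3 + e) + kk e r
    ≡⟨ kk-step e (suc N) (≤-trans r≤M (choose-monoˡ-suc N (suc e))) ⟨
  kk (suc e) (suc N choose (2 + e) + r)
    ≡⟨ cong (kk (suc e)) sum′ ⟩
  kk (suc e) (x + (N choose (2 + e) + y′)) ∎
  where
  open ≤-Reasoning
  M = N choose suc e
  r = (x + y′) ∸ M
  r+M : r + M ≡ x + y′
  r+M = m∸n+n≡m (<⇒≤ (≰⇒> overflow))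
  r≤M : r ≤ M
  r≤M = +-cancelʳ-≤ M r M (subst (_≤ M + M) (sym r+M) (+-mono-≤ x≤M (<⇒≤ y′<)))
  l : ∀ p q r → p + (q + r) ≡ (p + r) + q
  l = solve-∀
  l′ : ∀ p q r → (p + q) + r ≡ p + (r + q)
  l′ = solve-∀
  l″ : ∀ p q r → p + (q + r) ≡ q + (p + r)
  l″ = solve-∀
  sum′ : suc N choose (2 + e) + r ≡ x + (N choose (2 + e) + y′)
  sum′ = trans (cong (_+ r) (pascal N (suc e))) (trans (l′ (N choose (2 + e)) M r)
           (trans (cong (N choose (2 + e) +_) r+M) (l″ (N choose (2 + e)) x y′)))
kk-excess e y x | N , y′ , refl , y′< | no x≰M
  with m≤n⇒∃[o]m+o≡n (<⇒≤ (≰⇒> x≰M))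
... | zero , refl = contradiction (≤-reflexive (+-identityʳ _)) x≰M
... | suc x″ , refl with y′ + suc x″ ≤? suc N choose suc e
... | no overflow = begin
  kk (suc e) (N choose (2 + e) + y′) + ((N choose (2 + e) + y′) ⊓ kk e (M + suc x″))
    ≤⟨ +-mono-≤ (≤-reflexive (kk-step e N (<⇒≤ y′<))) (m⊓n≤m (N choose (2 + e) + y′) _) ⟩
  N choose (3 + e) + kk e y′ + (N choose (2 + e) + y′)
    ≤⟨ +-mono-≤ (+-monoʳ-≤ (N choose (3 + e)) (≤-trans (kk-mono e (<⇒≤ y′<)) (≤-reflexive (kk-C e N))))
                (+-monoʳ-≤ (N choose (2 + e)) (<⇒≤ y′<)) ⟩
  N choose (3 + e) + N choose (2 + e) + (N choose (2 + e) + M)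
    ≡⟨ cong₂ _+_ (pascal N (2 + e)) (pascal N (suc e)) ⟨
  suc N choose (3 + e) + suc N choose (2 + e)
    ≡⟨ cong (suc N choose (3 + e) +_) (kk-C e (suc N)) ⟨
  suc N choose (3 + e) + kk e (suc N choose suc e)
    ≡⟨ kk-step e (suc N) ≤-refl ⟨
  kk (suc e) (suc N choose (2 + e) + suc N choose suc e)
    ≤⟨ kk-mono (suc e) (+-monoʳ-≤ (suc N choose (2 + e)) (<⇒≤ (≰⇒> overflow))) ⟩
  kk (suc e) (suc N choose (2 + e) + (y′ + suc x″))
    ≡⟨ cong (kk (suc e)) (trans (cong (_+ (y′ + suc x″)) (pascal N (suc e))) (l (N choose (2 + e)) M y′ (suc x″))) ⟩
  kk (suc e) (M + suc x″ + (N choose (2 + e) + y′)) ∎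
  where
  open ≤-Reasoning
  M = N choose suc e
  l : ∀ p m y z → p + m + (y + z) ≡ m + z + (p + y)
  l = solve-∀
... | yes fits = begin
  kk (suc e) (N choose (2 + e) + y′) + ((N choose (2 + e) + y′) ⊓ kk e (M + suc x″))
    ≡⟨ cong (_+ ((N choose (2 + e) + y′) ⊓ kk e (M + suc x″))) (kk-step e N (<⇒≤ y′<)) ⟩
  N choose (3 + e) + kk e y′ + ((N choose (2 + e) + y′) ⊓ kk e (M + suc x″))
    ≡⟨ +-assoc (N choose (3 + e)) _ _ ⟩
  N choose (3 + e) + (kk e y′ + ((N choose (2 + e) + y′) ⊓ kk e (M + suc x″)))
    ≤⟨ +-monoʳ-≤ (N choose (3 + e)) (top e N y′ x″ y′<) ⟩
  N choose (3 + e) + (N choose (2 + e) + kk e (y′ + suc x″))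
    ≡⟨ +-assoc (N choose (3 + e)) _ _ ⟨
  N choose (3 + e) + N choose (2 + e) + kk e (y′ + suc x″)
    ≡⟨ cong (_+ kk e (y′ + suc x″)) (pascal N (2 + e)) ⟨
  suc N choose (3 + e) + kk e (y′ + suc x″)
    ≡⟨ kk-step e (suc N) fits ⟨
  kk (suc e) (suc N choose (2 + e) + (y′ + suc x″))
    ≡⟨ cong (kk (suc e)) (trans (cong (_+ (y′ + suc x″)) (pascal N (suc e))) (l (N choose (2 + e)) M y′ (suc x″))) ⟩
  kk (suc e) (M + suc x″ + (N choose (2 + e) + y′)) ∎
  where
  open ≤-Reasoning
  M = N choose suc e
  l : ∀ p m y z → p + m + (y + z) ≡ m + z + (p + y)
  l = solve-∀
  -- For positive `e` the coefficient `N choose (2 + e)` of this level can be taken out of both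
  -- entries of the minimum, and what remains is `kk-excess` one level lower. A large `x″` is first
  -- cut down to the size at which `y′` is already the smaller entry.
  top : ∀ e N y′ x″ → y′ < N choose suc e →
        kk e y′ + ((N choose (2 + e) + y′) ⊓ kk e (N choose suc e + suc x″)) ≤ N choose (2 + e) + kk e (y′ + suc x″)
  top zero N y′ x″ y′< rewrite kk-zero y′ | kk-zero (y′ + suc x″) = begin
    y′ choose 2 + ((N choose 2 + y′) ⊓ _)  ≤⟨ +-monoʳ-≤ (y′ choose 2) (m⊓n≤m (N choose 2 + y′) _) ⟩
    y′ choose 2 + (N choose 2 + y′)        ≡⟨ l₀ (y′ choose 2) _ y′ ⟩
    N choose 2 + (y′ choose 2 + y′)        ≡⟨ cong (λ z → N choose 2 + (y′ choose 2 + z)) (choose-1 y′) ⟨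
    N choose 2 + (y′ choose 2 + y′ choose 1)    ≡⟨ cong (N choose 2 +_) (pascal y′ 1) ⟨
    N choose 2 + suc y′ choose 2           ≤⟨ +-monoʳ-≤ (N choose 2) (choose-monoˡ 2 (≤-trans (s≤s (m≤m+n y′ x″)) (≤-reflexive (sym (+-suc y′ x″))))) ⟩
    N choose 2 + (y′ + suc x″) choose 2    ∎
    where
    l₀ : ∀ p q r → p + (q + r) ≡ q + (p + r)
    l₀ = solve-∀
  top (suc e) N y′ x″ y′< with suc x″ ≤? N choose suc e
  ... | yes x″≤ = begin
    kk (suc e) y′ + ((N choose (3 + e) + y′) ⊓ kk (suc e) (N choose (2 + e) + suc x″))
      ≡⟨ cong (λ z → kk (suc e) y′ + ((N choose (3 + e) + y′) ⊓ z)) (kk-step e N x″≤) ⟩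
    kk (suc e) y′ + ((N choose (3 + e) + y′) ⊓ (N choose (3 + e) + kk e (suc x″)))
      ≡⟨ cong (kk (suc e) y′ +_) (+-distribˡ-⊓ (N choose (3 + e)) y′ _) ⟨
    kk (suc e) y′ + (N choose (3 + e) + (y′ ⊓ kk e (suc x″)))
      ≡⟨ l₀ (kk (suc e) y′) (N choose (3 + e)) _ ⟩
    N choose (3 + e) + (kk (suc e) y′ + (y′ ⊓ kk e (suc x″)))
      ≤⟨ +-monoʳ-≤ (N choose (3 + e)) (kk-excess e y′ (suc x″)) ⟩
    N choose (3 + e) + kk (suc e) (suc x″ + y′)
      ≡⟨ cong (λ z → N choose (3 + e) + kk (suc e) z) (+-comm (suc x″) y′) ⟩
    N choose (3 + e) + kk (suc e) (y′ + suc x″) ∎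
    where
    l₀ : ∀ p q r → p + (q + r) ≡ q + (p + r)
    l₀ = solve-∀
  ... | no x″≰ = begin
    kk (suc e) y′ + ((N choose (3 + e) + y′) ⊓ kk (suc e) (N choose (2 + e) + suc x″))
      ≤⟨ +-monoʳ-≤ (kk (suc e) y′) (m⊓n≤m (N choose (3 + e) + y′) _) ⟩
    kk (suc e) y′ + (N choose (3 + e) + y′)
      ≡⟨ l₀ (kk (suc e) y′) (N choose (3 + e)) _ ⟩
    N choose (3 + e) + (kk (suc e) y′ + y′)
      ≡⟨ cong (λ z → N choose (3 + e) + (kk (suc e) y′ + z)) (m≤n⇒m⊓n≡m (≤-trans (<⇒≤ y′<) (≤-reflexive (sym (kk-C e N))))) ⟨
    N choose (3 + e) + (kk (suc e) y′ + (y′ ⊓ kk e (N choose suc e)))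
      ≤⟨ +-monoʳ-≤ (N choose (3 + e)) (kk-excess e y′ (N choose suc e)) ⟩
    N choose (3 + e) + kk (suc e) (N choose suc e + y′)
      ≤⟨ +-monoʳ-≤ (N choose (3 + e)) (kk-mono (suc e) (≤-trans (≤-reflexive (+-comm _ y′)) (+-monoʳ-≤ y′ (<⇒≤ (≰⇒> x″≰))))) ⟩
    N choose (3 + e) + kk (suc e) (y′ + suc x″) ∎
    where
    l₀ : ∀ p q r → p + (q + r) ≡ q + (p + r)
    l₀ = solve-∀

-- The quotient `kk e x / x` is largest at x = C(N, e + 1), where it equals (N - e - 1) / (e + 2).
-- In the induction along the cascade the coefficients one level up leave a surplus of at most `x`,
-- which pays exactly for the step from `a` to `suc a ≤ N`.
kk-upper : ∀ e N x → x ≤ N choose suc e → (2 + e) * kk e x + suc e * x ≤ N * x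
kk-upper zero N x x≤ rewrite kk-zero x = begin
  2 * (x choose 2) + 1 * x          ≡⟨ cong (λ z → 2 * (x choose 2) + 1 * z) (choose-1 x) ⟨
  2 * (x choose 2) + 1 * (x choose 1)    ≡⟨ choose-absorb x 1 ⟩
  x * (x choose 1)                  ≡⟨ cong (x *_) (choose-1 x) ⟩
  x * x                        ≤⟨ *-monoˡ-≤ x (≤-trans x≤ (≤-reflexive (choose-1 N))) ⟩
  N * x                        ∎
  where open ≤-Reasoning
kk-upper (suc e) N zero x≤ rewrite kk-0 (suc e) | *-zeroʳ e = z≤n
kk-upper (suc e) N x@(suc _) x≤ with cascade⁺ (suc e) x (s≤s z≤n)
... | a , x′ , eq , 0<x′ , x′≤ = begin
  (3 + e) * kk (suc e) x + (2 + e) * x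
    ≡⟨ cong (λ z → (3 + e) * kk (suc e) z + (2 + e) * z) eq ⟩
  (3 + e) * kk (suc e) (a choose (2 + e) + x′) + (2 + e) * (a choose (2 + e) + x′)
    ≡⟨ cong (λ z → (3 + e) * z + (2 + e) * (a choose (2 + e) + x′)) (kk-step e a x′≤) ⟩
  (3 + e) * (a choose (3 + e) + kk e x′) + (2 + e) * (a choose (2 + e) + x′)
    ≡⟨ l e (a choose (3 + e)) (a choose (2 + e)) (kk e x′) x′ ⟩
  ((3 + e) * (a choose (3 + e)) + (2 + e) * (a choose (2 + e))) + ((2 + e) * kk e x′ + suc e * x′) + (kk e x′ + x′)
    ≤⟨ +-mono-≤ (+-mono-≤ (≤-reflexive (choose-absorb a (2 + e))) (kk-upper e a x′ x′≤))
         (+-monoˡ-≤ x′ (≤-trans (kk-mono e x′≤) (≤-reflexive (kk-C e a)))) ⟩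
  a * (a choose (2 + e)) + a * x′ + (a choose (2 + e) + x′)
    ≡⟨ l′ a (a choose (2 + e)) x′ ⟩
  suc a * (a choose (2 + e) + x′)
    ≤⟨ *-monoˡ-≤ (a choose (2 + e) + x′) a<N ⟩
  N * (a choose (2 + e) + x′)
    ≡⟨ cong (N *_) eq ⟨
  N * x ∎
  where
  open ≤-Reasoning
  l : ∀ e A B g x → (3 + e) * (A + g) + (2 + e) * (B + x)
    ≡ ((3 + e) * A + (2 + e) * B) + ((2 + e) * g + suc e * x) + (g + x)
  l = solve-∀
  l′ : ∀ a B x → a * B + a * x + (B + x) ≡ suc a * (B + x)
  l′ = solve-∀
  a<N : a < N
  a<N = ≰⇒> λ N≤a → <-irrefl refl (begin-strict
    x                 ≤⟨ x≤ ⟩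
    N choose (2 + e)       ≤⟨ choose-monoˡ (2 + e) N≤a ⟩
    a choose (2 + e)       <⟨ m<m+n _ 0<x′ ⟩
    a choose (2 + e) + x′  ≡⟨ eq ⟨
    x                 ∎)

-- Converse of `kk-upper` up to a constant multiple of `x`: between two consecutive coefficients `x`
-- exceeds C(M, e + 1) by at most C(M, e), and M C(M, e) is of the order of C(M, e + 1).
kk-lower : ∀ e M x → M choose suc e ≤ x → x ≤ suc M choose suc e → M * x ≤ (2 + e) * kk e x + 2 * suc e * x
kk-lower e M x M≤ x≤ with suc e ≤? M
... | no M<d = ≤-trans (*-monoˡ-≤ x (≤-trans (<⇒≤ (≰⇒> M<d)) (m≤m+n (suc e) _))) (m≤n+m _ ((2 + e) * kk e x))
... | yes d≤M with m≤n⇒∃[o]m+o≡n d≤M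
... | o , refl = begin
  (suc e + o) * x
    ≡⟨ *-distribʳ-+ x (suc e) o ⟩
  suc e * x + o * x
    ≤⟨ +-monoʳ-≤ (suc e * x) (≤-trans (*-monoʳ-≤ o (≤-trans x≤ (≤-reflexive (pascal M e)))) key) ⟩
  suc e * x + ((2 + e) * kk e x + suc e * x)
    ≡⟨ l e x (kk e x) ⟩
  (2 + e) * kk e x + 2 * suc e * x ∎
  where
  open ≤-Reasoning
  l : ∀ e x g → suc e * x + ((2 + e) * g + suc e * x) ≡ (2 + e) * g + 2 * suc e * x
  l = solve-∀
  B D : ℕ
  B = M choose suc e
  D = M choose e
  oB : o * B ≡ (2 + e) * (M choose (2 + e))
  oB = +-cancelʳ-≡ (suc e * B) _ _ (trans (trans (+-comm (o * B) _) (sym (*-distribʳ-+ B (suc e) o))) (sym (choose-absorb M (suc e))))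
  oD : o * D ≤ suc e * B
  oD = +-cancelʳ-≤ (e * D) _ _ (≤-trans (≤-trans (≤-reflexive (sym (*-distribʳ-+ D o e)))
         (*-monoˡ-≤ D (≤-trans (n≤1+n (o + e)) (≤-reflexive (cong suc (+-comm o e)))))) (≤-reflexive (sym (choose-absorb M e))))
  key : o * (B + D) ≤ (2 + e) * kk e x + suc e * x
  key = begin
    o * (B + D)                               ≡⟨ *-distribˡ-+ o B D ⟩
    o * B + o * D                             ≤⟨ +-mono-≤ (≤-reflexive oB) oD ⟩
    (2 + e) * (M choose (2 + e)) + suc e * B       ≤⟨ +-mono-≤ (*-monoʳ-≤ (2 + e) (≤-trans (≤-reflexive (sym (kk-C e M))) (kk-mono e M≤))) (*-monoʳ-≤ (suc e) M≤) ⟩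
    (2 + e) * kk e x + suc e * x              ∎

-- Growth of binomial coefficients in the upper index

choose-up : ∀ n d → suc n * (n choose d) + d * (suc n choose d) ≡ suc n * (suc n choose d)
choose-up n d = begin
  suc n * (n choose d) + d * (suc n choose d)
    ≡⟨ cong (λ z → (n choose d) + z + d * (suc n choose d)) (choose-absorb n d) ⟨
  (n choose d) + (suc d * (n choose suc d) + d * (n choose d)) + d * (suc n choose d)
    ≡⟨ l d (n choose d) (n choose suc d) (suc n choose d) ⟩
  suc d * (n choose suc d + n choose d) + d * (suc n choose d)
    ≡⟨ cong (λ z → suc d * z + d * (suc n choose d)) (pascal n d) ⟨
  suc d * (suc n choose suc d) + d * (suc n choose d)
    ≡⟨ choose-absorb (suc n) d ⟩
  suc n * (suc n choose d) ∎
  where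
  open ≡-Reasoning
  l : ∀ d p q r → p + (suc d * q + d * p) + d * r ≡ suc d * (q + p) + d * r
  l = solve-∀

choose-absorb-∸ : ∀ n k → (n ∸ k) * (n choose k) ≡ suc k * (n choose suc k)
choose-absorb-∸ n k = begin
  (n ∸ k) * (n choose k)                                      ≡⟨ *-distribʳ-∸ (n choose k) n k ⟩
  n * (n choose k) ∸ k * (n choose k)                         ≡⟨ cong (_∸ k * (n choose k)) (choose-absorb n k) ⟨
  suc k * (n choose suc k) + k * (n choose k) ∸ k * (n choose k) ≡⟨ m+n∸n≡m _ (k * (n choose k)) ⟩
  suc k * (n choose suc k)                                    ∎
  where open ≡-Reasoning

choose-upper : ∀ n d → d ! * (n choose d) ≤ n ^ d
choose-upper n zero = ≤-reflexive (trans (+-identityʳ _) (choose-0 n))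
choose-upper n (suc d) = begin
  suc d ! * (n choose suc d)        ≡⟨ l (suc d) (d !) (n choose suc d) ⟩
  d ! * (suc d * (n choose suc d))  ≡⟨ cong (d ! *_) (choose-absorb-∸ n d) ⟨
  d ! * ((n ∸ d) * (n choose d))    ≤⟨ *-monoʳ-≤ (d !) (*-monoˡ-≤ (n choose d) (m∸n≤m n d)) ⟩
  d ! * (n * (n choose d))          ≡⟨ l′ (d !) n (n choose d) ⟩
  n * (d ! * (n choose d))          ≤⟨ *-monoʳ-≤ n (choose-upper n d) ⟩
  n ^ suc d                         ∎
  where
  open ≤-Reasoning
  l : ∀ a b c → a * b * c ≡ b * (a * c)
  l = solve-∀
  l′ : ∀ a b c → a * (b * c) ≡ b * (a * c)
  l′ = solve-∀

choose-lower : ∀ n d → (n ∸ d) ^ d ≤ d ! * (n choose d)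
choose-lower n zero = ≤-reflexive (sym (trans (+-identityʳ _) (choose-0 n)))
choose-lower n (suc d) = begin
  (n ∸ suc d) * (n ∸ suc d) ^ d     ≤⟨ *-mono-≤ le (^-monoˡ-≤ d le) ⟩
  (n ∸ d) * (n ∸ d) ^ d             ≤⟨ *-monoʳ-≤ (n ∸ d) (choose-lower n d) ⟩
  (n ∸ d) * (d ! * (n choose d))    ≡⟨ l (n ∸ d) (d !) (n choose d) ⟩
  d ! * ((n ∸ d) * (n choose d))    ≡⟨ cong (d ! *_) (choose-absorb-∸ n d) ⟩
  d ! * (suc d * (n choose suc d))  ≡⟨ l′ (suc d) (d !) (n choose suc d) ⟨
  suc d ! * (n choose suc d)        ∎
  where
  open ≤-Reasoning
  le : n ∸ suc d ≤ n ∸ d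
  le = ∸-monoʳ-≤ n (n≤1+n d)
  l : ∀ a b c → a * (b * c) ≡ b * (a * c)
  l = solve-∀
  l′ : ∀ a b c → a * b * c ≡ b * (a * c)
  l′ = solve-∀

-- By `choose-up`, one step upwards adds at most the fraction d / m of the new value; `J` such steps
-- are summed.
choose-growth : ∀ d m J → m * ((J + m) choose d) ≤ m * (m choose d) + J * d * ((J + m) choose d)
choose-growth d m zero = m≤m+n _ _
choose-growth d m (suc J) = begin
  m * X′                         ≤⟨ one-step ⟩
  m * X + d * X′                 ≤⟨ +-monoˡ-≤ (d * X′) (choose-growth d m J) ⟩
  m * (m choose d) + J * d * X + d * X′
    ≤⟨ +-monoˡ-≤ (d * X′) (+-monoʳ-≤ (m * (m choose d)) (*-monoʳ-≤ (J * d) X≤X′)) ⟩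
  m * (m choose d) + J * d * X′ + d * X′  ≡⟨ l (m * (m choose d)) J d X′ ⟩
  m * (m choose d) + suc J * d * X′ ∎
  where
  open ≤-Reasoning
  X = (J + m) choose d
  X′ = suc (J + m) choose d
  X≤X′ : X ≤ X′
  X≤X′ = choose-monoˡ-suc (J + m) d
  l : ∀ p J d x → p + J * d * x + d * x ≡ p + suc J * d * x
  l = solve-∀
  l₁ : ∀ m J x → m * x + suc J * x ≡ suc (J + m) * x
  l₁ = solve-∀
  l₂ : ∀ m J x y d → suc (J + m) * x + d * y ≡ m * x + d * y + suc J * x
  l₂ = solve-∀
  one-step : m * X′ ≤ m * X + d * X′
  one-step = +-cancelʳ-≤ (suc J * X′) _ _ (begin
    m * X′ + suc J * X′            ≡⟨ l₁ m J X′ ⟩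
    suc (J + m) * X′               ≡⟨ choose-up (J + m) d ⟨
    suc (J + m) * X + d * X′       ≡⟨ l₂ m J X X′ d ⟩
    m * X + d * X′ + suc J * X     ≤⟨ +-monoʳ-≤ (m * X + d * X′) (*-monoʳ-≤ (suc J) X≤X′) ⟩
    m * X + d * X′ + suc J * X′    ∎)

choose-double : ∀ d m J → 0 < m → 2 * (J * d) ≤ m → (J + m) choose d ≤ 2 * (m choose d)
choose-double d m@(suc _) J _ small = *-cancelˡ-≤ m (+-cancelʳ-≤ (m * X) _ _ (begin
  m * X + m * X                        ≡⟨ l m X ⟩
  2 * (m * X)                          ≤⟨ *-monoʳ-≤ 2 (choose-growth d m J) ⟩
  2 * (m * (m choose d) + J * d * X)   ≡⟨ l′ (m choose d) (J * d) X m ⟩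
  m * (2 * (m choose d)) + 2 * (J * d) * X ≤⟨ +-monoʳ-≤ (m * (2 * (m choose d))) (*-monoˡ-≤ X small) ⟩
  m * (2 * (m choose d)) + m * X       ∎))
  where
  open ≤-Reasoning
  X = (J + m) choose d
  l : ∀ m x → m * x + m * x ≡ 2 * (m * x)
  l = solve-∀
  l′ : ∀ c j x m → 2 * (m * c + j * x) ≡ m * (2 * c) + 2 * j * x
  l′ = solve-∀

-- Contrapositive of `choose-double`: raising the upper index by `J` at most doubles the
-- coefficient, so a number that is at most half of `b` has a root at least `J` lower.
root-gap : ∀ d J {M a x b} → 2 * x ≤ b → b ≤ suc M choose d → a choose d < x →
           2 * (J * d) + J ≤ M → a + J ≤ M
root-gap d J {M} {a} {x} {b} 2x≤b b≤ a< M≥ = ≮⇒≥ λ M<a+J → <-irrefl refl (begin-strict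
  b                     ≤⟨ b≤ ⟩
  suc M choose d        ≤⟨ choose-monoˡ d M<a+J ⟩
  (a + J) choose d      ≡⟨ cong (_choose d) (+-comm a J) ⟩
  (J + a) choose d      ≤⟨ choose-double d a J (≤-<-trans z≤n (a> M<a+J)) (<⇒≤ (a> M<a+J)) ⟩
  2 * (a choose d)      <⟨ *-monoʳ-< 2 a< ⟩
  2 * x                 ≤⟨ 2x≤b ⟩
  b                     ∎)
  where
  open ≤-Reasoning
  a> : M < a + J → 2 * (J * d) < a
  a> M<a+J = +-cancelʳ-< J _ a (≤-<-trans M≥ M<a+J)

-- The comparison `final` in `kk-drop` amounts to a ≥ 2 d² + 2 d - 2.
drop-threshold : ℕ → ℕ
drop-threshold d = 2 * (d * d) + 2 * d

-- For x about a choose (e + 1), the quotient kk e x / x is about a / (e + 2), and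
-- raising e by one makes it smaller by more than 1.
kk-drop : ∀ e x → drop-threshold (2 + e) choose suc e ≤ x → x + kk (suc e) x ≤ kk e x
kk-drop e x x≥ with cascade e x
... | a , x′ , eq , x′< = *-cancelˡ-≤ (D * suc D) (+-cancelʳ-≤ slack _ _ (begin
  D * suc D * (x + g₁) + slack
    ≡⟨ l₁ e x g₁ ⟩
  D * ((3 + e) * g₁ + D * x) + x * (D * suc D + 2 * (suc D * suc e))
    ≤⟨ +-monoˡ-≤ _ (*-monoʳ-≤ D (kk-upper (suc e) (suc a) x x≤′)) ⟩
  D * (suc a * x) + x * (D * suc D + 2 * (suc D * suc e))
    ≤⟨ final ⟩
  suc D * (a * x) + D * D * x
    ≤⟨ +-monoˡ-≤ (D * D * x) (*-monoʳ-≤ (suc D) (kk-lower e a x lo hi)) ⟩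
  suc D * ((2 + e) * g₀ + 2 * suc e * x) + D * D * x
    ≡⟨ l₂ e x g₀ ⟩
  D * suc D * g₀ + slack ∎))
  where
  open ≤-Reasoning
  D = 2 + e
  g₀ = kk e x
  g₁ = kk (suc e) x
  slack = D * D * x + 2 * (suc D * suc e) * x
  l₁ : ∀ e x g → (2 + e) * (3 + e) * (x + g) + ((2 + e) * (2 + e) * x + 2 * ((3 + e) * suc e) * x)
     ≡ (2 + e) * ((3 + e) * g + (2 + e) * x) + x * ((2 + e) * (3 + e) + 2 * ((3 + e) * suc e))
  l₁ = solve-∀
  l₂ : ∀ e x g → (3 + e) * ((2 + e) * g + 2 * suc e * x) + (2 + e) * (2 + e) * x
     ≡ (2 + e) * (3 + e) * g + ((2 + e) * (2 + e) * x + 2 * ((3 + e) * suc e) * x)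
  l₂ = solve-∀
  lo : a choose suc e ≤ x
  lo = ≤-trans (m≤m+n _ x′) (≤-reflexive (sym eq))
  x< : x < suc a choose suc e
  x< = subst₂ _<_ (sym eq) (sym (pascal a e)) (+-monoʳ-< (a choose suc e) x′<)
  hi : x ≤ suc a choose suc e
  hi = <⇒≤ x<
  a≥ : drop-threshold D ≤ a
  a≥ = ≮⇒≥ λ a< → <-irrefl refl (<-≤-trans x< (≤-trans (choose-monoˡ (suc e) a<) x≥))
  x≤′ : x ≤ suc a choose (2 + e)
  x≤′ = ≤-trans hi (*-cancelˡ-≤ (2 + e) (begin
    (2 + e) * (suc a choose suc e)           ≤⟨ *-monoˡ-≤ (suc a choose suc e) 2+e≤ ⟩
    (suc a ∸ suc e) * (suc a choose suc e)   ≡⟨ choose-absorb-∸ (suc a) (suc e) ⟩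
    (2 + e) * (suc a choose (2 + e))         ∎))
    where
    2+e≤ : 2 + e ≤ a ∸ e
    2+e≤ = m+n≤o⇒m≤o∸n (2 + e) (≤-trans (≤-trans (m≤m+n (2 + e + e) _) (≤-reflexive (h e))) a≥)
      where
      h : ∀ e → (2 + e + e) + (2 * ((2 + e) * (2 + e)) + 2) ≡ 2 * ((2 + e) * (2 + e)) + 2 * (2 + e)
      h = solve-∀
  final : D * (suc a * x) + x * (D * suc D + 2 * (suc D * suc e)) ≤ suc D * (a * x) + D * D * x
  final with m≤n⇒∃[o]m+o≡n a≥
  ... | o , refl = ≤-trans (m≤m+n _ (x * (2 + o))) (≤-reflexive (h e o x))
    where
    h : ∀ e o x → (2 + e) * (suc (2 * ((2 + e) * (2 + e)) + 2 * (2 + e) + o) * x) + x * ((2 + e) * (3 + e) + 2 * ((3 + e) * suc e)) + x * (2 + o)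
      ≡ (3 + e) * ((2 * ((2 + e) * (2 + e)) + 2 * (2 + e) + o) * x) + (2 + e) * (2 + e) * x
    h = solve-∀

^-distribʳ-* : ∀ k m n → (m * n) ^ k ≡ m ^ k * n ^ k
^-distribʳ-* zero m n = refl
^-distribʳ-* (suc k) m n = trans (cong (m * n *_) (^-distribʳ-* k m n)) (h″ m n (m ^ k) (n ^ k))
  where
  h″ : ∀ m n p q → m * n * (p * q) ≡ m * p * (n * q)
  h″ = solve-∀

-- The two size conditions force a ≥ 5 d + 4 and then M + 1 ≤ 3 (a - d), so the power bounds
-- `choose-upper` and `choose-lower` differ by the factor `3 ^ d`.
choose-triple : ∀ d M a → 12 * d + 12 ≤ M → M < suc a + suc a + (2 * d + 2) →
                suc M choose d ≤ 3 ^ d * (a choose d)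
choose-triple d M a M≥12 M< = *-cancelˡ-≤ (d !) {{d !≢0}} (begin
  d ! * (suc M choose d)              ≤⟨ choose-upper (suc M) d ⟩
  suc M ^ d                           ≤⟨ ^-monoˡ-≤ d (linear a≥ M<) ⟩
  (3 * (a ∸ d)) ^ d                   ≡⟨ ^-distribʳ-* d 3 (a ∸ d) ⟩
  3 ^ d * (a ∸ d) ^ d                 ≤⟨ *-monoʳ-≤ (3 ^ d) (choose-lower a d) ⟩
  3 ^ d * (d ! * (a choose d))        ≡⟨ h (3 ^ d) (d !) (a choose d) ⟩
  d ! * (3 ^ d * (a choose d))        ∎)
  where
  open ≤-Reasoning
  h : ∀ a b c → a * (b * c) ≡ b * (a * c)
  h = solve-∀
  h₁ : ∀ d → 2 * (5 * d + 4) + (2 * d + 4) ≡ 12 * d + 12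
  h₁ = solve-∀
  h₂ : ∀ a d → suc a + suc a + (2 * d + 2) ≡ 2 * a + (2 * d + 4)
  h₂ = solve-∀
  a≥ : 5 * d + 4 ≤ a
  a≥ = *-cancelˡ-≤ 2 (+-cancelʳ-≤ (2 * d + 4) _ _ (begin
    2 * (5 * d + 4) + (2 * d + 4)   ≡⟨ h₁ d ⟩
    12 * d + 12                     ≤⟨ M≥12 ⟩
    M                               ≤⟨ <⇒≤ M< ⟩
    suc a + suc a + (2 * d + 2)     ≡⟨ h₂ a d ⟩
    2 * a + (2 * d + 4)             ∎))
  h₃ : ∀ d o → suc (5 * d + 4 + o) + suc (5 * d + 4 + o) + (2 * d + 2) + o ≡ 3 * (4 * d + 4 + o)
  h₃ = solve-∀
  h₄ : ∀ d o → 4 * d + 4 + o + d ≡ 5 * d + 4 + o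
  h₄ = solve-∀
  linear : ∀ {a} → 5 * d + 4 ≤ a → M < suc a + suc a + (2 * d + 2) → suc M ≤ 3 * (a ∸ d)
  linear a≥ M< with m≤n⇒∃[o]m+o≡n a≥
  ... | o , refl = begin
    suc M                                                   ≤⟨ M< ⟩
    suc (5 * d + 4 + o) + suc (5 * d + 4 + o) + (2 * d + 2)     ≤⟨ m≤m+n _ o ⟩
    suc (5 * d + 4 + o) + suc (5 * d + 4 + o) + (2 * d + 2) + o ≡⟨ h₃ d o ⟩
    3 * (4 * d + 4 + o)                                     ≡⟨ cong (3 *_) (m+n∸n≡m (4 * d + 4 + o) d) ⟨
    3 * (4 * d + 4 + o + d ∸ d)                             ≡⟨ cong (λ z → 3 * (z ∸ d)) (h₄ d o) ⟩
    3 * (5 * d + 4 + o ∸ d)                                 ∎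

-- The two demands are those of `slopes-first-larger` and `slopes-second-larger` on the gap between
-- roots.
gap : ∀ d Q → ∃ λ J → suc d * 3 ^ d + (2 * d + 2) ≤ J × suc d + (2 * d + 2) * Q ≤ J
gap d Q = _ , m≤m+n _ _ , m≤n+m _ (suc d * 3 ^ d + (2 * d + 2))

-- Merging the two parts of a split family

module _ (e d : ℕ) (d≡ : d ≡ 2 + e) where
  private
    upper : ∀ N x → x ≤ N choose d → suc d * kk (suc e) x + d * x ≤ N * x
    upper rewrite d≡ = kk-upper (suc e)

    lower : ∀ M x → M choose d ≤ x → x ≤ suc M choose d → M * x ≤ suc d * kk (suc e) x + 2 * d * x
    lower rewrite d≡ = kk-lower (suc e)

    drop : ∀ x → drop-threshold d choose suc e ≤ x → x + kk (suc e) x ≤ kk e x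
    drop rewrite d≡ = kk-drop e

    split⁺ : ∀ x → 0 < x → ∃ λ a → a choose d < x × x ≤ suc a choose d
    split⁺ x 0<x rewrite d≡ with cascade⁺ (suc e) x 0<x
    ... | a , x′ , eq , 0<x′ , x′≤ = a
      , subst (a choose (2 + e) <_) (sym eq) (m<m+n _ 0<x′)
      , subst₂ _≤_ (sym eq) (sym (pascal a (suc e))) (+-monoʳ-≤ (a choose (2 + e)) x′≤)

    threshold>0 : drop-threshold d choose suc e > 0
    threshold>0 rewrite d≡ = choose-pos (≤-trans (m≤m+n (suc e) _) (≤-reflexive (h e)))
      where
      h : ∀ e → suc e + (2 * ((2 + e) * (2 + e)) + 3 + e) ≡ 2 * ((2 + e) * (2 + e)) + 2 * (2 + e)
      h = solve-∀

  -- Multiplied by `suc d`, each value of `kk` is root times argument up to multiples of the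
  -- argument, so only a linear inequality between the roots is left. Its last summand on the left
  -- collects the errors of `kk-upper` and `kk-lower` and the extra `b₁`.
  kk-merge-from-slopes : ∀ M N₀ N₁ b₀ b₁ →
    b₀ ≤ N₀ choose d → b₁ ≤ N₁ choose d → M choose d ≤ b₀ + b₁ → b₀ + b₁ ≤ suc M choose d →
    N₀ * b₀ + N₁ * b₁ + (d * b₀ + suc (2 * d) * b₁) ≤ M * (b₀ + b₁) →
    kk (suc e) b₀ + b₁ + kk (suc e) b₁ ≤ kk (suc e) (b₀ + b₁)
  kk-merge-from-slopes M N₀ N₁ b₀ b₁ b₀≤ b₁≤ M≤ ≤M key = *-cancelˡ-≤ (suc d) (+-cancelʳ-≤ (2 * d * (b₀ + b₁)) _ _ (begin
    suc d * (kk (suc e) b₀ + b₁ + kk (suc e) b₁) + 2 * d * (b₀ + b₁)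
      ≡⟨ l d b₀ b₁ (kk (suc e) b₀) (kk (suc e) b₁) ⟩
    (suc d * kk (suc e) b₀ + d * b₀) + (suc d * kk (suc e) b₁ + d * b₁) + (d * b₀ + suc (2 * d) * b₁)
      ≤⟨ +-monoˡ-≤ _ (+-mono-≤ (upper N₀ b₀ b₀≤) (upper N₁ b₁ b₁≤)) ⟩
    N₀ * b₀ + N₁ * b₁ + (d * b₀ + suc (2 * d) * b₁)
      ≤⟨ key ⟩
    M * (b₀ + b₁)
      ≤⟨ lower M (b₀ + b₁) M≤ ≤M ⟩
    suc d * kk (suc e) (b₀ + b₁) + 2 * d * (b₀ + b₁) ∎))
    where
    open ≤-Reasoning
    l : ∀ d b₀ b₁ g₀ g₁ → suc d * (g₀ + b₁ + g₁) + 2 * d * (b₀ + b₁)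
      ≡ (suc d * g₀ + d * b₀) + (suc d * g₁ + d * b₁) + (d * b₀ + suc (2 * d) * b₁)
    l = solve-∀

  private
    slope-tail : ∀ M N b₀ b₁ → suc d * b₀ + (N + suc (2 * d)) * b₁ ≤ M * b₁ →
      suc M * b₀ + N * b₁ + (d * b₀ + suc (2 * d) * b₁) ≤ M * (b₀ + b₁)
    slope-tail M N b₀ b₁ h = begin
      suc M * b₀ + N * b₁ + (d * b₀ + suc (2 * d) * b₁)   ≡⟨ l M N d b₀ b₁ ⟩
      M * b₀ + (suc d * b₀ + (N + suc (2 * d)) * b₁)      ≤⟨ +-monoʳ-≤ (M * b₀) h ⟩
      M * b₀ + M * b₁                                     ≡⟨ *-distribˡ-+ M b₀ b₁ ⟨
      M * (b₀ + b₁)                                       ∎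
      where
      open ≤-Reasoning
      l : ∀ M N d x y → suc M * x + N * y + (d * x + suc (2 * d) * y) ≡ M * x + (suc d * x + (N + suc (2 * d)) * y)
      l = solve-∀

    -- Here `suc d * b₀` is itself at most about `N * b₁`, so a root `N` below roughly half of `M`
    -- leaves room for both terms.
    slopes-tiny : ∀ M N b₀ b₁ → b₁ ≤ N choose d → b₀ ≤ b₁ + kk (suc e) b₁ → N + N + (2 * d + 2) ≤ M →
      suc d * b₀ + (N + suc (2 * d)) * b₁ ≤ M * b₁
    slopes-tiny M N b₀ b₁ b₁≤ b₀≤ tiny = begin
      suc d * b₀ + (N + suc (2 * d)) * b₁                             ≤⟨ +-monoˡ-≤ _ (*-monoʳ-≤ (suc d) b₀≤) ⟩
      suc d * (b₁ + kk (suc e) b₁) + (N + suc (2 * d)) * b₁           ≡⟨ l₁ d b₁ (kk (suc e) b₁) N ⟩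
      (suc d * kk (suc e) b₁ + d * b₁) + (N + (2 * d + 2)) * b₁       ≤⟨ +-monoˡ-≤ _ (upper N b₁ b₁≤) ⟩
      N * b₁ + (N + (2 * d + 2)) * b₁                                 ≡⟨ l₂ N (2 * d + 2) b₁ ⟩
      (N + N + (2 * d + 2)) * b₁                                      ≤⟨ *-monoˡ-≤ b₁ tiny ⟩
      M * b₁                                                          ∎
      where
      open ≤-Reasoning
      l₁ : ∀ d b g N → suc d * (b + g) + (N + suc (2 * d)) * b ≡ (suc d * g + d * b) + (N + (2 * d + 2)) * b
      l₁ = solve-∀
      l₂ : ∀ N c b → N * b + (N + c) * b ≡ (N + N + c) * b
      l₂ = solve-∀

    -- Since `b₀` is at most a constant times `b₁`, the gap `J` in the root of `b₁` pays for all
    -- terms in `b₀`.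
    slopes-first-larger : ∀ {J} M a b₀ b₁ → suc d * 3 ^ d + (2 * d + 2) ≤ J → b₀ ≤ 3 ^ d * b₁ → a + J ≤ M →
      suc d * b₀ + (suc a + suc (2 * d)) * b₁ ≤ M * b₁
    slopes-first-larger {J} M a b₀ b₁ J≥ b₀≤ a+J≤M = begin
      suc d * b₀ + (suc a + suc (2 * d)) * b₁                ≤⟨ +-monoˡ-≤ _ (*-monoʳ-≤ (suc d) b₀≤) ⟩
      suc d * (3 ^ d * b₁) + (suc a + suc (2 * d)) * b₁      ≡⟨ l₁ d (3 ^ d) b₁ a ⟩
      (a + (suc d * 3 ^ d + (2 * d + 2))) * b₁               ≤⟨ *-monoˡ-≤ b₁ (≤-trans (+-monoʳ-≤ a J≥) a+J≤M) ⟩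
      M * b₁                                                 ∎
      where
      open ≤-Reasoning
      l₁ : ∀ d t b a → suc d * (t * b) + (suc a + suc (2 * d)) * b ≡ (a + (suc d * t + (2 * d + 2))) * b
      l₁ = solve-∀

    -- The gap `J` in the root of `b₀` gains `J * b₀`, and `b₀` has at least the share 1 / Q of the
    -- sum, enough to cover the terms in `b₁`.
    slopes-second-larger : ∀ {J} M Q a b₀ b₁ → suc d + (2 * d + 2) * Q ≤ J → b₀ + b₁ ≤ Q * b₀ → a + J ≤ M →
      suc a * b₀ + suc M * b₁ + (d * b₀ + suc (2 * d) * b₁) ≤ M * (b₀ + b₁)
    slopes-second-larger {J} M Q a b₀ b₁ J≥ b≤ a+J≤M = begin
      suc a * b₀ + suc M * b₁ + (d * b₀ + suc (2 * d) * b₁)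
        ≡⟨ l₁ M a d b₀ b₁ ⟩
      (2 * d + 2) * b₁ + (a + suc d) * b₀ + M * b₁
        ≤⟨ +-monoˡ-≤ (M * b₁) (+-monoˡ-≤ ((a + suc d) * b₀) (*-monoʳ-≤ (2 * d + 2) (≤-trans (m≤n+m b₁ b₀) b≤))) ⟩
      (2 * d + 2) * (Q * b₀) + (a + suc d) * b₀ + M * b₁
        ≡⟨ cong (_+ M * b₁) (l₂ d Q a b₀) ⟩
      (a + (suc d + (2 * d + 2) * Q)) * b₀ + M * b₁
        ≤⟨ +-monoˡ-≤ (M * b₁) (*-monoˡ-≤ b₀ (≤-trans (+-monoʳ-≤ a J≥) a+J≤M)) ⟩
      M * b₀ + M * b₁
        ≡⟨ *-distribˡ-+ M b₀ b₁ ⟨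
      M * (b₀ + b₁) ∎
      where
      open ≤-Reasoning
      l₁ : ∀ M a d x y → suc a * x + suc M * y + (d * x + suc (2 * d) * y) ≡ (2 * d + 2) * y + (a + suc d) * x + M * y
      l₁ = solve-∀
      l₂ : ∀ d Q a x → (2 * d + 2) * (Q * x) + (a + suc d) * x ≡ (a + (suc d + (2 * d + 2) * Q)) * x
      l₂ = solve-∀

  opaque
    -- The middle `b₁` pays for members that contain the core and have a selected element inside it.
    -- If `b₁ + kk (suc e) b₁ ≤ b₀`, this number is below both entries of the minimum in
    -- `kk-excess`, the second by `kk-drop`. Otherwise the roots decide. The smaller part is at most
    -- half of the sum, so `root-gap` puts its root `J` below `M`. When `b₀` is the smaller, its
    -- share 1 / Q is enough; when `b₁` is, either its root is tiny or `choose-triple` bounds `b₀`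
    -- by a multiple of `b₁`.
    kk-merge : ∀ Q → ∃ λ M* → ∀ M b₀ b₁ → M* ≤ M →
      M choose d ≤ b₀ + b₁ → b₀ + b₁ ≤ suc M choose d →
      b₀ + b₁ ≤ Q * b₀ → drop-threshold d choose suc e ≤ b₁ →
      kk (suc e) b₀ + b₁ + kk (suc e) b₁ ≤ kk (suc e) (b₀ + b₁)
    kk-merge Q with gap d Q
    ... | J , J≥₁ , J≥₂ = 2 * (J * d) + J + (12 * d + 12) , merge
      where
      merge : ∀ M b₀ b₁ → 2 * (J * d) + J + (12 * d + 12) ≤ M →
        M choose d ≤ b₀ + b₁ → b₀ + b₁ ≤ suc M choose d →
        b₀ + b₁ ≤ Q * b₀ → drop-threshold d choose suc e ≤ b₁ →
        kk (suc e) b₀ + b₁ + kk (suc e) b₁ ≤ kk (suc e) (b₀ + b₁)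
      merge M b₀ b₁ M≥ lo hi b≤Qb₀ b₁≥ = case (b₁ + kk (suc e) b₁ ≤? b₀)
        where
        M≥J : 2 * (J * d) + J ≤ M
        M≥J = ≤-trans (m≤m+n (2 * (J * d) + J) (12 * d + 12)) M≥
        M≥12 : 12 * d + 12 ≤ M
        M≥12 = ≤-trans (m≤n+m (12 * d + 12) (2 * (J * d) + J)) M≥
        b₀>0 : 0 < b₀
        b₀>0 = n≢0⇒n>0 λ { refl → <-irrefl refl (≤-trans (≤-trans threshold>0 b₁≥) (≤-trans b≤Qb₀ (≤-reflexive (*-zeroʳ Q)))) }
        b₀≤ : b₀ ≤ suc M choose d
        b₀≤ = ≤-trans (m≤m+n b₀ b₁) hi
        b₁≤ : b₁ ≤ suc M choose d
        b₁≤ = ≤-trans (m≤n+m b₁ b₀) hi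
        double₁ : b₁ ≤ b₀ → 2 * b₁ ≤ b₀ + b₁
        double₁ b₁≤b₀ = ≤-trans (≤-reflexive (cong (b₁ +_) (+-identityʳ b₁))) (+-monoˡ-≤ b₁ b₁≤b₀)
        double₀ : b₀ ≤ b₁ → 2 * b₀ ≤ b₀ + b₁
        double₀ b₀≤b₁ = +-monoʳ-≤ b₀ (≤-trans (≤-reflexive (+-identityʳ b₀)) b₀≤b₁)

        comparable : b₀ ≤ b₁ + kk (suc e) b₁ → b₁ ≤ b₀ ⊎ b₀ ≤ b₁ →
          ∃ (λ a → a choose d < b₀ × b₀ ≤ suc a choose d) →
          ∃ (λ a → a choose d < b₁ × b₁ ≤ suc a choose d) →
          kk (suc e) b₀ + b₁ + kk (suc e) b₁ ≤ kk (suc e) (b₀ + b₁)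
        comparable _ (inj₂ b₀≤b₁) (a , <b₀ , b₀≤′) _ =
          kk-merge-from-slopes M (suc a) (suc M) b₀ b₁ b₀≤′ b₁≤ lo hi
            (slopes-second-larger M Q a b₀ b₁ J≥₂ b≤Qb₀ (root-gap d J (double₀ b₀≤b₁) hi <b₀ M≥J))
        comparable b₀≤g (inj₁ b₁≤b₀) _ (a , <b₁ , b₁≤′) =
          kk-merge-from-slopes M (suc M) (suc a) b₀ b₁ b₀≤ b₁≤′ lo hi
            (slope-tail M (suc a) b₀ b₁ (by-size (suc a + suc a + (2 * d + 2) ≤? M)))
          where
          by-size : Dec (suc a + suc a + (2 * d + 2) ≤ M) → suc d * b₀ + (suc a + suc (2 * d)) * b₁ ≤ M * b₁
          by-size (yes tiny) = slopes-tiny M (suc a) b₀ b₁ b₁≤′ b₀≤g tiny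
          by-size (no M<) = slopes-first-larger M a b₀ b₁ J≥₁
            (≤-trans b₀≤ (≤-trans (choose-triple d M a M≥12 (≰⇒> M<)) (*-monoʳ-≤ (3 ^ d) (<⇒≤ <b₁))))
            (root-gap d J (double₁ b₁≤b₀) hi <b₁ M≥J)

        case : Dec (b₁ + kk (suc e) b₁ ≤ b₀) → kk (suc e) b₀ + b₁ + kk (suc e) b₁ ≤ kk (suc e) (b₀ + b₁)
        case (no large) = comparable (<⇒≤ (≰⇒> large)) (≤-total b₁ b₀) (split⁺ b₀ b₀>0) (split⁺ b₁ (≤-trans threshold>0 b₁≥))
        case (yes small) = begin
          kk (suc e) b₀ + b₁ + kk (suc e) b₁         ≡⟨ +-assoc (kk (suc e) b₀) _ _ ⟩
          kk (suc e) b₀ + (b₁ + kk (suc e) b₁)       ≤⟨ +-monoʳ-≤ (kk (suc e) b₀) (⊓-glb small (drop b₁ b₁≥)) ⟩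
          kk (suc e) b₀ + (b₀ ⊓ kk e b₁)             ≤⟨ kk-excess e b₀ b₁ ⟩
          kk (suc e) (b₁ + b₀)                       ≡⟨ cong (kk (suc e)) (+-comm b₁ b₀) ⟩
          kk (suc e) (b₀ + b₁)                       ∎
          where open ≤-Reasoning

private
  variable
    a p q : Level
    X Y : Set a
    xs ys : List X

-- Counting in lists

∈-remove : ∀ {x y : X} as {bs} → x ∈ as ++ y ∷ bs → x ≢ y → x ∈ as ++ bs
∈-remove as x∈ x≢y with ∈-++⁻ as x∈
... | inj₁ x∈as = ∈-++⁺ˡ x∈as
... | inj₂ (here x≡y) = contradiction x≡y x≢y
... | inj₂ (there x∈bs) = ∈-++⁺ʳ as x∈bs

-- A relation instead of a function: images may be chosen freely, because each image determines its
-- source.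
injection-length : ∀ {r} {R : X → Y → Set r} → Unique xs →
  (∀ {x} → x ∈ xs → ∃ λ y → y ∈ ys × R x y) →
  (∀ {x x′ y} → x ∈ xs → x′ ∈ xs → R x y → R x′ y → x ≡ x′) → length xs ≤ length ys
injection-length {xs = []} _ _ _ = z≤n
injection-length {xs = x ∷ xs} {R = R} (x∉xs ∷ xs!) image inj with image (here refl)
... | y , y∈ys , Rxy with ∈-∃++ y∈ys
... | as , bs , refl = subst (suc (length xs) ≤_) (sym (trans (length-++ as) (trans (+-suc (length as) _) (cong suc (sym (length-++ as))))))
  (s≤s (injection-length xs! image′ (λ p q → inj (there p) (there q))))
  where
  image′ : ∀ {x′} → x′ ∈ xs → ∃ λ y′ → y′ ∈ as ++ bs × R x′ y′
  image′ x′∈ with image (there x′∈)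
  ... | y′ , y′∈ , Rx′y′ = y′ , ∈-remove as y′∈ (λ { refl → All.lookup x∉xs x′∈ (inj (here refl) (there x′∈) Rxy Rx′y′) }) , Rx′y′

⊆-length : Unique xs → (∀ {x} → x ∈ xs → x ∈ ys) → length xs ≤ length ys
⊆-length xs! sub = injection-length {R = _≡_} xs! (λ {x} x∈ → x , sub x∈ , refl) (λ { _ _ refl refl → refl })

∉⇒Unique : ∀ {x : X} → x ∉ xs → Unique xs → Unique (x ∷ xs)
∉⇒Unique x∉ xs! = All.tabulate (λ y∈ x≡y → x∉ (subst (_∈ _) (sym x≡y) y∈)) ∷ xs!

module _ {X : Set a} where

  count : {P : Pred X p} → Decidable P → List X → ℕ
  count P? xs = length (filter P? xs)

  module _ {P : Pred X p} (P? : Decidable P) where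

    count-injection : ∀ {Y : Set q} {xs : List X} {ys : List Y} {r} {R : X → Y → Set r} → Unique xs →
      (∀ {x} → x ∈ xs → P x → ∃ λ y → y ∈ ys × R x y) →
      (∀ {x x′ y} → x ∈ xs → x′ ∈ xs → P x → P x′ → R x y → R x′ y → x ≡ x′) → count P? xs ≤ length ys
    count-injection {xs = xs} xs! image inj = injection-length (Uniqueₚ.filter⁺ P? xs!)
      (λ x∈ → let x∈xs , Px = ∈-filter⁻ P? {xs = xs} x∈ in image x∈xs Px)
      (λ x∈ x′∈ → let x∈xs , Px = ∈-filter⁻ P? {xs = xs} x∈ ; x′∈xs , Px′ = ∈-filter⁻ P? {xs = xs} x′∈ in
        inj x∈xs x′∈xs Px Px′)

    count-pos : ∀ {xs x} → x ∈ xs → P x → 1 ≤ count P? xs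
    count-pos x∈ Px = ∈-length (∈-filter⁺ P? x∈ Px)

    count-¬ : ∀ xs → count P? xs + count (¬? ∘ P?) xs ≡ length xs
    count-¬ [] = refl
    count-¬ (x ∷ xs) with does (P? x)
    ... | true = cong suc (count-¬ xs)
    ... | false = trans (+-suc _ _) (cong suc (count-¬ xs))

    count-none : ∀ xs → (∀ {x} → x ∈ xs → ¬ P x) → count P? xs ≡ 0
    count-none [] none = refl
    count-none (x ∷ xs) none with P? x
    ... | yes Px = contradiction Px (none (here refl))
    ... | no _ = count-none xs (none ∘ there)

  module _ {P : Pred X p} {Q : Pred X q} (P? : Decidable P) (Q? : Decidable Q) where

    count-mono : ∀ xs → (∀ {x} → x ∈ xs → P x → Q x) → count P? xs ≤ count Q? xs
    count-mono [] _ = z≤n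
    count-mono (x ∷ xs) P⇒Q with P? x | Q? x
    ... | yes Px | yes Qx = s≤s (count-mono xs (P⇒Q ∘ there))
    ... | yes Px | no ¬Qx = contradiction (P⇒Q (here refl) Px) ¬Qx
    ... | no ¬Px | yes Qx = m≤n⇒m≤1+n (count-mono xs (P⇒Q ∘ there))
    ... | no ¬Px | no ¬Qx = count-mono xs (P⇒Q ∘ there)

    count-∪ : ∀ {r} {R : Pred X r} (R? : Decidable R) xs →
              (∀ {x} → x ∈ xs → P x → Q x ⊎ R x) → count P? xs ≤ count Q? xs + count R? xs
    count-∪ R? [] _ = z≤n
    count-∪ R? (x ∷ xs) P⇒ with P? x | Q? x | R? x | count-∪ R? xs (P⇒ ∘ there)
    ... | yes _ | yes _ | yes _ | ih = s≤s (≤-trans ih (+-monoʳ-≤ _ (n≤1+n _)))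
    ... | yes _ | yes _ | no _  | ih = s≤s ih
    ... | yes _ | no _  | yes _ | ih = ≤-trans (s≤s ih) (≤-reflexive (sym (+-suc _ _)))
    ... | yes Px | no ¬Q | no ¬R | ih with P⇒ (here refl) Px
    ... | inj₁ Qx = contradiction Qx ¬Q
    ... | inj₂ Rx = contradiction Rx ¬R
    count-∪ R? (x ∷ xs) P⇒ | no _ | yes _ | yes _ | ih = m≤n⇒m≤1+n (≤-trans ih (+-monoʳ-≤ _ (n≤1+n _)))
    count-∪ R? (x ∷ xs) P⇒ | no _ | yes _ | no _  | ih = m≤n⇒m≤1+n ih
    count-∪ R? (x ∷ xs) P⇒ | no _ | no _  | yes _ | ih = ≤-trans ih (+-monoʳ-≤ _ (n≤1+n _))
    count-∪ R? (x ∷ xs) P⇒ | no _ | no _  | no _  | ih = ih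

    count-filter : ∀ xs → (∀ {x} → x ∈ xs → P x → Q x) → count P? xs ≤ count P? (filter Q? xs)
    count-filter [] _ = z≤n
    count-filter (x ∷ xs) P⇒Q with Q? x
    ... | yes Qx with does (P? x)
    ... | true = s≤s (count-filter xs (P⇒Q ∘ there))
    ... | false = count-filter xs (P⇒Q ∘ there)
    count-filter (x ∷ xs) P⇒Q | no ¬Qx with P? x
    ... | yes Px = contradiction (P⇒Q (here refl) Px) ¬Qx
    ... | no _ = count-filter xs (P⇒Q ∘ there)

module _ {X : Set a} {Y : Set p} {R : X → Y → Set q} (R? : ∀ x y → Dec (R x y)) where

  private
    shift : ∀ a b c {d} → a + c ≡ d → a + (b + c) ≡ b + d
    shift a b c eq = trans (l a b c) (cong (b +_) eq)
      where
      l : ∀ a b c → a + (b + c) ≡ b + (a + c)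
      l = solve-∀

    add-row : ∀ x xs ys → count (R? x) ys + sum (map (λ y → count (λ x → R? x y) xs) ys)
                        ≡ sum (map (λ y → count (λ x → R? x y) (x ∷ xs)) ys)
    add-row x xs [] = refl
    add-row x xs (y ∷ ys) with does (R? x y)
    ... | true  = cong suc (shift (count (R? x) ys) _ _ (add-row x xs ys))
    ... | false = shift (count (R? x) ys) _ _ (add-row x xs ys)

  sum-swap : ∀ xs ys → sum (map (λ x → count (R? x) ys) xs) ≡ sum (map (λ y → count (λ x → R? x y) xs) ys)
  sum-swap [] [] = refl
  sum-swap [] (y ∷ ys) = sum-swap [] ys
  sum-swap (x ∷ xs) ys = trans (cong (count (R? x) ys +_) (sum-swap xs ys)) (add-row x xs ys)

  -- The factor `m` is a denominator: each `x` has at least `lo / m` partners. It is a factorial in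
  -- the counts of walks.
  double-count : ∀ m {lo hi} xs ys →
    (∀ {x} → x ∈ xs → lo ≤ m * count (R? x) ys) →
    (∀ {y} → y ∈ ys → count (λ x → R? x y) xs ≤ hi) → lo * length xs ≤ m * (hi * length ys)
  double-count m {lo} {hi} xs ys lower upper = begin
    lo * length xs                                          ≤⟨ below xs lower ⟩
    m * sum (map (λ x → count (R? x) ys) xs)                ≡⟨ cong (m *_) (sum-swap xs ys) ⟩
    m * sum (map (λ y → count (λ x → R? x y) xs) ys)        ≤⟨ *-monoʳ-≤ m (above ys upper) ⟩
    m * (hi * length ys)                                    ∎
    where
    open ≤-Reasoning
    below : ∀ {f : X → ℕ} xs → (∀ {x} → x ∈ xs → lo ≤ m * f x) → lo * length xs ≤ m * sum (map f xs)
    below [] _ = ≤-trans (≤-reflexive (*-zeroʳ lo)) z≤n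
    below {f} (x ∷ xs) h = begin
      lo * suc (length xs)            ≡⟨ *-suc lo _ ⟩
      lo + lo * length xs             ≤⟨ +-mono-≤ (h (here refl)) (below xs (h ∘ there)) ⟩
      m * f x + m * sum (map f xs)    ≡⟨ *-distribˡ-+ m (f x) _ ⟨
      m * sum (map f (x ∷ xs))        ∎
    above : ∀ {f : Y → ℕ} ys → (∀ {y} → y ∈ ys → f y ≤ hi) → sum (map f ys) ≤ hi * length ys
    above [] _ = z≤n
    above (y ∷ ys) h = ≤-trans (+-mono-≤ (h (here refl)) (above ys (h ∘ there))) (≤-reflexive (sym (*-suc hi _)))

-- Finite sets of natural numbers

unique-elements : ∀ A → Unique (elements A)
unique-elements (mkFinSet es s) = AllPairs.map <⇒≢ (Linkedₚ.Linked⇒AllPairs <-trans (recompute (Linked.linked? _<?_ es) s))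

private
  sorted-ext : ∀ {xs ys} → AllPairs _<_ xs → AllPairs _<_ ys →
               (∀ {x} → x ∈ xs → x ∈ ys) → (∀ {x} → x ∈ ys → x ∈ xs) → xs ≡ ys
  sorted-ext [] [] _ _ = refl
  sorted-ext [] (_ ∷ _) _ g with () ← g (here refl)
  sorted-ext (_ ∷ _) [] f _ with () ← f (here refl)
  sorted-ext {x ∷ xs} {y ∷ ys} (x< ∷ xs<) (y< ∷ ys<) f g with heads
    where
    heads : x ≡ y
    heads with f (here refl) | g (here refl)
    ... | here x≡y | _ = x≡y
    ... | there _ | here y≡x = sym y≡x
    ... | there x∈ys | there y∈xs = contradiction (All.lookup x< y∈xs) (<-asym (All.lookup y< x∈ys))
  ... | refl = cong (x ∷_) (sorted-ext xs< ys< (tail x< f) (tail y< g))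
    where
    tail : ∀ {xs ys} → All (x <_) xs → (∀ {z} → z ∈ x ∷ xs → z ∈ x ∷ ys) → ∀ {z} → z ∈ xs → z ∈ ys
    tail x< h z∈ with h (there z∈)
    ... | here refl = contradiction (All.lookup x< z∈) (<-irrefl refl)
    ... | there z∈ys = z∈ys

set-ext : ∀ {A B} → A ⊆ B → B ⊆ A → A ≡ B
set-ext {mkFinSet xs s} {mkFinSet ys t} f g
  with sorted-ext (Linkedₚ.Linked⇒AllPairs <-trans (recompute (Linked.linked? _<?_ xs) s))
                  (Linkedₚ.Linked⇒AllPairs <-trans (recompute (Linked.linked? _<?_ ys) t)) f g
... | refl = refl

opaque
  _≟ˢ_ : (A B : FinSet) → Dec (A ≡ B)
  mkFinSet xs s ≟ˢ mkFinSet ys t with ≡-dec _≟_ xs ys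
  ... | yes refl = yes refl
  ... | no xs≢ys = no λ { refl → xs≢ys refl }

private
  member≤sum : ∀ {x} xs → x ∈ xs → x ≤ sum xs
  member≤sum (y ∷ xs) (here refl) = m≤m+n y _
  member≤sum (y ∷ xs) (there x∈) = ≤-trans (member≤sum xs x∈) (m≤n+m _ y)

opaque
  -- The sum serves as an upper bound for all entries; filtering an initial segment sorts the list
  -- and removes duplicates at once.
  fromList : List ℕ → FinSet
  fromList xs = mkFinSet (filter (_∈ℕ? xs) (upTo (suc (sum xs))))
    (Linkedₚ.filter⁺ (_∈ℕ? xs) <-trans (Linkedₚ.applyUpTo⁺₂ id _ n<1+n))

  ∈-fromList⁺ : ∀ {x xs} → x ∈ xs → x ∈ elements (fromList xs)
  ∈-fromList⁺ {xs = xs} x∈ = ∈-filter⁺ (_∈ℕ? xs) (∈-upTo⁺ (s≤s (member≤sum xs x∈))) x∈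

  ∈-fromList⁻ : ∀ {x xs} → x ∈ elements (fromList xs) → x ∈ xs
  ∈-fromList⁻ {xs = xs} x∈ = proj₂ (∈-filter⁻ (_∈ℕ? xs) {xs = upTo (suc (sum xs))} x∈)

size-fromList : ∀ {xs} → Unique xs → ∣ fromList xs ∣ ≡ length xs
size-fromList {xs} xs! = ≤-antisym (⊆-length (unique-elements (fromList xs)) ∈-fromList⁻) (⊆-length xs! ∈-fromList⁺)

import Data.List.Membership.DecPropositional _≟ˢ_ as DecMembershipˢ

opaque
  _∈ˢ?_ : (A : FinSet) (As : List FinSet) → Dec (A ∈ As)
  _∈ˢ?_ = DecMembershipˢ._∈?_

infixl 6 _-_

opaque
  _-_ : FinSet → ℕ → FinSet
  A - v = fromList (filter (λ x → ¬? (x ≟ v)) (elements A))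

  ∈-minus⁺ : ∀ {x v} A → x ∈ elements A → x ≢ v → x ∈ elements (A - v)
  ∈-minus⁺ {v = v} A x∈ x≢v = ∈-fromList⁺ (∈-filter⁺ (λ x → ¬? (x ≟ v)) x∈ x≢v)

  ∈-minus⁻ : ∀ {x v} A → x ∈ elements (A - v) → x ∈ elements A × x ≢ v
  ∈-minus⁻ {v = v} A x∈ = ∈-filter⁻ (λ x → ¬? (x ≟ v)) {xs = elements A} (∈-fromList⁻ x∈)

minus-injective : ∀ {A A′ v} → v ∈ elements A → v ∈ elements A′ → A - v ≡ A′ - v → A ≡ A′
minus-injective {A} {A′} {v} v∈A v∈A′ eq = set-ext (half v∈A′ eq) (half v∈A (sym eq))
  where
  half : ∀ {A A′} → v ∈ elements A′ → A - v ≡ A′ - v → A ⊆ A′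
  half {A} {A′} v∈A′ eq {x} x∈A with x ≟ v
  ... | yes refl = v∈A′
  ... | no x≢v = proj₁ (∈-minus⁻ A′ (subst (λ B → x ∈ elements B) eq (∈-minus⁺ A x∈A x≢v)))

minus-cancel : ∀ {A v w} → v ∈ elements A → A - v ≡ A - w → v ≡ w
minus-cancel {A} {v} {w} v∈A eq with v ≟ w
... | yes v≡w = v≡w
... | no v≢w = contradiction refl (proj₂ (∈-minus⁻ A (subst (λ B → v ∈ elements B) (sym eq) (∈-minus⁺ A v∈A v≢w))))

size-minus : ∀ {A v} → v ∈ elements A → suc ∣ A - v ∣ ≡ ∣ A ∣
size-minus {A} {v} v∈A = ≤-antisym
  (⊆-length (∉⇒Unique (λ v∈ → proj₂ (∈-minus⁻ A v∈) refl) (unique-elements (A - v)))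
     λ { (here refl) → v∈A ; (there x∈) → proj₁ (∈-minus⁻ A x∈) })
  (⊆-length {ys = v ∷ elements (A - v)} (unique-elements A) λ {x} x∈ → split x∈ (x ≟ v))
  where
  split : ∀ {x} → x ∈ elements A → Dec (x ≡ v) → x ∈ v ∷ elements (A - v)
  split x∈ (yes refl) = here refl
  split x∈ (no x≢v) = there (∈-minus⁺ A x∈ x≢v)

⊆-length⁻ : ∀ {xs ys : List ℕ} → Unique xs → (∀ {x} → x ∈ xs → x ∈ ys) → length ys ≤ length xs → ∀ {y} → y ∈ ys → y ∈ xs
⊆-length⁻ {xs} xs! sub len {y} y∈ with y ∈ℕ? xs
... | yes y∈xs = y∈xs
... | no y∉xs = contradiction
  (≤-trans (⊆-length (∉⇒Unique y∉xs xs!) (λ { (here refl) → y∈ ; (there x∈) → sub x∈ })) len) (<-irrefl refl)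

escape : (_≟X_ : (x y : X) → Dec (x ≡ y)) → ∀ {xs ys : List X} → Unique xs → length ys < length xs → ∃ λ x → x ∈ xs × x ∉ ys
escape {X = X} _≟X_ {xs} {ys} xs! len with Any.any? (λ x → ¬? (x ∈? ys)) xs
  where open import Data.List.Membership.DecPropositional _≟X_ using (_∈?_)
... | yes some = let x , x∈ , x∉ = find some in x , x∈ , x∉
... | no none = contradiction (<-≤-trans len (⊆-length xs! λ {x} x∈ → decidable-stable (x ∈? ys) λ x∉ → none (lose x∈ x∉))) (<-irrefl refl)
  where open import Data.List.Membership.DecPropositional _≟X_ using (_∈?_)

-- Facets

_Facet_ : FinSet → FinSet → Set
B Facet A = B ∈ map (A -_) (elements A)

_Facet?_ : ∀ B A → Dec (B Facet A)
B Facet? A = B ∈ˢ? map (A -_) (elements A)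

in? : (ℬ : List FinSet) (A : FinSet) (v : ℕ) → Dec (A - v ∈ ℬ)
in? ℬ A v = (A - v) ∈ˢ? ℬ

facet : ∀ {A v} → v ∈ elements A → (A - v) Facet A
facet {A} v∈A = ∈-map⁺ (A -_) v∈A

facet-root : ∀ {A B} → B Facet A → ∃ λ v → v ∈ elements A × B ≡ A - v
facet-root {A} = ∈-map⁻ (A -_)

facets-in : ∀ ℬ A → count (in? ℬ A) (elements A) ≤ count (_Facet? A) ℬ
facets-in ℬ A = count-injection (in? ℬ A) {R = λ v B → B ≡ A - v} (unique-elements A)
  (λ {v} v∈A v∈ → A - v , ∈-filter⁺ (_Facet? A) v∈ (facet v∈A) , refl)
  (λ { v∈A _ _ _ eq eq′ → minus-cancel v∈A (trans (sym eq) eq′) })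

-- A set is the union of any two distinct facets, so two sets that share two facets coincide.
two-facets : ∀ {A A′ B B′} → B ≢ B′ → B Facet A → B′ Facet A → B Facet A′ → B′ Facet A′ → A ⊆ A′
two-facets {A} {A′} {B} {B′} B≢B′ f f′ g g′ {x} x∈A
  with facet-root f | facet-root f′ | facet-root g | facet-root g′
... | v , _ , refl | v′ , _ , refl | w , _ , eq | w′ , _ , eq′ with x ≟ v
... | no x≢v = proj₁ (∈-minus⁻ A′ (subst (λ B → x ∈ elements B) eq (∈-minus⁺ A x∈A x≢v)))
... | yes refl = proj₁ (∈-minus⁻ A′ (subst (λ B → x ∈ elements B) eq′ (∈-minus⁺ A x∈A λ { refl → B≢B′ refl })))

-- By `two-facets`, a member of `𝒜` above `B` is determined by a second facet, so `B` lies under at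
-- most `length ℬ ∸ 1` members, while every member is counted at least twice. This settles k = 2
-- exactly and bounds `𝒜` for larger k whenever `ℬ` is small.
pair-bound : ∀ {𝒜 ℬ} → Unique 𝒜 → Unique ℬ →
  (∀ {A} → A ∈ 𝒜 → 2 ≤ count (in? ℬ A) (elements A)) → length 𝒜 ≤ kk 0 (length ℬ)
pair-bound {𝒜} {ℬ} 𝒜! ℬ! two = *-cancelˡ-≤ 2 (begin
  2 * length 𝒜                          ≤⟨ double-count (λ A B → B Facet? A) 1 𝒜 ℬ lower upper ⟩
  1 * ((length ℬ ∸ 1) * length ℬ)       ≡⟨ +-identityʳ _ ⟩
  (length ℬ ∸ 1) * length ℬ             ≡⟨ cong ((length ℬ ∸ 1) *_) (choose-1 (length ℬ)) ⟨
  (length ℬ ∸ 1) * (length ℬ choose 1)  ≡⟨ choose-absorb-∸ (length ℬ) 1 ⟩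
  2 * (length ℬ choose 2)               ≡⟨ cong (2 *_) (choose≡kk (length ℬ)) ⟩
  2 * kk 0 (length ℬ)                   ∎)
  where
  open ≤-Reasoning
  choose≡kk : ∀ n → n choose 2 ≡ kk 0 n
  choose≡kk n = sym (kk-zero n)
  lower : ∀ {A} → A ∈ 𝒜 → 2 ≤ 1 * count (_Facet? A) ℬ
  lower {A} A∈ = ≤-trans (≤-trans (two A∈) (facets-in ℬ A)) (≤-reflexive (sym (+-identityʳ _)))
  upper : ∀ {B} → B ∈ ℬ → count (B Facet?_) 𝒜 ≤ length ℬ ∸ 1
  upper {B} B∈ = ≤-trans
    (count-injection (B Facet?_) {ys = filter (λ B′ → ¬? (B′ ≟ˢ B)) ℬ} {R = λ A B′ → B′ Facet A × B ≢ B′} 𝒜! other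
      (λ { _ _ f g (f′ , B≢) (g′ , _) → set-ext (two-facets B≢ f f′ g g′) (two-facets B≢ g g′ f f′) }))
    (m+n≤o⇒m≤o∸n _ (≤-trans (≤-reflexive (+-comm _ 1)) (filter-notAll (λ B′ → ¬? (B′ ≟ˢ B)) ℬ (lose B∈ λ B≢B → B≢B refl))))
    where
    other : ∀ {A} → A ∈ 𝒜 → B Facet A → ∃ λ B′ → B′ ∈ filter (λ B′ → ¬? (B′ ≟ˢ B)) ℬ × (B′ Facet A × B ≢ B′)
    other {A} A∈ f with facet-root f
    ... | v , v∈A , refl with escape _≟_ {ys = v ∷ []} (Uniqueₚ.filter⁺ (in? ℬ A) (unique-elements A)) (two A∈)
    ... | w , w∈ , w∉ with ∈-filter⁻ (in? ℬ A) {xs = elements A} w∈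
    ... | w∈A , A-w∈ = A - w
      , ∈-filter⁺ (λ B′ → ¬? (B′ ≟ˢ (A - v))) A-w∈ (λ eq → w∉ (here (minus-cancel w∈A eq)))
      , facet w∈A , λ eq → w∉ (here (sym (minus-cancel v∈A eq)))

-- Kruskal-Katona in a link

outside? : (K : List ℕ) → (x : ℕ) → Dec (x ∉ K)
outside? K x = ¬? (x ∈ℕ? K)

count-outside : ∀ {K v} A → v ∈ elements A → v ∉ K →
  suc (count (outside? (v ∷ K)) (elements A)) ≡ count (outside? K) (elements A)
count-outside {K} {v} A v∈A v∉K = ≤-antisym
  (⊆-length (∉⇒Unique (λ v∈ → proj₂ (∈-filter⁻ (outside? (v ∷ K)) {xs = elements A} v∈) (here refl))
                      (Uniqueₚ.filter⁺ (outside? (v ∷ K)) (unique-elements A)))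
    λ { (here refl) → ∈-filter⁺ (outside? K) v∈A v∉K
      ; (there x∈) → let x∈A , x∉ = ∈-filter⁻ (outside? (v ∷ K)) {xs = elements A} x∈ in
                     ∈-filter⁺ (outside? K) x∈A (x∉ ∘ there) })
  (⊆-length {ys = v ∷ filter (outside? (v ∷ K)) (elements A)} (Uniqueₚ.filter⁺ (outside? K) (unique-elements A))
    λ {x} x∈ → let x∈A , x∉K = ∈-filter⁻ (outside? K) {xs = elements A} x∈ in split x∈A x∉K (x ≟ v))
  where
  split : ∀ {x} → x ∈ elements A → x ∉ K → Dec (x ≡ v) → x ∈ v ∷ filter (outside? (v ∷ K)) (elements A)
  split _ _ (yes refl) = here refl
  split x∈A x∉K (no x≢v) = there (∈-filter⁺ (outside? (v ∷ K)) x∈A λ { (here eq) → x≢v eq ; (there x∈K) → x∉K x∈K })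

-- The Kruskal–Katona theorem for the link of K: kk-excess is exactly the inequality
-- that results from splitting by the members that contain a vertex v.
kruskal-katona : ∀ e K ℋ 𝒜 → Unique 𝒜 → Unique ℋ →
  (∀ {A} → A ∈ 𝒜 → count (outside? K) (elements A) ≡ 2 + e) →
  (∀ {A x} → A ∈ 𝒜 → x ∈ elements A → x ∉ K → A - x ∈ ℋ) → length 𝒜 ≤ kk e (length ℋ)
kruskal-katona zero K ℋ 𝒜 𝒜! ℋ! size covered = pair-bound 𝒜! ℋ! λ {A} A∈ →
  ≤-trans (≤-reflexive (sym (size A∈))) (count-mono (outside? K) (in? ℋ A) (elements A) λ x∈A x∉K → covered A∈ x∈A x∉K)
kruskal-katona (suc e) K ℋ₀ 𝒜₀ = go ℋ₀ 𝒜₀ (<-wellFounded (length 𝒜₀))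
  where
  go : ∀ ℋ 𝒜 → Acc _<_ (length 𝒜) → Unique 𝒜 → Unique ℋ →
    (∀ {A} → A ∈ 𝒜 → count (outside? K) (elements A) ≡ 3 + e) →
    (∀ {A x} → A ∈ 𝒜 → x ∈ elements A → x ∉ K → A - x ∈ ℋ) → length 𝒜 ≤ kk (suc e) (length ℋ)
  go ℋ [] _ _ _ _ _ = z≤n
  go ℋ 𝒜@(A₀ ∷ _) (acc rs) 𝒜! ℋ! size covered
    with escape _≟_ {ys = []} (Uniqueₚ.filter⁺ (outside? K) (unique-elements A₀)) (≤-trans (s≤s z≤n) (≤-reflexive (sym (size (here refl)))))
  ... | v , v∈ , _ with ∈-filter⁻ (outside? K) {xs = elements A₀} v∈
  ... | v∈A₀ , v∉K = begin
    length 𝒜                             ≡⟨ count-¬ has 𝒜 ⟨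
    length 𝒜₁ + length 𝒜₂                ≡⟨ +-comm (length 𝒜₁) _ ⟩
    length 𝒜₂ + length 𝒜₁                ≤⟨ +-mono-≤ without (⊓-glb with-v with-v′) ⟩
    kk (suc e) (length ℋ₂) + (length ℋ₂ ⊓ kk e (length ℋ₁)) ≤⟨ kk-excess e (length ℋ₂) (length ℋ₁) ⟩
    kk (suc e) (length ℋ₁ + length ℋ₂)   ≡⟨ cong (kk (suc e)) (count-¬ has ℋ) ⟩
    kk (suc e) (length ℋ)                ∎
    where
    open ≤-Reasoning
    has : (A : FinSet) → Dec (v ∈ elements A)
    has A = v ∈ℕ? elements A
    𝒜₁ = filter has 𝒜
    𝒜₂ = filter (¬? ∘ has) 𝒜
    ℋ₁ = filter has ℋ
    ℋ₂ = filter (¬? ∘ has) ℋ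
    smaller : length 𝒜₂ < length 𝒜
    smaller = filter-notAll (¬? ∘ has) 𝒜 (here λ v∉A₀ → v∉A₀ v∈A₀)
    without : length 𝒜₂ ≤ kk (suc e) (length ℋ₂)
    without = go ℋ₂ 𝒜₂ (rs smaller) (Uniqueₚ.filter⁺ (¬? ∘ has) 𝒜!) (Uniqueₚ.filter⁺ (¬? ∘ has) ℋ!)
      (λ A∈ → size (proj₁ (∈-filter⁻ (¬? ∘ has) {xs = 𝒜} A∈)))
      (λ {A} A∈ x∈A x∉K → let A∈𝒜 , v∉A = ∈-filter⁻ (¬? ∘ has) {xs = 𝒜} A∈ in
        ∈-filter⁺ (¬? ∘ has) (covered A∈𝒜 x∈A x∉K) (v∉A ∘ proj₁ ∘ ∈-minus⁻ A))
    -- Removing `v` is injective on the sets that contain it and lands among the members of `ℋ`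
    -- without `v`.
    with-v : length 𝒜₁ ≤ length ℋ₂
    with-v = count-injection has {R = λ A B → B ≡ A - v} 𝒜!
      (λ {A} A∈ v∈A → A - v , ∈-filter⁺ (¬? ∘ has) (covered A∈ v∈A v∉K) (λ v∈ → proj₂ (∈-minus⁻ A v∈) refl) , refl)
      (λ { _ _ v∈A v∈A′ eq eq′ → minus-injective v∈A v∈A′ (trans (sym eq) eq′) })
    -- Here `v` joins `K` instead of being deleted: the same sets form an instance with one element
    -- fewer outside, and `A - x` still contains `v` for every other `x`.
    with-v′ : length 𝒜₁ ≤ kk e (length ℋ₁)
    with-v′ = kruskal-katona e (v ∷ K) ℋ₁ 𝒜₁ (Uniqueₚ.filter⁺ has 𝒜!) (Uniqueₚ.filter⁺ has ℋ!)
      (λ {A} A∈ → let A∈𝒜 , v∈A = ∈-filter⁻ has {xs = 𝒜} A∈ in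
        suc-injective (trans (count-outside A v∈A v∉K) (size A∈𝒜)))
      (λ {A} {x} A∈ x∈A x∉ → let A∈𝒜 , v∈A = ∈-filter⁻ has {xs = 𝒜} A∈ in
        ∈-filter⁺ has (covered A∈𝒜 x∈A (x∉ ∘ there)) (∈-minus⁺ A v∈A λ { refl → x∉ (here refl) }))

-- Walks and heavy cores

⊆-count : ∀ {X : Set a} {P : Pred X p} {Q : Pred X q} (P? : Decidable P) (Q? : Decidable Q) {xs ys} → Unique xs →
  (∀ {x} → x ∈ xs → P x → x ∈ ys × Q x) → count P? xs ≤ count Q? ys
⊆-count P? Q? {xs} xs! sub = count-injection P? {R = _≡_} xs!
  (λ {x} x∈ Px → let x∈ys , Qx = sub x∈ Px in x , ∈-filter⁺ Q? x∈ys Qx , refl)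
  (λ { _ _ _ _ refl refl → refl })

fibre-bound : ∀ {X : Set a} {Y : Set p} {R : X → Y → Set q} (R? : ∀ x y → Dec (R x y)) {hi} xs ys →
  (∀ {x} → x ∈ xs → ∃ λ y → y ∈ ys × R x y) →
  (∀ {y} → y ∈ ys → count (λ x → R? x y) xs ≤ hi) → length xs ≤ hi * length ys
fibre-bound R? {hi} xs ys image fibres = begin
  length xs               ≡⟨ +-identityʳ _ ⟨
  1 * length xs           ≤⟨ double-count R? 1 xs ys
                               (λ {x} x∈ → let y , y∈ , Rxy = image x∈ in ≤-trans (count-pos (R? x) y∈ Rxy) (≤-reflexive (sym (+-identityʳ _))))
                               fibres ⟩
  1 * (hi * length ys)    ≡⟨ +-identityʳ _ ⟩
  hi * length ys          ∎
  where open ≤-Reasoning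

diff : FinSet → FinSet → ℕ
diff A B = count (outside? (elements B)) (elements A)

diff-self : ∀ A → diff A A ≡ 0
diff-self A = count-none (outside? (elements A)) (elements A) λ x∈A x∉A → x∉A x∈A

diff-minusʳ : ∀ A v w B → diff B (A - w) ≤ suc (diff B (A - v))
diff-minusʳ A v w B = ⊆-length {ys = w ∷ filter (outside? (elements (A - v))) (elements B)}
  (Uniqueₚ.filter⁺ (outside? (elements (A - w))) (unique-elements B))
  λ {x} x∈ → let x∈B , x∉ = ∈-filter⁻ (outside? (elements (A - w))) {xs = elements B} x∈ in split x∈B x∉ (x ≟ w)
  where
  split : ∀ {x} → x ∈ elements B → x ∉ elements (A - w) → Dec (x ≡ w) → x ∈ w ∷ filter (outside? (elements (A - v))) (elements B)
  split _ _ (yes refl) = here refl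
  split x∈B x∉ (no x≢w) = there (∈-filter⁺ (outside? (elements (A - v))) x∈B λ x∈ → x∉ (∈-minus⁺ A (proj₁ (∈-minus⁻ A x∈)) x≢w))

diff-minusˡ : ∀ A v w B → diff (A - w) B ≤ suc (diff (A - v) B)
diff-minusˡ A v w B = ⊆-length {ys = v ∷ filter (outside? (elements B)) (elements (A - v))}
  (Uniqueₚ.filter⁺ (outside? (elements B)) (unique-elements (A - w)))
  λ {x} x∈ → let x∈A-w , x∉ = ∈-filter⁻ (outside? (elements B)) {xs = elements (A - w)} x∈ in split (proj₁ (∈-minus⁻ A x∈A-w)) x∉ (x ≟ v)
  where
  split : ∀ {x} → x ∈ elements A → x ∉ elements B → Dec (x ≡ v) → x ∈ v ∷ filter (outside? (elements B)) (elements (A - v))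
  split _ _ (yes refl) = here refl
  split x∈A x∉ (no x≢v) = there (∈-filter⁺ (outside? (elements B)) (∈-minus⁺ A x∈A x≢v) x∉)

-- S selects, for each A, the elements whose removal is recorded.
module System (S : FinSet → List ℕ) (d : ℕ) where

  record Sys (𝒜 ℬ : List FinSet) : Set where
    field
      𝒜!    : Unique 𝒜
      S!     : ∀ {A} → A ∈ 𝒜 → Unique (S A)
      S-size : ∀ {A} → A ∈ 𝒜 → length (S A) ≡ suc d
      S-⊆    : ∀ {A v} → A ∈ 𝒜 → v ∈ S A → v ∈ elements A
      S-in   : ∀ {A v} → A ∈ 𝒜 → v ∈ S A → A - v ∈ ℬ

  open Sys

  restrict : ∀ {𝒜 ℬ 𝒜′ ℬ′} → Sys 𝒜 ℬ → Unique 𝒜′ → (∀ {A} → A ∈ 𝒜′ → A ∈ 𝒜) →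
    (∀ {A v} → A ∈ 𝒜′ → v ∈ S A → A - v ∈ ℬ′) → Sys 𝒜′ ℬ′
  restrict sys 𝒜′! sub in′ = record
    { 𝒜! = 𝒜′! ; S! = S! sys ∘ sub ; S-size = S-size sys ∘ sub ; S-⊆ = S-⊆ sys ∘ sub ; S-in = in′ }

  _Under_ : FinSet → FinSet → Set
  B Under A = B ∈ map (A -_) (S A)

  opaque
    _Under?_ : ∀ B A → Dec (B Under A)
    B Under? A = B ∈ˢ? map (A -_) (S A)

  under-root : ∀ {A B} → B Under A → ∃ λ v → v ∈ S A × B ≡ A - v
  under-root {A} = ∈-map⁻ (A -_)

  degree : List FinSet → FinSet → ℕ
  degree 𝒜 B = count (B Under?_) 𝒜

  MinDegree : ℕ → List FinSet → Set
  MinDegree n 𝒜 = ∀ {A v} → A ∈ 𝒜 → v ∈ S A → n ≤ degree 𝒜 (A - v)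

  -- A system records no set sizes, so the differences in both directions are bounded. The first
  -- counts the elements added on a walk, the second serves to recover a core.
  Near : List ℕ → ℕ → FinSet → FinSet → Set
  Near X j B B′ = All (_∈ elements B′) X × diff B′ B ≤ j × diff B B′ ≤ j

  opaque
    Near? : ∀ X j B B′ → Dec (Near X j B B′)
    Near? X j B B′ = All.all? (_∈ℕ? elements B′) X ×-dec (diff B′ B ≤? j ×-dec diff B B′ ≤? j)

  -- B′ is reached from B = A - w by way of A - v; the elements X added by earlier
  -- steps and the new element w are kept.
  Step : List ℕ → ℕ → FinSet → FinSet → FinSet → Set
  Step X j B A B′ = Any (λ w → B ≡ A - w × Any (λ v → Near (w ∷ X) j (A - v) B′) (S A)) (S A)

  opaque
    Step? : ∀ X j B A B′ → Dec (Step X j B A B′)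
    Step? X j B A B′ = Any.any? (λ w → (B ≟ˢ (A - w)) ×-dec Any.any? (λ v → Near? (w ∷ X) j (A - v) B′) (S A)) (S A)

  step⇒near : ∀ {X j B A B′} → Step X j B A B′ → Near X (suc j) B B′
  step⇒near {A = A} {B′} step with find step
  ... | w , _ , refl , step′ with find step′
  ... | v , _ , _ ∷ X⊆ , near₁ , near₂ = X⊆
    , ≤-trans (diff-minusʳ A v w B′) (s≤s near₁) , ≤-trans (diff-minusˡ A v w B′) (s≤s near₂)

  -- There are at least `n` members `A = B + w` above `B`, and from each the walk continues at some
  -- `A - v` with `w` added to the protected elements. An endpoint `B′` contains `w`, which is not
  -- in `B`, and `w` determines `A`; as at most `suc j` elements of `B′` lie outside `B`, at most
  -- `suc j` members `A` lead to `B′`. Repetition turns these multiplicities into `j !`.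
  reach : ∀ {𝒜 ℬ n} → Sys 𝒜 ℬ → MinDegree n 𝒜 → ∀ j X B → B ∈ ℬ → n ≤ degree 𝒜 B →
    (∀ {x} → x ∈ X → x ∈ elements B) → length X + j ≤ d → n ^ j ≤ j ! * count (Near? X j B) ℬ
  reach sys min zero X B B∈ _ X⊆B _ = ≤-trans
    (count-pos (Near? X 0 B) B∈ (All.tabulate X⊆B , ≤-reflexive (diff-self B) , ≤-reflexive (diff-self B)))
    (≤-reflexive (sym (+-identityʳ _)))
  reach {𝒜} {ℬ} {n} sys min (suc j) X B B∈ deg X⊆B len = begin
    n * n ^ j                          ≡⟨ *-comm n _ ⟩
    n ^ j * n                          ≤⟨ *-monoʳ-≤ (n ^ j) deg ⟩
    n ^ j * length above               ≤⟨ double-count (Step? X j B) (j !) above near lower upper ⟩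
    j ! * (suc j * length near)        ≡⟨ l (j !) (suc j) (length near) ⟩
    suc j * j ! * length near          ∎
    where
    open ≤-Reasoning
    l : ∀ x y z → x * (y * z) ≡ y * x * z
    l = solve-∀
    above = filter (B Under?_) 𝒜
    near = filter (Near? X (suc j) B) ℬ
    lower : ∀ {A} → A ∈ above → n ^ j ≤ j ! * count (Step? X j B A) near
    lower {A} A∈ with ∈-filter⁻ (B Under?_) {xs = 𝒜} A∈
    ... | A∈𝒜 , under with under-root under
    -- At most `d` elements are to be protected, and `S A` has `suc d`, so some selected `v` can
    -- still be removed.
    ... | w , w∈S , refl with escape _≟_ {ys = w ∷ X} (S! sys A∈𝒜)
            (≤-trans (s≤s (≤-trans (≤-trans (s≤s (m≤m+n _ j)) (≤-reflexive (sym (+-suc (length X) j)))) len)) (≤-reflexive (sym (S-size sys A∈𝒜))))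
    ... | v , v∈S , v∉ = ≤-trans
      (reach sys min j (w ∷ X) (A - v) (S-in sys A∈𝒜 v∈S) (min A∈𝒜 v∈S)
        (λ { (here refl) → ∈-minus⁺ A (S-⊆ sys A∈𝒜 w∈S) (λ { refl → v∉ (here refl) })
           ; (there x∈X) → ∈-minus⁺ A (proj₁ (∈-minus⁻ A (X⊆B x∈X))) (λ { refl → v∉ (there x∈X) }) })
        (≤-trans (≤-reflexive (sym (+-suc (length X) j))) len))
      (*-monoʳ-≤ (j !) (≤-trans
        (count-mono (Near? (w ∷ X) j (A - v)) (Step? X j (A - w) A) ℬ (λ _ nr → lose w∈S (refl , lose v∈S nr)))
        (count-filter (Step? X j (A - w) A) (Near? X (suc j) (A - w)) ℬ λ {B′} _ → step⇒near {X} {j} {A - w} {A} {B′})))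
    upper : ∀ {B′} → B′ ∈ near → count (λ A → Step? X j B A B′) above ≤ suc j
    upper {B′} B′∈ = ≤-trans
      (count-injection (λ A → Step? X j B A B′) {ys = filter (outside? (elements B)) (elements B′)}
        {R = λ A w → w ∈ S A × B ≡ A - w} (Uniqueₚ.filter⁺ (B Under?_) (𝒜! sys)) added
        (λ { A∈ A′∈ _ _ (w∈ , eq) (w∈′ , eq′) → minus-injective
               (S-⊆ sys (proj₁ (∈-filter⁻ (B Under?_) {xs = 𝒜} A∈)) w∈)
               (S-⊆ sys (proj₁ (∈-filter⁻ (B Under?_) {xs = 𝒜} A′∈)) w∈′) (trans (sym eq) eq′) }))
      (proj₁ (proj₂ (proj₂ (∈-filter⁻ (Near? X (suc j) B) {xs = ℬ} B′∈))))
      where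
      added : ∀ {A} → A ∈ above → Step X j B A B′ →
              ∃ λ w → w ∈ filter (outside? (elements B)) (elements B′) × (w ∈ S A × B ≡ A - w)
      added {A} A∈ step with find step
      ... | w , w∈S , refl , step′ with find step′
      ... | v , _ , w∈B′ ∷ _ , _ = w
        , ∈-filter⁺ (outside? (elements (A - w))) w∈B′ (λ w∈ → proj₂ (∈-minus⁻ A w∈) refl) , w∈S , refl

  -- Deletion of facets of low degree, where each deleted set is charged to the facet `peel A` that
  -- caused its deletion. No facet is charged more than `n` times, so in total at most `n` deletions
  -- per member of `ℬ` occur.
  record Peeling (n : ℕ) (𝒜 : List FinSet) : Set where
    field
      rest       : List FinSet
      peel       : FinSet → FinSet
      rest!      : Unique rest
      rest⊆      : ∀ {A} → A ∈ rest → A ∈ 𝒜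
      min-degree : MinDegree n rest
      peel-under : ∀ {A} → A ∈ 𝒜 → A ∉ rest → peel A Under A
      fibres     : ∀ B → count (λ A → ¬? (A ∈ˢ? rest) ×-dec (peel A ≟ˢ B)) 𝒜 ≤ n

  private
    peel-all : ∀ n 𝒜 → Unique 𝒜 → Peeling n 𝒜
    peel-all n 𝒜₀ = go 𝒜₀ (<-wellFounded (length 𝒜₀))
      where
      go : ∀ 𝒜 → Acc _<_ (length 𝒜) → Unique 𝒜 → Peeling n 𝒜
      go 𝒜 (acc rs) 𝒜! with Any.any? (λ A → Any.any? (λ v → degree 𝒜 (A - v) <? n) (S A)) 𝒜
      ... | no none = record
        { rest = 𝒜 ; peel = id ; rest! = 𝒜! ; rest⊆ = id
        ; min-degree = λ A∈ v∈ → ≮⇒≥ λ small → none (lose A∈ (lose v∈ small))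
        ; peel-under = λ A∈ A∉ → contradiction A∈ A∉
        ; fibres = λ B → ≤-trans (≤-reflexive (count-none (λ A → ¬? (A ∈ˢ? 𝒜) ×-dec (A ≟ˢ B)) 𝒜 λ A∈ → λ { (A∉ , _) → A∉ A∈ })) z≤n }
      ... | yes some with find some
      ... | A₀ , A₀∈ , some′ with find some′
      ... | v₀ , v₀∈ , small = record
        { rest = rest ; peel = peel′ ; rest! = rest! ; rest⊆ = proj₁ ∘ ∈-filter⁻ away {xs = 𝒜} ∘ rest⊆
        ; min-degree = min-degree ; peel-under = under ; fibres = fibres′ }
        where
        B₀ = A₀ - v₀
        away : (A : FinSet) → Dec (¬ B₀ Under A)
        away A = ¬? (B₀ Under? A)
        smaller : length (filter away 𝒜) < length 𝒜
        smaller = filter-notAll away 𝒜 (lose A₀∈ λ ¬under → ¬under (∈-map⁺ (A₀ -_) v₀∈))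
        open Peeling (go (filter away 𝒜) (rs smaller) (Uniqueₚ.filter⁺ away 𝒜!))
        peel′ : FinSet → FinSet
        peel′ A with B₀ Under? A
        ... | yes _ = B₀
        ... | no _ = peel A
        under : ∀ {A} → A ∈ 𝒜 → A ∉ rest → peel′ A Under A
        under {A} A∈ A∉ with B₀ Under? A
        ... | yes u = u
        ... | no ¬u = peel-under (∈-filter⁺ away A∈ ¬u) A∉
        fibres′ : ∀ B → count (λ A → ¬? (A ∈ˢ? rest) ×-dec (peel′ A ≟ˢ B)) 𝒜 ≤ n
        -- Everything charged to `B₀`, now or later, lies above `B₀`, whose degree was below `n`.
        fibres′ B with B ≟ˢ B₀
        ... | yes refl = ≤-trans (count-mono (λ A → ¬? (A ∈ˢ? rest) ×-dec (peel′ A ≟ˢ B₀)) (B₀ Under?_) 𝒜 (λ A∈ → λ { (A∉ , eq) → subst (_Under _) eq (under A∈ A∉) })) (<⇒≤ small)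
        ... | no B≢B₀ = ≤-trans (⊆-count (λ A → ¬? (A ∈ˢ? rest) ×-dec (peel′ A ≟ˢ B)) (λ A → ¬? (A ∈ˢ? rest) ×-dec (peel A ≟ˢ B)) 𝒜! sub) (fibres B)
          where
          sub : ∀ {A} → A ∈ 𝒜 → A ∉ rest × peel′ A ≡ B → A ∈ filter away 𝒜 × A ∉ rest × peel A ≡ B
          sub {A} A∈ (A∉ , eq) with B₀ Under? A
          ... | yes _ = contradiction (sym eq) B≢B₀
          ... | no ¬u = ∈-filter⁺ away A∈ ¬u , A∉ , eq

  opaque
    peeling : ∀ n 𝒜 → Unique 𝒜 → Peeling n 𝒜
    peeling = peel-all

  opaque
    core : FinSet → FinSet
    core A = fromList (filter (outside? (S A)) (elements A))

    ∈-core⁺ : ∀ {A x} → x ∈ elements A → x ∉ S A → x ∈ elements (core A)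
    ∈-core⁺ {A} x∈ x∉ = ∈-fromList⁺ (∈-filter⁺ (outside? (S A)) x∈ x∉)

    ∈-core⁻ : ∀ {A x} → x ∈ elements (core A) → x ∈ elements A × x ∉ S A
    ∈-core⁻ {A} x∈ = ∈-filter⁻ (outside? (S A)) {xs = elements A} (∈-fromList⁻ x∈)

  opaque
    _⊆?_ : ∀ A B → Dec (All (_∈ elements B) (elements A))
    A ⊆? B = All.all? (_∈ℕ? elements B) (elements A)

  -- Peeling with `n` leaves at least `n * length ℬ` members; each class of members with equal core
  -- is then peeled with `n′`. If a class survives in part, its walks never leave the sets that
  -- contain its core, and `reach` makes that core heavy. Otherwise every remaining `A` has a facet
  -- `β A` charged at most `n′` times within its class. Pairs of such an `A` and some `B₀` of `ℬ`
  -- within distance `d` of `β A` are counted in two ways: each `A` has at least `n ^ d / d !` by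
  -- `reach`, each `B₀` at most `(n′ + suc d) * length ℬ`. This contradicts the density hypothesis.
  heavy-core : ∀ {𝒜 ℬ} n n′ → Sys 𝒜 ℬ → 0 < length ℬ → 2 * (n * length ℬ) ≤ length 𝒜 →
    d ! * ((n′ + suc d) * length ℬ) < n ^ d * n →
    ∃ λ A → A ∈ 𝒜 × n′ ^ d ≤ d ! * count (core A ⊆?_) ℬ
  heavy-core {𝒜} {ℬ} n n′ sys 0<b large dense = search
    where
    open ≤-Reasoning
    open Peeling (peeling n 𝒜 (𝒜! sys)) renaming (rest to 𝒜₁; peel to peel₁; rest! to 𝒜₁!; rest⊆ to 𝒜₁⊆)
    sys₁ : Sys 𝒜₁ ℬ
    sys₁ = restrict sys 𝒜₁! 𝒜₁⊆ (S-in sys ∘ 𝒜₁⊆)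

    under-in : ∀ {A B} → A ∈ 𝒜 → B Under A → B ∈ ℬ
    under-in A∈ u with under-root u
    ... | v , v∈ , refl = S-in sys A∈ v∈

    𝒜₁-large : n * length ℬ ≤ length 𝒜₁
    𝒜₁-large = +-cancelʳ-≤ (n * length ℬ) _ _ (begin
      n * length ℬ + n * length ℬ   ≡⟨ cong (n * length ℬ +_) (+-identityʳ _) ⟨
      2 * (n * length ℬ)            ≤⟨ large ⟩
      length 𝒜                      ≡⟨ count-¬ (_∈ˢ? 𝒜₁) 𝒜 ⟨
      count (_∈ˢ? 𝒜₁) 𝒜 + length peeled ≤⟨ +-mono-≤ kept (fibre-bound (λ A B → ¬? (A ∈ˢ? 𝒜₁) ×-dec (peel₁ A ≟ˢ B)) peeled ℬ image bounded) ⟩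
      length 𝒜₁ + n * length ℬ      ∎)
      where
      peeled = filter (¬? ∘ (_∈ˢ? 𝒜₁)) 𝒜
      kept : count (_∈ˢ? 𝒜₁) 𝒜 ≤ length 𝒜₁
      kept = ⊆-length (Uniqueₚ.filter⁺ (_∈ˢ? 𝒜₁) (𝒜! sys)) λ A∈ → proj₂ (∈-filter⁻ (_∈ˢ? 𝒜₁) {xs = 𝒜} A∈)
      image : ∀ {A} → A ∈ peeled → ∃ λ B → B ∈ ℬ × (A ∉ 𝒜₁ × peel₁ A ≡ B)
      image {A} A∈ = let A∈𝒜 , A∉ = ∈-filter⁻ (¬? ∘ (_∈ˢ? 𝒜₁)) {xs = 𝒜} A∈ in
        peel₁ A , under-in A∈𝒜 (peel-under A∈𝒜 A∉) , A∉ , refl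
      bounded : ∀ {B} → B ∈ ℬ → count (λ A → ¬? (A ∈ˢ? 𝒜₁) ×-dec (peel₁ A ≟ˢ B)) peeled ≤ n
      bounded {B} _ = ≤-trans (⊆-count (λ A → ¬? (A ∈ˢ? 𝒜₁) ×-dec (peel₁ A ≟ˢ B)) (λ A → ¬? (A ∈ˢ? 𝒜₁) ×-dec (peel₁ A ≟ˢ B)) (Uniqueₚ.filter⁺ (¬? ∘ (_∈ˢ? 𝒜₁)) (𝒜! sys))
        λ A∈ x → proj₁ (∈-filter⁻ (¬? ∘ (_∈ˢ? 𝒜₁)) {xs = 𝒜} A∈) , x) (fibres B)

    class? : ∀ K A → Dec (core A ≡ K)
    class? K A = core A ≟ˢ K
    class : FinSet → List FinSet
    class K = filter (class? K) 𝒜₁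
    peeling-of : ∀ K → Peeling n′ (class K)
    peeling-of K = peeling n′ (class K) (Uniqueₚ.filter⁺ (class? K) 𝒜₁!)
    module P K = Peeling (peeling-of K)

    -- Removing selected elements keeps the core, so in one class all facets used by walks contain
    -- `K` and the system lives on `ℬ′`.
    dense-core : ∀ {A} → A ∈ 𝒜₁ → ∀ {A′} → A′ ∈ P.rest (core A) → n′ ^ d ≤ d ! * count (core A ⊆?_) ℬ
    dense-core {A} A∈ {A′} A′∈ with S! sys (𝒜₁⊆ A′∈𝒜₁) | S-size sys (𝒜₁⊆ A′∈𝒜₁)
      where
      A′∈𝒜₁ : A′ ∈ 𝒜₁
      A′∈𝒜₁ = proj₁ (∈-filter⁻ (class? (core A)) {xs = 𝒜₁} (P.rest⊆ (core A) A′∈))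
    ... | S!′ | size with escape _≟_ {ys = []} S!′ (≤-trans (s≤s z≤n) (≤-reflexive (sym size)))
    ... | v , v∈ , _ = ≤-trans
      (reach {ℬ = ℬ′} sys′ (P.min-degree K) d [] (A′ - v) (S-in sys′ A′∈ v∈) (P.min-degree K A′∈ v∈) (λ ()) ≤-refl)
      (*-monoʳ-≤ (d !) (length-filter (Near? [] d (A′ - v)) ℬ′))
      where
      K = core A
      ℬ′ = filter (K ⊆?_) ℬ
      sys′ : Sys (P.rest K) ℬ′
      sys′ = restrict sys (P.rest! K) (𝒜₁⊆ ∘ proj₁ ∘ ∈-filter⁻ (class? K) {xs = 𝒜₁} ∘ P.rest⊆ K) inside
        where
        inside : ∀ {A″ w} → A″ ∈ P.rest K → w ∈ S A″ → A″ - w ∈ ℬ′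
        inside {A″} {w} A″∈ w∈ = let A″∈𝒜₁ , eq = ∈-filter⁻ (class? K) {xs = 𝒜₁} (P.rest⊆ K A″∈) in
          ∈-filter⁺ (K ⊆?_) (S-in sys (𝒜₁⊆ A″∈𝒜₁) w∈)
            (subst (λ K → All (_∈ elements (A″ - w)) (elements K)) eq
              (All.tabulate λ x∈ → let x∈A″ , x∉ = ∈-core⁻ x∈ in ∈-minus⁺ A″ x∈A″ λ { refl → x∉ w∈ }))

    search : ∃ λ A → A ∈ 𝒜 × n′ ^ d ≤ d ! * count (core A ⊆?_) ℬ
    search with Any.any? (λ A → 1 ≤? length (P.rest (core A))) 𝒜₁
    ... | yes some with find some
    ... | A , A∈ , nonempty with P.rest (core A) | dense-core A∈
    ... | A′ ∷ _ | bound = A , 𝒜₁⊆ A∈ , bound (here refl)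
    search | no none = contradiction (<-≤-trans dense sparse) (<-irrefl refl)
      where
      empty : ∀ {A} → A ∈ 𝒜₁ → ∀ {A′} → A′ ∉ P.rest (core A)
      empty {A} A∈ A′∈ = none (lose A∈ (∈-length A′∈))
      β : FinSet → FinSet
      β A = P.peel (core A) A
      β-under : ∀ {A} → A ∈ 𝒜₁ → β A Under A
      β-under {A} A∈ = P.peel-under (core A) (∈-filter⁺ (class? (core A)) A∈ refl) (empty A∈)

      module _ (B₀ : FinSet) where
        trace : FinSet → FinSet
        trace B = fromList (filter (_∈ℕ? elements B₀) (elements B))
        -- Here `B₀` and `β A` alone determine the core and thereby the class; at most `n′` members
        -- of that class are charged to the same facet.
        Bad? : ∀ A → Dec (core A ≡ trace (β A))
        Bad? A = core A ≟ˢ trace (β A)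
        -- The walk is prolonged by one step: `B = A - u` has lost an element `u` of `B₀`. As at
        -- most `suc d` elements of `B₀` are missing from `B`, at most `suc d` sets `A` belong to
        -- the same `B`.
        Swap : FinSet → FinSet → Set
        Swap A B = Any (λ u → B ≡ A - u × u ∈ elements B₀ × diff B₀ B ≤ suc d) (S A)
        Swap? : ∀ A B → Dec (Swap A B)
        Swap? A B = Any.any? (λ u → (B ≟ˢ (A - u)) ×-dec ((u ∈ℕ? elements B₀) ×-dec (diff B₀ B ≤? suc d))) (S A)
        Good? : ∀ A → Dec (Any (Swap A) ℬ)
        Good? A = Any.any? (Swap? A) ℬ

        bad-count : count Bad? 𝒜₁ ≤ n′ * length ℬ
        bad-count = fibre-bound (λ A B → β A ≟ˢ B) (filter Bad? 𝒜₁) ℬ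
          (λ {A} A∈ → let A∈𝒜₁ , _ = ∈-filter⁻ Bad? {xs = 𝒜₁} A∈ in β A , under-in (𝒜₁⊆ A∈𝒜₁) (β-under A∈𝒜₁) , refl)
          (λ {B} _ → ≤-trans (⊆-count (λ A → β A ≟ˢ B) (λ A → ¬? (A ∈ˢ? P.rest (trace B)) ×-dec (P.peel (trace B) A ≟ˢ B))
            (Uniqueₚ.filter⁺ Bad? 𝒜₁!) (in-class B)) (P.fibres (trace B) B))
          where
          in-class : ∀ B {A} → A ∈ filter Bad? 𝒜₁ → β A ≡ B →
            A ∈ class (trace B) × A ∉ P.rest (trace B) × P.peel (trace B) A ≡ B
          in-class B {A} A∈ refl with ∈-filter⁻ Bad? {xs = 𝒜₁} A∈
          ... | A∈𝒜₁ , bad = ∈-filter⁺ (class? (trace (β A))) A∈𝒜₁ bad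
            , subst (λ K → A ∉ P.rest K) bad (empty A∈𝒜₁) , cong (λ K → P.peel K A) (sym bad)

        good-count : count Good? 𝒜₁ ≤ suc d * length ℬ
        good-count = fibre-bound Swap? (filter Good? 𝒜₁) ℬ
          (λ A∈ → find (proj₂ (∈-filter⁻ Good? {xs = 𝒜₁} A∈))) bounded
          where
          bounded : ∀ {B} → B ∈ ℬ → count (λ A → Swap? A B) (filter Good? 𝒜₁) ≤ suc d
          bounded {B} _ = by-distance (diff B₀ B ≤? suc d)
            where
            by-distance : Dec (diff B₀ B ≤ suc d) → count (λ A → Swap? A B) (filter Good? 𝒜₁) ≤ suc d
            by-distance (no far) = ≤-trans (≤-reflexive (count-none (λ A → Swap? A B) (filter Good? 𝒜₁) λ _ sw → far (proj₂ (proj₂ (proj₂ (proj₂ (find sw))))))) z≤n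
            by-distance (yes close) = ≤-trans
              (count-injection (λ A → Swap? A B) {ys = filter (outside? (elements B)) (elements B₀)} {R = λ A u → u ∈ S A × B ≡ A - u}
                (Uniqueₚ.filter⁺ Good? 𝒜₁!) removed
                (λ { A∈ A′∈ _ _ (u∈ , eq) (u∈′ , eq′) → minus-injective
                  (S-⊆ sys₁ (proj₁ (∈-filter⁻ Good? {xs = 𝒜₁} A∈)) u∈)
                  (S-⊆ sys₁ (proj₁ (∈-filter⁻ Good? {xs = 𝒜₁} A′∈)) u∈′) (trans (sym eq) eq′) }))
              close
              where
              removed : ∀ {A} → A ∈ filter Good? 𝒜₁ → Swap A B →
                ∃ λ u → u ∈ filter (outside? (elements B)) (elements B₀) × (u ∈ S A × B ≡ A - u)
              removed {A} _ sw with find sw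
              ... | u , u∈ , refl , u∈B₀ , _ = u
                , ∈-filter⁺ (outside? (elements B)) u∈B₀ (λ u∈B → proj₂ (∈-minus⁻ A u∈B) refl) , u∈ , refl

        -- If no selected element except `v` lies in `B₀`, the `d` other selected elements are all
        -- in `β A` and outside `B₀`. The distance allows no more than `d`, so the rest of `β A`,
        -- which is the core, lies in `B₀`.
        bad-or-good : ∀ {A} → A ∈ 𝒜₁ → Near [] d (β A) B₀ → core A ≡ trace (β A) ⊎ Any (Swap A) ℬ
        bad-or-good {A} A∈ (_ , near₁ , near₂) with under-root (β-under A∈)
        ... | v , v∈ , eq rewrite eq with Any.any? (λ u → ¬? (u ≟ v) ×-dec (u ∈ℕ? elements B₀)) (S A)
        ... | yes some = let u , u∈ , u≢v , u∈B₀ = find some in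
          inj₂ (lose (S-in sys₁ A∈ u∈) (lose u∈ (refl , u∈B₀ , ≤-trans (diff-minusʳ A v u B₀) (s≤s near₁))))
        ... | no none = inj₁ (set-ext core⊆ ⊆core)
          where
          avoid : ∀ {u} → u ∈ S A → u ≢ v → u ∉ elements B₀
          avoid u∈ u≢v u∈B₀ = none (lose u∈ (u≢v , u∈B₀))
          other? : (u : ℕ) → Dec (u ≢ v)
          other? u = ¬? (u ≟ v)
          others = filter other? (S A)
          d≤others : suc d ≤ suc (length others)
          d≤others = ≤-trans (≤-reflexive (sym (S-size sys₁ A∈))) (⊆-length {ys = v ∷ others} (S! sys₁ A∈) split)
            where
            split : ∀ {u} → u ∈ S A → u ∈ v ∷ others
            split {u} u∈ with u ≟ v
            ... | yes refl = here refl
            ... | no u≢v = there (∈-filter⁺ other? u∈ u≢v)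
          core⊆ : core A ⊆ trace (A - v)
          core⊆ {x} x∈ = ∈-fromList⁺ (∈-filter⁺ (_∈ℕ? elements B₀) x∈A-v (decidable-stable (x ∈ℕ? elements B₀) λ x∉B₀ →
            <-irrefl refl (<-≤-trans (s≤s ≤-refl) (≤-trans d≤others (≤-trans (⊆-length
              (∉⇒Unique (λ x∈o → x∉S (proj₁ (∈-filter⁻ other? {xs = S A} x∈o))) (Uniqueₚ.filter⁺ other? (S! sys₁ A∈)))
              (all-out x∉B₀)) near₂)))))
            where
            x∈A = proj₁ (∈-core⁻ {A} x∈)
            x∉S = proj₂ (∈-core⁻ {A} x∈)
            x∈A-v : x ∈ elements (A - v)
            x∈A-v = ∈-minus⁺ A x∈A λ { refl → x∉S v∈ }
            all-out : x ∉ elements B₀ → ∀ {u} → u ∈ x ∷ others → u ∈ filter (outside? (elements B₀)) (elements (A - v))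
            all-out x∉B₀ (here refl) = ∈-filter⁺ (outside? (elements B₀)) x∈A-v x∉B₀
            all-out x∉B₀ (there u∈) = let u∈S , u≢v = ∈-filter⁻ other? {xs = S A} u∈ in
              ∈-filter⁺ (outside? (elements B₀)) (∈-minus⁺ A (S-⊆ sys₁ A∈ u∈S) u≢v) (avoid u∈S u≢v)
          ⊆core : trace (A - v) ⊆ core A
          ⊆core x∈ with ∈-filter⁻ (_∈ℕ? elements B₀) {xs = elements (A - v)} (∈-fromList⁻ x∈)
          ... | x∈A-v , x∈B₀ = let x∈A , x≢v = ∈-minus⁻ A x∈A-v in ∈-core⁺ x∈A λ x∈S → avoid x∈S x≢v x∈B₀

      sparse : n ^ d * n ≤ d ! * ((n′ + suc d) * length ℬ)
      sparse = *-cancelʳ-≤ _ _ (length ℬ) {{>-nonZero 0<b}} (begin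
        n ^ d * n * length ℬ                               ≡⟨ *-assoc (n ^ d) n _ ⟩
        n ^ d * (n * length ℬ)                             ≤⟨ *-monoʳ-≤ (n ^ d) 𝒜₁-large ⟩
        n ^ d * length 𝒜₁                                  ≤⟨ double-count (λ A B₀ → Near? [] d (β A) B₀) (d !) 𝒜₁ ℬ lower upper ⟩
        d ! * ((n′ + suc d) * length ℬ * length ℬ)         ≡⟨ *-assoc (d !) _ _ ⟨
        d ! * ((n′ + suc d) * length ℬ) * length ℬ         ∎)
        where
        lower : ∀ {A} → A ∈ 𝒜₁ → n ^ d ≤ d ! * count (Near? [] d (β A)) ℬ
        lower {A} A∈ with under-root (β-under A∈)
        ... | v , v∈ , eq = reach sys₁ min-degree d [] (β A) (under-in (𝒜₁⊆ A∈) (β-under A∈))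
          (subst (λ B → n ≤ degree 𝒜₁ B) (sym eq) (min-degree A∈ v∈)) (λ ()) ≤-refl
        upper : ∀ {B₀} → B₀ ∈ ℬ → count (λ A → Near? [] d (β A) B₀) 𝒜₁ ≤ (n′ + suc d) * length ℬ
        upper {B₀} _ = begin
          count (λ A → Near? [] d (β A) B₀) 𝒜₁              ≤⟨ count-∪ (λ A → Near? [] d (β A) B₀) (Bad? B₀) (Good? B₀) 𝒜₁ (bad-or-good B₀) ⟩
          count (Bad? B₀) 𝒜₁ + count (Good? B₀) 𝒜₁          ≤⟨ +-mono-≤ (bad-count B₀) (good-count B₀) ⟩
          n′ * length ℬ + suc d * length ℬ                  ≡⟨ *-distribʳ-+ (length ℬ) n′ (suc d) ⟨
          (n′ + suc d) * length ℬ                           ∎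

-- Choice of the density constants

private
  -- With n = c t, n′ = t and M about E t, the factor `8 * suc d` in `E` secures the first claim.
  -- Since 2 E = 16 (d + 1) c, the power `(2 * E * t) ^ d` equals w (c t)ᵈ, and t + d + 1 ≤ 2 t
  -- reduces the last claim to 2 w < c, which fixes `c`.
  density-arith : ∀ d t M → let w = (16 * suc d) ^ d ; c = suc (2 * w) ; E = 8 * suc d * c in
    suc d ≤ t → E * t ≤ M → suc M ≤ E * suc t →
    4 * suc d * (c * t) + d ≤ M × suc M ≤ 2 * E * t × (t + suc d) * (2 * E * t) ^ d < (c * t) ^ d * (c * t)
  density-arith d t M t≥ Et≤ M< = first , second , third
    where
    open ≤-Reasoning
    w = (16 * suc d) ^ d
    c = suc (2 * w)
    E = 8 * suc d * c
    t>0 : 0 < t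
    t>0 = ≤-trans (s≤s z≤n) t≥
    first : 4 * suc d * (c * t) + d ≤ M
    first = begin
      4 * suc d * (c * t) + d                       ≤⟨ +-monoʳ-≤ (4 * suc d * (c * t)) (<⇒≤ t≥) ⟩
      4 * suc d * (c * t) + t                       ≤⟨ +-monoʳ-≤ (4 * suc d * (c * t)) (m≤m+n t _) ⟩
      4 * suc d * (c * t) + (t + (2 * w * t + (3 + 4 * d) * (c * t))) ≡⟨ l d w t ⟩
      E * t                                         ≤⟨ Et≤ ⟩
      M                                             ∎
      where
      l : ∀ d w t → 4 * suc d * (suc (2 * w) * t) + (t + (2 * w * t + (3 + 4 * d) * (suc (2 * w) * t))) ≡ 8 * suc d * suc (2 * w) * t
      l = solve-∀
    second : suc M ≤ 2 * E * t
    second = begin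
      suc M           ≤⟨ M< ⟩
      E * suc t       ≡⟨ *-suc E t ⟩
      E + E * t       ≡⟨ cong (_+ E * t) (*-identityʳ E) ⟨
      E * 1 + E * t   ≤⟨ +-monoˡ-≤ (E * t) (*-monoʳ-≤ E t>0) ⟩
      E * t + E * t   ≡⟨ l E t ⟩
      2 * E * t       ∎
      where
      l : ∀ E t → E * t + E * t ≡ 2 * E * t
      l = solve-∀
    third : (t + suc d) * (2 * E * t) ^ d < (c * t) ^ d * (c * t)
    third = begin-strict
      (t + suc d) * (2 * E * t) ^ d               ≤⟨ *-monoˡ-≤ ((2 * E * t) ^ d) (+-monoʳ-≤ t t≥) ⟩
      (t + t) * (2 * E * t) ^ d                   ≡⟨ cong (λ z → (t + t) * z ^ d) (l₁ (suc d) c t) ⟩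
      (t + t) * (16 * suc d * (c * t)) ^ d        ≡⟨ cong ((t + t) *_) (^-distribʳ-* d (16 * suc d) (c * t)) ⟩
      (t + t) * (w * (c * t) ^ d)                 ≡⟨ l₂ t w ((c * t) ^ d) ⟩
      (c * t) ^ d * (2 * w * t)                   <⟨ *-monoʳ-< ((c * t) ^ d) {{>-nonZero (m^n>0 (c * t) {{>-nonZero (*-mono-< {0} {c} {0} {t} (s≤s z≤n) t>0)}} d)}}
                                                       (*-monoˡ-< t {{>-nonZero t>0}} (n<1+n (2 * w))) ⟩
      (c * t) ^ d * (c * t)                       ∎
      where
      l₁ : ∀ s c t → 2 * (8 * s * c) * t ≡ 16 * s * (c * t)
      l₁ = solve-∀
      l₂ : ∀ t w p → (t + t) * (w * p) ≡ p * (2 * w * t)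
      l₂ = solve-∀

private
  -- The constant `Q` is the ratio of `(2 * E * t) ^ d`, which bounds `d ! * b`, to `n′ ^ d` with
  -- `n′ = t`. The bound on `M` makes the quotient `t = M / E` at least `suc d`, so that rounding
  -- costs no more than a factor 2.
  parameters : ∀ e d → d ≡ suc e → ∃₂ λ Q M* → ∀ M b → M* ≤ M → M choose d ≤ b → b ≤ suc M choose d →
    ∃₂ λ n n′ → 2 * (n * b) ≤ kk e b × d ! * ((n′ + suc d) * b) < n ^ d * n × (∀ b₀ → n′ ^ d ≤ d ! * b₀ → b ≤ Q * b₀)
  parameters e d d≡ = (2 * E) ^ d , E * suc d , params
    where
    w = (16 * suc d) ^ d
    c = suc (2 * w)
    E = 8 * suc d * c
    instance
      E≢0 : NonZero E
      E≢0 = _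
    kk-at : ∀ M → kk e (M choose d) ≡ M choose suc d
    kk-at M = subst (λ d → kk e (M choose d) ≡ M choose suc d) (sym d≡) (kk-C e M)
    params : ∀ M b → E * suc d ≤ M → M choose d ≤ b → b ≤ suc M choose d →
      ∃₂ λ n n′ → 2 * (n * b) ≤ kk e b × d ! * ((n′ + suc d) * b) < n ^ d * n × (∀ b₀ → n′ ^ d ≤ d ! * b₀ → b ≤ (2 * E) ^ d * b₀)
    params M b M≥ lo hi = c * t , t , first , second , third
      where
      open ≤-Reasoning
      t = M / E
      M≡ : M ≡ M % E + t * E
      M≡ = m≡m%n+[m/n]*n M E
      Et≤M : E * t ≤ M
      Et≤M = subst₂ _≤_ (*-comm t E) (sym M≡) (m≤n+m (t * E) (M % E))
      M<Est : suc M ≤ E * suc t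
      M<Est = begin
        suc M                   ≡⟨ cong suc M≡ ⟩
        suc (M % E) + t * E     ≤⟨ +-monoˡ-≤ (t * E) (m%n<n M E) ⟩
        E + t * E               ≡⟨ cong (E +_) (*-comm t E) ⟩
        E + E * t               ≡⟨ *-suc E t ⟨
        E * suc t               ∎
      t≥ : suc d ≤ t
      t≥ = ≮⇒≥ λ t< → <-irrefl refl (≤-trans M<Est (≤-trans (*-monoʳ-≤ E t<) M≥))
      arith = density-arith d t M t≥ Et≤M M<Est
      M≥first = proj₁ arith
      M≤second = proj₁ (proj₂ arith)
      2d≤M : 2 * (1 * d) ≤ M
      2d≤M = begin
        2 * (1 * d)                        ≡⟨ l d ⟩
        d + d                              ≤⟨ +-monoˡ-≤ d (≤-trans (<⇒≤ t≥) (≤-trans (m≤m+n t (2 * w * t)) (m≤n*m (c * t) (4 * suc d)))) ⟩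
        4 * suc d * (c * t) + d            ≤⟨ M≥first ⟩
        M                                  ∎
        where
        l : ∀ d → 2 * (1 * d) ≡ d + d
        l = solve-∀
      M>0 : 0 < M
      M>0 = ≤-trans (≤-trans (s≤s z≤n) t≥) (≤-trans (m≤n*m t E) Et≤M)
      -- The average `kk e b / b` is at least (M - d) / (2 (d + 1)), because b ≤ C(M + 1, d) ≤ 2
      -- C(M, d).
      first : 2 * (c * t * b) ≤ kk e b
      first = ≤-trans (*-cancelˡ-≤ (suc d) (begin
        suc d * (2 * (c * t * b))                        ≤⟨ *-monoʳ-≤ (suc d) (*-monoʳ-≤ 2 (*-monoʳ-≤ (c * t) (≤-trans hi (choose-double d M 1 M>0 2d≤M)))) ⟩
        suc d * (2 * (c * t * (2 * (M choose d))))       ≡⟨ l (suc d) (c * t) (M choose d) ⟩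
        4 * suc d * (c * t) * (M choose d)               ≤⟨ *-monoˡ-≤ (M choose d) (m+n≤o⇒m≤o∸n (4 * suc d * (c * t)) {d} {M} M≥first) ⟩
        (M ∸ d) * (M choose d)                           ≡⟨ choose-absorb-∸ M d ⟩
        suc d * (M choose suc d)                         ∎))
        (≤-trans (≤-reflexive (sym (kk-at M))) (kk-mono e lo))
        where
        l : ∀ s n x → s * (2 * (n * (2 * x))) ≡ 4 * s * n * x
        l = solve-∀
      b-upper : d ! * b ≤ (2 * E * t) ^ d
      b-upper = ≤-trans (*-monoʳ-≤ (d !) hi) (≤-trans (choose-upper (suc M) d) (^-monoˡ-≤ d M≤second))
      second : d ! * ((t + suc d) * b) < (c * t) ^ d * (c * t)
      second = begin-strict
        d ! * ((t + suc d) * b)              ≡⟨ l (d !) (t + suc d) b ⟩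
        (t + suc d) * (d ! * b)              ≤⟨ *-monoʳ-≤ (t + suc d) b-upper ⟩
        (t + suc d) * (2 * E * t) ^ d        <⟨ proj₂ (proj₂ arith) ⟩
        (c * t) ^ d * (c * t)                ∎
        where
        l : ∀ f s b → f * (s * b) ≡ s * (f * b)
        l = solve-∀
      third : ∀ b₀ → t ^ d ≤ d ! * b₀ → b ≤ (2 * E) ^ d * b₀
      third b₀ t≤ = *-cancelˡ-≤ (d !) {{d !≢0}} (begin
        d ! * b                        ≤⟨ b-upper ⟩
        (2 * E * t) ^ d                ≡⟨ ^-distribʳ-* d (2 * E) t ⟩
        (2 * E) ^ d * t ^ d            ≤⟨ *-monoʳ-≤ ((2 * E) ^ d) t≤ ⟩
        (2 * E) ^ d * (d ! * b₀)       ≡⟨ l ((2 * E) ^ d) (d !) b₀ ⟩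
        d ! * ((2 * E) ^ d * b₀)       ∎)
        where
        l : ∀ q f b → q * (f * b) ≡ f * (q * b)
        l = solve-∀

-- The parameters n and n′ for which heavy-core applies to a system with more
-- members than the Kruskal–Katona bound; its core then lies in a positive
-- fraction 1 / Q of the family ℬ.
opaque
  density-parameters : ∀ e d → d ≡ suc e → ∃₂ λ Q M* → ∀ M b → M* ≤ M → M choose d ≤ b → b ≤ suc M choose d →
    ∃₂ λ n n′ → 2 * (n * b) ≤ kk e b × d ! * ((n′ + suc d) * b) < n ^ d * n × (∀ b₀ → n′ ^ d ≤ d ! * b₀ → b ≤ Q * b₀)
  density-parameters = parameters

-- The upper bound

∈-take : ∀ {X : Set} {x : X} n xs → x ∈ take n xs → x ∈ xs
∈-take (suc n) (y ∷ xs) (here refl) = here refl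
∈-take (suc n) (y ∷ xs) (there x∈) = there (∈-take n xs x∈)

record System-at (r k : ℕ) (𝒜 ℬ : List FinSet) : Set where
  field
    𝒜-unique : Unique 𝒜
    ℬ-unique : Unique ℬ
    sizes    : ∀ {A} → A ∈ 𝒜 → ∣ A ∣ ≡ r
    covered  : ∀ {A} → A ∈ 𝒜 → k ≤ count (in? ℬ A) (elements A)

module Decomposition {r e 𝒜 ℬ} (sys-at : System-at r (2 + e) 𝒜 ℬ) where
  open System-at sys-at
  private
    k = 2 + e

  opaque
    -- Exactly `k` removable elements are kept, so that all cores have r - k elements and a member
    -- containing a core has exactly `k` elements outside it.
    selected : FinSet → List ℕ
    selected A = take k (filter (in? ℬ A) (elements A))

    selected! : ∀ A → Unique (selected A)
    selected! A = Uniqueₚ.take⁺ k (Uniqueₚ.filter⁺ (in? ℬ A) (unique-elements A))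

    selected-size : ∀ {A} → A ∈ 𝒜 → length (selected A) ≡ k
    selected-size {A} A∈ = trans (length-take k (filter (in? ℬ A) (elements A))) (m≤n⇒m⊓n≡m (covered A∈))

    selected-in : ∀ {A v} → v ∈ selected A → v ∈ elements A × A - v ∈ ℬ
    selected-in {A} v∈ = ∈-filter⁻ (in? ℬ A) {xs = elements A} (∈-take k (filter (in? ℬ A) (elements A)) v∈)

  open System selected (suc e) public

  sys : Sys 𝒜 ℬ
  sys = record
    { 𝒜! = 𝒜-unique
    ; S! = λ {A} _ → selected! A
    ; S-size = selected-size
    ; S-⊆ = λ _ v∈ → proj₁ (selected-in v∈)
    ; S-in = λ _ v∈ → proj₂ (selected-in v∈) }

  opaque
    unfolding core

    size-core : ∀ {A} → A ∈ 𝒜 → k + ∣ core A ∣ ≡ r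
    size-core {A} A∈ = begin
      k + ∣ core A ∣
        ≡⟨ cong (k +_) (size-fromList (Uniqueₚ.filter⁺ (outside? (selected A)) (unique-elements A))) ⟩
      k + count (outside? (selected A)) (elements A)
        ≡⟨ cong (_+ count (outside? (selected A)) (elements A)) (trans (sym (Sys.S-size sys A∈)) same) ⟩
      count (_∈ℕ? selected A) (elements A) + count (outside? (selected A)) (elements A)
        ≡⟨ count-¬ (_∈ℕ? selected A) (elements A) ⟩
      ∣ A ∣
        ≡⟨ sizes A∈ ⟩
      r ∎
      where
      open ≡-Reasoning
      same : length (selected A) ≡ count (_∈ℕ? selected A) (elements A)
      same = ≤-antisym
        (⊆-length (Sys.S! sys A∈) λ v∈ → ∈-filter⁺ (_∈ℕ? selected A) (proj₁ (selected-in v∈)) v∈)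
        (⊆-length (Uniqueₚ.filter⁺ (_∈ℕ? selected A) (unique-elements A)) λ v∈ → proj₂ (∈-filter⁻ (_∈ℕ? selected A) {xs = elements A} v∈))

  module At-core (K : FinSet) (size-K : k + ∣ K ∣ ≡ r) where
    ℬ₀ ℬ₁ containing avoiding : List FinSet
    ℬ₀ = filter (K ⊆?_) ℬ
    ℬ₁ = filter (¬? ∘ (K ⊆?_)) ℬ
    containing = filter (K ⊆?_) 𝒜
    avoiding = filter (¬? ∘ (K ⊆?_)) 𝒜

    private
      touches? : (A : FinSet) → Dec (Any (_∈ elements K) (selected A))
      touches? A = Any.any? (_∈ℕ? elements K) (selected A)

      touching clean : List FinSet
      touching = filter touches? containing
      clean = filter (¬? ∘ touches?) containing

      containing-in : ∀ {A} → A ∈ containing → A ∈ 𝒜 × All (_∈ elements A) (elements K)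
      containing-in = ∈-filter⁻ (K ⊆?_) {xs = 𝒜}

      containing! : Unique containing
      containing! = Uniqueₚ.filter⁺ (K ⊆?_) 𝒜-unique

      out : ∀ {A} → A ∈ containing → count (outside? (elements K)) (elements A) ≡ k
      out {A} A∈ with containing-in A∈
      ... | A∈𝒜 , K⊆A = +-cancelʳ-≡ ∣ K ∣ _ k (begin
        count (outside? (elements K)) (elements A) + ∣ K ∣
          ≡⟨ cong (count (outside? (elements K)) (elements A) +_) same ⟩
        count (outside? (elements K)) (elements A) + count (_∈ℕ? elements K) (elements A)
          ≡⟨ +-comm (count (outside? (elements K)) (elements A)) _ ⟩
        count (_∈ℕ? elements K) (elements A) + count (outside? (elements K)) (elements A)
          ≡⟨ count-¬ (_∈ℕ? elements K) (elements A) ⟩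
        ∣ A ∣
          ≡⟨ trans (sizes A∈𝒜) (sym size-K) ⟩
        k + ∣ K ∣ ∎)
        where
        open ≡-Reasoning
        same : ∣ K ∣ ≡ count (_∈ℕ? elements K) (elements A)
        same = ≤-antisym
          (⊆-length (unique-elements K) λ x∈ → ∈-filter⁺ (_∈ℕ? elements K) (All.lookup K⊆A x∈) x∈)
          (⊆-length (Uniqueₚ.filter⁺ (_∈ℕ? elements K) (unique-elements A)) λ x∈ → proj₂ (∈-filter⁻ (_∈ℕ? elements K) {xs = elements A} x∈))

      -- A clean member has `k` elements outside `K` and `k` selected ones, all of them outside `K`,
      -- so these coincide. Hence every facet that contains `K` belongs to `ℬ₀`.
      clean-bound : length clean ≤ kk e (length ℬ₀)
      clean-bound = kruskal-katona e (elements K) ℬ₀ clean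
        (Uniqueₚ.filter⁺ (¬? ∘ touches?) containing!) (Uniqueₚ.filter⁺ (K ⊆?_) ℬ-unique)
        (λ A∈ → out (proj₁ (∈-filter⁻ (¬? ∘ touches?) {xs = containing} A∈))) facets
        where
        facets : ∀ {A x} → A ∈ clean → x ∈ elements A → x ∉ elements K → A - x ∈ ℬ₀
        facets {A} {x} A∈ x∈A x∉K = ∈-filter⁺ (K ⊆?_) (proj₂ (selected-in x∈S))
          (All.tabulate λ y∈K → ∈-minus⁺ A (All.lookup K⊆A y∈K) λ { refl → x∉K y∈K })
          where
          A∈con = proj₁ (∈-filter⁻ (¬? ∘ touches?) {xs = containing} A∈)
          untouched = proj₂ (∈-filter⁻ (¬? ∘ touches?) {xs = containing} A∈)
          A∈𝒜 = proj₁ (containing-in A∈con)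
          K⊆A = proj₂ (containing-in A∈con)
          x∈S : x ∈ selected A
          x∈S = ⊆-length⁻ (Sys.S! sys A∈𝒜)
            (λ v∈ → ∈-filter⁺ (outside? (elements K)) (proj₁ (selected-in v∈)) λ v∈K → untouched (lose v∈ v∈K))
            (≤-reflexive (trans (out A∈con) (sym (Sys.S-size sys A∈𝒜))))
            (∈-filter⁺ (outside? (elements K)) x∈A x∉K)

      -- As `K` is contained in `A`, the facet `A - v` with `v` in `K` lacks exactly one element of
      -- `K`; so it is in `ℬ₁`, and it reveals `v` and then `A`.
      touching-bound : length touching ≤ length ℬ₁
      touching-bound = count-injection touches? {R = λ A B → ∃ λ v → v ∈ elements K × B ≡ A - v} containing! image inj
        where
        image : ∀ {A} → A ∈ containing → Any (_∈ elements K) (selected A) →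
          ∃ λ B → B ∈ ℬ₁ × ∃ λ v → v ∈ elements K × B ≡ A - v
        image {A} A∈ touch = let v , v∈S , v∈K = find touch in
          A - v , ∈-filter⁺ (¬? ∘ (K ⊆?_)) (proj₂ (selected-in v∈S)) (λ K⊆ → proj₂ (∈-minus⁻ A (All.lookup K⊆ v∈K)) refl)
          , v , v∈K , refl
        inj : ∀ {A A′ B} → A ∈ containing → A′ ∈ containing →
          Any (_∈ elements K) (selected A) → Any (_∈ elements K) (selected A′) →
          (∃ λ v → v ∈ elements K × B ≡ A - v) → (∃ λ v → v ∈ elements K × B ≡ A′ - v) → A ≡ A′
        inj {A} {A′} A∈ A′∈ _ _ (v , v∈K , eq) (v′ , v′∈K , eq′) with v ≟ v′
        ... | yes refl = minus-injective (All.lookup (proj₂ (containing-in A∈)) v∈K) (All.lookup (proj₂ (containing-in A′∈)) v∈K)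
                           (trans (sym eq) eq′)
        ... | no v≢v′ = contradiction refl (proj₂ (∈-minus⁻ A′ (subst (λ B → v′ ∈ elements B) (trans (sym eq) eq′)
                           (∈-minus⁺ A (All.lookup (proj₂ (containing-in A∈)) v′∈K) (v≢v′ ∘ sym)))))

    bound : length 𝒜 ≤ kk e (length ℬ₀) + length ℬ₁ + length avoiding
    bound = begin
      length 𝒜                                          ≡⟨ count-¬ (K ⊆?_) 𝒜 ⟨
      length containing + length avoiding               ≡⟨ cong (_+ length avoiding) (count-¬ touches? containing) ⟨
      length touching + length clean + length avoiding  ≡⟨ cong (_+ length avoiding) (+-comm (length touching) _) ⟩
      length clean + length touching + length avoiding  ≤⟨ +-monoˡ-≤ (length avoiding) (+-mono-≤ clean-bound touching-bound) ⟩
      kk e (length ℬ₀) + length ℬ₁ + length avoiding    ∎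
      where open ≤-Reasoning

    -- A set that does not contain `K` has no facet containing `K`, so all of its facets in `ℬ`
    -- survive in `ℬ₁`.
    avoiding-system : System-at r k avoiding ℬ₁
    avoiding-system = record
      { 𝒜-unique = Uniqueₚ.filter⁺ (¬? ∘ (K ⊆?_)) 𝒜-unique
      ; ℬ-unique = Uniqueₚ.filter⁺ (¬? ∘ (K ⊆?_)) ℬ-unique
      ; sizes = λ A∈ → sizes (proj₁ (∈-filter⁻ (¬? ∘ (K ⊆?_)) {xs = 𝒜} A∈))
      ; covered = λ {A} A∈ → let A∈𝒜 , K⊈A = ∈-filter⁻ (¬? ∘ (K ⊆?_)) {xs = 𝒜} A∈ in
          ≤-trans (covered A∈𝒜) (count-mono (in? ℬ A) (in? ℬ₁ A) (elements A) λ _ A-v∈ →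
            ∈-filter⁺ (¬? ∘ (K ⊆?_)) A-v∈ λ K⊆ → K⊈A (All.map (proj₁ ∘ ∈-minus⁻ A) K⊆)) }

pair-bound-at : ∀ {r e 𝒜 ℬ} → System-at r (2 + e) 𝒜 ℬ → length 𝒜 ≤ kk 0 (length ℬ)
pair-bound-at s = pair-bound 𝒜-unique ℬ-unique λ A∈ → ≤-trans (s≤s (s≤s z≤n)) (covered A∈)
  where open System-at s

-- For k = 2 the count of pairs is already exact. For larger k the induction on `length ℬ` carries
-- the same `τ` along, because `kk-merge` has no error term; `τ` is fixed before `r`.
upper-bound : ∀ e → ∃ λ τ → ∀ {r 𝒜 ℬ} → System-at r (2 + e) 𝒜 ℬ → length 𝒜 ≤ kk e (length ℬ) + τ
upper-bound zero = 0 , λ s → ≤-trans (pair-bound-at s) (m≤m+n _ 0)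
upper-bound (suc e) with density-parameters (suc e) (2 + e) refl
... | Q , M₁ , params with kk-merge e (2 + e) refl Q
... | M₂ , merge = τ , λ {r} {𝒜} {ℬ} s → go (<-wellFounded (length ℬ)) s
  where
  d b* x τ : ℕ
  d = 2 + e
  b* = (M₁ + M₂) choose d
  x = drop-threshold d choose suc e
  -- The first summand serves families `ℬ` too small for the estimates, the second a last level at
  -- which fewer than `x` members of `ℬ` miss the core.
  τ = kk 0 b* + (x + kk 0 x)

  go : ∀ {r 𝒜 ℬ} → Acc _<_ (length ℬ) → System-at r (suc d) 𝒜 ℬ → length 𝒜 ≤ kk (suc e) (length ℬ) + τ
  go {r} {𝒜} {ℬ} (acc rs) s with length ℬ <? b* | length 𝒜 ≤? kk (suc e) (length ℬ)
  ... | _ | yes small = ≤-trans small (m≤m+n _ τ)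
  ... | yes few | no _ = ≤-trans (pair-bound-at s) (≤-trans (kk-mono 0 (<⇒≤ few)) (≤-trans (m≤m+n _ (x + kk 0 x)) (m≤n+m τ (kk (suc e) (length ℬ)))))
  ... | no many | no large with cascade (suc e) (length ℬ)
  ... | M , x′ , eq , x′< = conclude
    where
    open ≤-Reasoning
    open Decomposition s
    lo : M choose d ≤ length ℬ
    lo = ≤-trans (m≤m+n _ x′) (≤-reflexive (sym eq))
    hi′ : length ℬ < suc M choose d
    hi′ = subst₂ _<_ (sym eq) (sym (pascal M (suc e))) (+-monoʳ-< (M choose d) x′<)
    M≥ : M₁ + M₂ ≤ M
    M≥ = ≮⇒≥ λ M< → many (<-≤-trans hi′ (choose-monoˡ d M<))
    ps = params M (length ℬ) (≤-trans (m≤m+n M₁ M₂) M≥) lo (<⇒≤ hi′)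
    n = proj₁ ps
    n′ = proj₁ (proj₂ ps)
    ps′ = proj₂ (proj₂ ps)
    positive : 0 < length ℬ
    positive = n≢0⇒n>0 λ b≡0 → large (≤-trans (pair-bound-at s)
      (≤-reflexive (trans (cong (kk 0) b≡0) (trans (kk-0 0) (sym (trans (cong (kk (suc e)) b≡0) (kk-0 (suc e))))))))
    heavy = heavy-core n n′ sys positive (≤-trans (proj₁ ps′) (<⇒≤ (≰⇒> large))) (proj₁ (proj₂ ps′))
    A* = proj₁ heavy
    open At-core (core A*) (size-core (proj₁ (proj₂ heavy)))
    b≡ : length ℬ₀ + length ℬ₁ ≡ length ℬ
    b≡ = count-¬ (core A* ⊆?_) ℬ
    b≤Qb₀ : length ℬ ≤ Q * length ℬ₀
    b≤Qb₀ = proj₂ (proj₂ ps′) (length ℬ₀) (proj₂ (proj₂ heavy))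
    b₀>0 : 0 < length ℬ₀
    b₀>0 = n≢0⇒n>0 λ b₀≡0 → <-irrefl refl (<-≤-trans positive
      (≤-trans b≤Qb₀ (≤-reflexive (trans (cong (Q *_) b₀≡0) (*-zeroʳ Q)))))
    ℬ₁<ℬ : length ℬ₁ < length ℬ
    ℬ₁<ℬ = subst (length ℬ₁ <_) b≡ (+-monoˡ-< (length ℬ₁) b₀>0)
    conclude : length 𝒜 ≤ kk (suc e) (length ℬ) + τ
    conclude = by-size (x ≤? length ℬ₁)
      where
      by-size : Dec (x ≤ length ℬ₁) → length 𝒜 ≤ kk (suc e) (length ℬ) + τ
      by-size (yes x≤) = begin
        length 𝒜
          ≤⟨ bound ⟩
        kk (suc e) (length ℬ₀) + length ℬ₁ + length avoiding
          ≤⟨ +-monoʳ-≤ (kk (suc e) (length ℬ₀) + length ℬ₁) (go (rs ℬ₁<ℬ) avoiding-system) ⟩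
        kk (suc e) (length ℬ₀) + length ℬ₁ + (kk (suc e) (length ℬ₁) + τ)
          ≡⟨ +-assoc (kk (suc e) (length ℬ₀) + length ℬ₁) _ τ ⟨
        kk (suc e) (length ℬ₀) + length ℬ₁ + kk (suc e) (length ℬ₁) + τ
          ≤⟨ +-monoˡ-≤ τ (merge M (length ℬ₀) (length ℬ₁) (≤-trans (m≤n+m M₂ M₁) M≥)
               (≤-trans lo (≤-reflexive (sym b≡))) (≤-trans (≤-reflexive b≡) (<⇒≤ hi′))
               (≤-trans (≤-reflexive b≡) b≤Qb₀) x≤) ⟩
        kk (suc e) (length ℬ₀ + length ℬ₁) + τ
          ≡⟨ cong (λ z → kk (suc e) z + τ) b≡ ⟩
        kk (suc e) (length ℬ) + τ ∎
      by-size (no x≰) = begin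
        length 𝒜
          ≤⟨ bound ⟩
        kk (suc e) (length ℬ₀) + length ℬ₁ + length avoiding
          ≡⟨ +-assoc (kk (suc e) (length ℬ₀)) _ _ ⟩
        kk (suc e) (length ℬ₀) + (length ℬ₁ + length avoiding)
          ≤⟨ +-mono-≤ (kk-mono (suc e) (≤-trans (m≤m+n _ (length ℬ₁)) (≤-reflexive b≡)))
               (+-mono-≤ ℬ₁≤x (≤-trans (pair-bound-at avoiding-system) (kk-mono 0 ℬ₁≤x))) ⟩
        kk (suc e) (length ℬ) + (x + kk 0 x)
          ≤⟨ +-monoʳ-≤ (kk (suc e) (length ℬ)) (m≤n+m _ (kk 0 b*)) ⟩
        kk (suc e) (length ℬ) + τ ∎
        where
        ℬ₁≤x : length ℬ₁ ≤ x
        ℬ₁≤x = <⇒≤ (≰⇒> x≰)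

-- Admissible pairs in terms of removable elements

lookup-injective : ∀ {X : Set} {xs : List X} → Unique xs → ∀ i j → lookup xs i ≡ lookup xs j → i ≡ j
lookup-injective (_ ∷ _) Fin.zero Fin.zero _ = refl
lookup-injective (x∉ ∷ _) Fin.zero (Fin.suc j) eq = contradiction eq (All.lookup x∉ (∈-lookup j))
lookup-injective (x∉ ∷ _) (Fin.suc i) Fin.zero eq = contradiction (sym eq) (All.lookup x∉ (∈-lookup i))
lookup-injective (_ ∷ xs!) (Fin.suc i) (Fin.suc j) eq = cong Fin.suc (lookup-injective xs! i j eq)

map-unique : ∀ {X Y : Set} {f : X → Y} {xs} → Unique xs →
  (∀ {x y} → x ∈ xs → y ∈ xs → f x ≡ f y → x ≡ y) → Unique (map f xs)
map-unique [] _ = []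
map-unique {f = f} {x ∷ xs} (x∉ ∷ xs!) inj = ∉⇒Unique fx∉ (map-unique xs! λ p q → inj (there p) (there q))
  where
  fx∉ : f x ∉ map f xs
  fx∉ fx∈ with ∈-map⁻ f fx∈
  ... | y , y∈ , eq = All.lookup x∉ y∈ (inj (here refl) (there y∈) eq)

facet-of-size : ∀ {A B} → B ⊆ A → suc ∣ B ∣ ≡ ∣ A ∣ → ∃ λ v → v ∈ elements A × B ≡ A - v
facet-of-size {A} {B} B⊆A size with escape _≟_ {ys = elements B} (unique-elements A) (≤-reflexive size)
... | v , v∈A , v∉B = v , v∈A , set-ext {B} {A - v} sub
  (⊆-length⁻ (unique-elements B) sub (≤-reflexive (suc-injective (trans (size-minus v∈A) (sym size)))))
  where
  sub : B ⊆ (A - v)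
  sub x∈B = ∈-minus⁺ A (B⊆A x∈B) λ { refl → v∉B x∈B }

record Closed (r k : ℕ) (𝒜 ℬ : List FinSet) : Set where
  field
    system   : System-at r k 𝒜 ℬ
    ℬ-sized  : ∀ {B} → B ∈ ℬ → suc ∣ B ∣ ≡ r
  open System-at system public

closed⇒admissible : ∀ {r k 𝒜 ℬ} → Closed r k 𝒜 ℬ → Admissible r k (length ℬ) 𝒜 ℬ
closed⇒admissible {r} {k} {𝒜} {ℬ} closed = record
  { 𝒜-unique = 𝒜-unique ; ℬ-unique = ℬ-unique ; 𝒜-sizes = sizes ; ℬ-sizes = ℬ-sized ; ℬ-card = refl
  ; covers = λ {A} A∈ → facets A (covered A∈)
  , (λ {i} {j} eq → inject≤-injective (covered A∈) (covered A∈) i j (lookup-injective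
      (Uniqueₚ.filter⁺ (in? ℬ A) (unique-elements A)) _ _ (minus-cancel (proj₁ (facet∈ A (covered A∈) i)) eq)))
  , (λ i → proj₂ (facet∈ A (covered A∈) i) , λ x∈ → proj₁ (∈-minus⁻ A x∈)) }
  where
  open Closed closed
  removable : FinSet → List ℕ
  removable A = filter (in? ℬ A) (elements A)
  facets : ∀ A → k ≤ length (removable A) → Fin k → FinSet
  facets A k≤ i = A - lookup (removable A) (inject≤ i k≤)
  facet∈ : ∀ A (k≤ : k ≤ length (removable A)) i → lookup (removable A) (inject≤ i k≤) ∈ elements A × facets A k≤ i ∈ ℬ
  facet∈ A k≤ i = ∈-filter⁻ (in? ℬ A) {xs = elements A} (∈-lookup (inject≤ i k≤))

-- A subset with one element fewer is `A - v` for a suitable `v`, and distinct facets need distinct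
-- `v`.
admissible⇒closed : ∀ {r k b 𝒜 ℬ} → Admissible r k b 𝒜 ℬ → Closed r k 𝒜 ℬ
admissible⇒closed {r} {k} {b} {𝒜} {ℬ} adm = record
  { system = record { 𝒜-unique = 𝒜-unique ; ℬ-unique = ℬ-unique ; sizes = 𝒜-sizes ; covered = covered }
  ; ℬ-sized = ℬ-sizes }
  where
  open Admissible adm
  covered : ∀ {A} → A ∈ 𝒜 → k ≤ count (in? ℬ A) (elements A)
  covered {A} A∈ with covers A∈
  ... | Bs , inj , Bs-in = ≤-trans (≤-reflexive (sym (length-tabulate {n = k} id)))
    (injection-length {xs = tabulate id} {ys = filter (in? ℬ A) (elements A)} {R = λ i v → Bs i ≡ A - v}
      (Uniqueₚ.tabulate⁺ id)
      (λ {i} _ → let B∈ , B⊆A = Bs-in i ; v , v∈A , eq = facet-of-size {A} {Bs i} B⊆A (trans (ℬ-sizes B∈) (sym (𝒜-sizes A∈))) in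
        v , ∈-filter⁺ (in? ℬ A) v∈A (subst (_∈ ℬ) eq B∈) , eq)
      (λ _ _ eq eq′ → inj (trans eq (sym eq′))))

-- Adjoining a new largest element

insert : ℕ → FinSet → FinSet
insert t A = fromList (t ∷ elements A)

Below : ℕ → FinSet → Set
Below n A = ∀ {x} → x ∈ elements A → x < n

∈-insert⁻ : ∀ {t x} A → x ∈ elements (insert t A) → x ≡ t ⊎ x ∈ elements A
∈-insert⁻ A x∈ with ∈-fromList⁻ x∈
... | here eq = inj₁ eq
... | there x∈A = inj₂ x∈A

top-∉ : ∀ {t A} → Below t A → t ∉ elements A
top-∉ A<t t∈ = <-irrefl refl (A<t t∈)

insert-below : ∀ {t A} → Below t A → Below (suc t) (insert t A)
insert-below {t} {A} A<t x∈ with ∈-insert⁻ A x∈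
... | inj₁ refl = n<1+n t
... | inj₂ x∈A = m<n⇒m<1+n (A<t x∈A)

size-insert : ∀ {t A} → Below t A → ∣ insert t A ∣ ≡ suc ∣ A ∣
size-insert {t} {A} A<t = size-fromList (∉⇒Unique (top-∉ {A = A} A<t) (unique-elements A))

insert-minus : ∀ {t A} → Below t A → insert t A - t ≡ A
insert-minus {t} {A} A<t = set-ext {insert t A - t} {A}
  (λ x∈ → let x∈i , x≢t = ∈-minus⁻ (insert t A) x∈ in keep (∈-insert⁻ A x∈i) x≢t)
  (λ x∈A → ∈-minus⁺ (insert t A) (∈-fromList⁺ (there x∈A)) λ { refl → top-∉ {A = A} A<t x∈A })
  where
  keep : ∀ {x} → x ≡ t ⊎ x ∈ elements A → x ≢ t → x ∈ elements A
  keep (inj₁ eq) x≢t = contradiction eq x≢t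
  keep (inj₂ x∈A) _ = x∈A

insert-injective : ∀ {t A A′} → Below t A → Below t A′ → insert t A ≡ insert t A′ → A ≡ A′
insert-injective {t} {A} {A′} A<t A′<t eq = trans (sym (insert-minus {A = A} A<t)) (trans (cong (_- t) eq) (insert-minus {A = A′} A′<t))

minus-insert : ∀ {t A v} → v ≢ t → insert t (A - v) ≡ insert t A - v
minus-insert {t} {A} {v} v≢t = set-ext {insert t (A - v)} {insert t A - v} to from
  where
  to : insert t (A - v) ⊆ (insert t A - v)
  to x∈ with ∈-insert⁻ (A - v) x∈
  ... | inj₁ refl = ∈-minus⁺ (insert t A) (∈-fromList⁺ (here refl)) (v≢t ∘ sym)
  ... | inj₂ x∈A-v = let x∈A , x≢v = ∈-minus⁻ A x∈A-v in ∈-minus⁺ (insert t A) (∈-fromList⁺ (there x∈A)) x≢v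
  from : (insert t A - v) ⊆ insert t (A - v)
  from x∈ with ∈-minus⁻ (insert t A) x∈
  ... | x∈i , x≢v with ∈-insert⁻ A x∈i
  ... | inj₁ refl = ∈-fromList⁺ (here refl)
  ... | inj₂ x∈A = ∈-fromList⁺ (there (∈-minus⁺ A x∈A x≢v))

restore : ∀ {t A} → t ∈ elements A → insert t (A - t) ≡ A
restore {t} {A} t∈A = set-ext {insert t (A - t)} {A}
  (λ x∈ → back (∈-insert⁻ (A - t) x∈))
  (λ {x} x∈A → split x∈A (x ≟ t))
  where
  back : ∀ {x} → x ≡ t ⊎ x ∈ elements (A - t) → x ∈ elements A
  back (inj₁ refl) = t∈A
  back (inj₂ x∈) = proj₁ (∈-minus⁻ A x∈)
  split : ∀ {x} → x ∈ elements A → Dec (x ≡ t) → x ∈ elements (insert t (A - t))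
  split _ (yes refl) = ∈-fromList⁺ (here refl)
  split x∈A (no x≢t) = ∈-fromList⁺ (there (∈-minus⁺ A x∈A x≢t))

subsets : ℕ → ℕ → List FinSet
subsets n zero = fromList [] ∷ []
subsets zero (suc j) = []
subsets (suc n) (suc j) = subsets n (suc j) ++ map (insert n) (subsets n j)

subsets-below : ∀ n j {A} → A ∈ subsets n j → Below n A
subsets-below n zero (here refl) x∈ with () ← ∈-fromList⁻ x∈
subsets-below (suc n) (suc j) A∈ x∈ with ∈-++⁻ (subsets n (suc j)) A∈
... | inj₁ A∈ˡ = m<n⇒m<1+n (subsets-below n (suc j) A∈ˡ x∈)
... | inj₂ A∈ʳ with ∈-map⁻ (insert n) A∈ʳ
... | A′ , A′∈ , refl = insert-below {A = A′} (subsets-below n j A′∈) x∈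

subsets-size : ∀ n j {A} → A ∈ subsets n j → ∣ A ∣ ≡ j
subsets-size n zero (here refl) = size-fromList []
subsets-size (suc n) (suc j) A∈ with ∈-++⁻ (subsets n (suc j)) A∈
... | inj₁ A∈ˡ = subsets-size n (suc j) A∈ˡ
... | inj₂ A∈ʳ with ∈-map⁻ (insert n) A∈ʳ
... | A′ , A′∈ , refl = trans (size-insert {A = A′} (subsets-below n j A′∈)) (cong suc (subsets-size n j A′∈))

with-top-unique : ∀ {t} {𝒞 𝒟 : List FinSet} → Unique 𝒞 → Unique 𝒟 →
  (∀ {A} → A ∈ 𝒞 → Below t A) → (∀ {A} → A ∈ 𝒟 → Below t A) → Unique (𝒞 ++ map (insert t) 𝒟)
with-top-unique {t} {𝒞} {𝒟} 𝒞! 𝒟! 𝒞<t 𝒟<t = Uniqueₚ.++⁺ 𝒞!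
  (map-unique 𝒟! λ {A} {A′} A∈ A′∈ → insert-injective {A = A} {A′} (𝒟<t A∈) (𝒟<t A′∈)) disjoint
  where
  disjoint : ∀ {A} → ¬ (A ∈ 𝒞 × A ∈ map (insert t) 𝒟)
  disjoint {A} (A∈𝒞 , A∈) with ∈-map⁻ (insert t) A∈
  ... | A′ , _ , refl = top-∉ {A = insert t A′} (𝒞<t A∈𝒞) (∈-fromList⁺ (here refl))

subsets-unique : ∀ n j → Unique (subsets n j)
subsets-unique n zero = [] ∷ []
subsets-unique zero (suc j) = []
subsets-unique (suc n) (suc j) = with-top-unique (subsets-unique n (suc j)) (subsets-unique n j)
  (subsets-below n (suc j)) (subsets-below n j)

subsets-length : ∀ n j → length (subsets n j) ≡ n choose j
subsets-length n zero = sym (choose-0 n)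
subsets-length zero (suc j) = sym (choose-zero (s≤s z≤n))
subsets-length (suc n) (suc j) = trans (length-++ (subsets n (suc j)))
  (trans (cong₂ _+_ (subsets-length n (suc j)) (trans (length-map (insert n) (subsets n j)) (subsets-length n j))) (sym (pascal n j)))

subsets-complete : ∀ n j {A} → ∣ A ∣ ≡ j → Below n A → A ∈ subsets n j
subsets-complete n zero {A} size _ = here (set-ext {A} {fromList []} (λ x∈ → contradiction (∈-length x∈) (λ 0< → <-irrefl (sym size) 0<))
  (λ {x} x∈ → contradiction (∈-fromList⁻ {x} {[]} x∈) λ ()))
subsets-complete zero (suc j) {A} size A<0 with escape _≟_ {ys = []} (unique-elements A) (≤-trans (s≤s z≤n) (≤-reflexive (sym size)))
... | x , x∈ , _ with () ← A<0 x∈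
subsets-complete (suc n) (suc j) {A} size A<sn with n ∈ℕ? elements A
... | no n∉ = ∈-++⁺ˡ (subsets-complete n (suc j) {A} size λ x∈ → ≤∧≢⇒< (≤-pred (A<sn x∈)) λ { refl → n∉ x∈ })
... | yes n∈ = ∈-++⁺ʳ (subsets n (suc j)) (subst (_∈ map (insert n) (subsets n j)) (restore n∈)
  (∈-map⁺ (insert n) (subsets-complete n j {A - n} (suc-injective (trans (size-minus n∈) size))
    λ x∈ → let x∈A , x≢n = ∈-minus⁻ A x∈ in ≤∧≢⇒< (≤-pred (A<sn x∈A)) x≢n)))

-- Existence of the maximum

open import Data.List.Relation.Unary.Unique.DecPropositional _≟ˢ_ using (unique?)

index : List ℕ → ℕ → ℕ
index [] x = 0
index (y ∷ ys) x with x ≟ y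
... | yes _ = 0
... | no _ = suc (index ys x)

index< : ∀ {x} ys → x ∈ ys → index ys x < length ys
index< {x} (y ∷ ys) x∈ with x ≟ y | x∈
... | yes _ | _ = s≤s z≤n
... | no x≢y | here x≡y = contradiction x≡y x≢y
... | no _ | there x∈ys = s≤s (index< ys x∈ys)

index-injective : ∀ {x x′} ys → x ∈ ys → x′ ∈ ys → index ys x ≡ index ys x′ → x ≡ x′
index-injective {x} {x′} (y ∷ ys) x∈ x′∈ eq with x ≟ y | x′ ≟ y
... | yes refl | yes refl = refl
index-injective (y ∷ ys) x∈ x′∈ () | yes _ | no _
index-injective (y ∷ ys) x∈ x′∈ () | no _ | yes _
index-injective (y ∷ ys) x∈ x′∈ eq | no x≢y | no x′≢y =
  index-injective ys (tail x∈ x≢y) (tail x′∈ x′≢y) (suc-injective eq)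
  where
  tail : ∀ {z} → z ∈ y ∷ ys → z ≢ y → z ∈ ys
  tail (here z≡y) z≢y = contradiction z≡y z≢y
  tail (there z∈) _ = z∈

-- The ground set can be shrunk to {0, …, b r - 1}: for k ≥ 2 every element of a
-- member of 𝒜 already occurs in ℬ.
module Relabel {r e b 𝒜 ℬ} (adm : Admissible r (2 + e) b 𝒜 ℬ) where
  open Admissible adm
  private
    -- Repetitions are harmless: `index` returns the first position, which still determines the
    -- element.
    ground : List ℕ
    ground = concat (map elements ℬ)

    ground-length : length ground ≤ b * r
    ground-length = subst (λ b → length ground ≤ b * r) ℬ-card (short ℬ λ B∈ → ≤-trans (n≤1+n _) (≤-reflexive (ℬ-sizes B∈)))
      where
      short : ∀ ℬ → (∀ {B} → B ∈ ℬ → ∣ B ∣ ≤ r) → length (concat (map elements ℬ)) ≤ length ℬ * r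
      short [] _ = z≤n
      short (B ∷ ℬ) h = ≤-trans (≤-reflexive (length-++ (elements B))) (+-mono-≤ (h (here refl)) (short ℬ (h ∘ there)))

    Grounded : FinSet → Set
    Grounded A = ∀ {x} → x ∈ elements A → x ∈ ground

    ℬ-grounded : ∀ {B} → B ∈ ℬ → Grounded B
    ℬ-grounded B∈ x∈ = ∈-concat⁺′ x∈ (∈-map⁺ elements B∈)

    𝒜-grounded : ∀ {A} → A ∈ 𝒜 → Grounded A
    𝒜-grounded {A} A∈ {x} x∈A
      with escape _≟_ {ys = x ∷ []} (Uniqueₚ.filter⁺ (in? ℬ A) (unique-elements A))
             (≤-trans (s≤s (s≤s z≤n)) (Closed.covered (admissible⇒closed adm) A∈))
    ... | v , v∈ , v∉ = ℬ-grounded (proj₂ (∈-filter⁻ (in? ℬ A) {xs = elements A} v∈))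
      (∈-minus⁺ A x∈A λ { refl → v∉ (here refl) })

  relabel : FinSet → FinSet
  relabel A = fromList (map (index ground) (elements A))

  private
    ∈-relabel⁻ : ∀ {A y} → y ∈ elements (relabel A) → ∃ λ x → x ∈ elements A × y ≡ index ground x
    ∈-relabel⁻ y∈ = ∈-map⁻ (index ground) (∈-fromList⁻ y∈)

    relabel-below : ∀ {A} → Grounded A → Below (b * r) (relabel A)
    relabel-below {A} A⊆ y∈ with ∈-relabel⁻ {A} y∈
    ... | x , x∈ , refl = ≤-trans (index< ground (A⊆ x∈)) ground-length

    relabel-size : ∀ {A} → Grounded A → ∣ relabel A ∣ ≡ ∣ A ∣
    relabel-size {A} A⊆ = trans
      (size-fromList (map-unique (unique-elements A) λ x∈ y∈ → index-injective ground (A⊆ x∈) (A⊆ y∈)))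
      (length-map (index ground) (elements A))

    relabel-⊆ : ∀ {A B} → A ⊆ B → relabel A ⊆ relabel B
    relabel-⊆ {A} {B} A⊆B y∈ with ∈-relabel⁻ {A} y∈
    ... | x , x∈ , refl = ∈-fromList⁺ (∈-map⁺ (index ground) (A⊆B x∈))

    relabel-injective : ∀ {A B} → Grounded A → Grounded B → relabel A ≡ relabel B → A ≡ B
    relabel-injective {A} {B} A⊆ B⊆ eq = set-ext {A} {B} (half {A} {B} A⊆ B⊆ eq) (half {B} {A} B⊆ A⊆ (sym eq))
      where
      half : ∀ {A B} → Grounded A → Grounded B → relabel A ≡ relabel B → A ⊆ B
      half {A} {B} A⊆ B⊆ eq x∈ with ∈-relabel⁻ {B} (subst (λ A → _ ∈ elements A) eq (∈-fromList⁺ (∈-map⁺ (index ground) x∈)))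
      ... | y , y∈ , same = subst (_∈ elements B) (sym (index-injective ground (A⊆ x∈) (B⊆ y∈) same)) y∈

  𝒜′ ℬ′ : List FinSet
  𝒜′ = map relabel 𝒜
  ℬ′ = map relabel ℬ

  below : ∀ {A} → A ∈ 𝒜′ ⊎ A ∈ ℬ′ → Below (b * r) A
  below (inj₁ A∈) with ∈-map⁻ relabel A∈
  ... | A , A∈𝒜 , refl = relabel-below {A} (𝒜-grounded A∈𝒜)
  below (inj₂ B∈) with ∈-map⁻ relabel B∈
  ... | B , B∈ℬ , refl = relabel-below {B} (ℬ-grounded B∈ℬ)

  admissible′ : Admissible r (2 + e) b 𝒜′ ℬ′
  admissible′ = record
    { 𝒜-unique = map-unique 𝒜-unique λ {A} {B} A∈ B∈ → relabel-injective {A} {B} (𝒜-grounded A∈) (𝒜-grounded B∈)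
    ; ℬ-unique = map-unique ℬ-unique λ {A} {B} A∈ B∈ → relabel-injective {A} {B} (ℬ-grounded A∈) (ℬ-grounded B∈)
    ; 𝒜-sizes = 𝒜-sizes′ ; ℬ-sizes = ℬ-sizes′
    ; ℬ-card = trans (length-map relabel ℬ) ℬ-card ; covers = covers′ }
    where
    𝒜-sizes′ : ∀ {A} → A ∈ 𝒜′ → ∣ A ∣ ≡ r
    𝒜-sizes′ A∈ with ∈-map⁻ relabel A∈
    ... | A , A∈𝒜 , refl = trans (relabel-size {A} (𝒜-grounded A∈𝒜)) (𝒜-sizes A∈𝒜)
    ℬ-sizes′ : ∀ {B} → B ∈ ℬ′ → suc ∣ B ∣ ≡ r
    ℬ-sizes′ B∈ with ∈-map⁻ relabel B∈
    ... | B , B∈ℬ , refl = trans (cong suc (relabel-size {B} (ℬ-grounded B∈ℬ))) (ℬ-sizes B∈ℬ)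
    covers′ : ∀ {A} → A ∈ 𝒜′ → Σ[ Bs ∈ (Fin (2 + e) → FinSet) ] (Injective _≡_ _≡_ Bs × (∀ i → Bs i ∈ ℬ′ × Bs i ⊆ A))
    covers′ A∈ with ∈-map⁻ relabel A∈
    ... | A , A∈𝒜 , refl with covers A∈𝒜
    ... | Bs , inj , Bs-in = relabel ∘ Bs
      , (λ {i} {j} eq → inj (relabel-injective {Bs i} {Bs j} (ℬ-grounded (proj₁ (Bs-in i))) (ℬ-grounded (proj₁ (Bs-in j))) eq))
      , λ i → ∈-map⁺ relabel (proj₁ (Bs-in i)) , relabel-⊆ {Bs i} {A} (proj₂ (Bs-in i))

tuples : ∀ {X : Set} → ℕ → List X → List (List X)
tuples zero U = [] ∷ []
tuples (suc n) U = cartesianProductWith _∷_ U (tuples n U)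

∈-tuples⁺ : ∀ {X : Set} {U : List X} xs → (∀ {x} → x ∈ xs → x ∈ U) → xs ∈ tuples (length xs) U
∈-tuples⁺ [] _ = here refl
∈-tuples⁺ (x ∷ xs) h = ∈-cartesianProductWith⁺ _∷_ (h (here refl)) (∈-tuples⁺ xs (h ∘ there))

∈-tuples⁻ : ∀ {X : Set} {U : List X} n {xs} → xs ∈ tuples n U → length xs ≡ n × (∀ {x} → x ∈ xs → x ∈ U)
∈-tuples⁻ zero (here refl) = refl , λ ()
∈-tuples⁻ {U = U} (suc n) xs∈ with ∈-cartesianProductWith⁻ _∷_ U (tuples n U) xs∈
... | x , xs , x∈ , xs∈′ , refl with ∈-tuples⁻ n xs∈′
... | len , sub = cong suc len , λ { (here refl) → x∈ ; (there y∈) → sub y∈ }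

maximum : ∀ {X : Set} (f : X → ℕ) xs {x} → x ∈ xs → ∃ λ x* → x* ∈ xs × (∀ {y} → y ∈ xs → f y ≤ f x*)
maximum f (x ∷ []) _ = x , here refl , λ { (here refl) → ≤-refl }
maximum f (x ∷ xs@(_ ∷ _)) _ with maximum f xs (here refl)
... | x* , x*∈ , best with ≤-total (f x) (f x*)
... | inj₁ x≤ = x* , there x*∈ , λ { (here refl) → x≤ ; (there y∈) → best y∈ }
... | inj₂ x*≤ = x , here refl , λ { (here refl) → ≤-refl ; (there y∈) → ≤-trans (best y∈) x*≤ }

-- After relabelling only finitely many `ℬ` remain, and for each of them the best `𝒜` consists of
-- all sets with at least `k` facets in it. The given pair shows that the list of candidates is not
-- empty.
maximum-exists : ∀ {r e b 𝒜₀ ℬ₀} → Admissible (suc r) (2 + e) b 𝒜₀ ℬ₀ → ∃ λ m → f[ suc r , 2 + e , b ]≡ m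
maximum-exists {r} {e} {b} adm₀ = length (full ℬ*) , ((full ℬ* , ℬ* , full-admissible ℬ*∈ , refl) , bounded)
  where
  k = 2 + e
  M = b * suc r
  rich? : ∀ ℬ A → Dec (k ≤ count (in? ℬ A) (elements A))
  rich? ℬ A = k ≤? count (in? ℬ A) (elements A)
  full : List FinSet → List FinSet
  full ℬ = filter (rich? ℬ) (subsets M (suc r))
  candidates = filter unique? (tuples b (subsets M r))

  candidate : ∀ {ℬ} → ℬ ∈ candidates → Unique ℬ × length ℬ ≡ b × (∀ {B} → B ∈ ℬ → B ∈ subsets M r)
  candidate ℬ∈ = let ℬ∈t , ℬ! = ∈-filter⁻ unique? {xs = tuples b (subsets M r)} ℬ∈ ; len , sub = ∈-tuples⁻ b ℬ∈t in ℬ! , len , sub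

  full-admissible : ∀ {ℬ} → ℬ ∈ candidates → Admissible (suc r) k b (full ℬ) ℬ
  full-admissible {ℬ} ℬ∈ with candidate ℬ∈
  ... | ℬ! , refl , sub = closed⇒admissible (record
    { system = record
      { 𝒜-unique = Uniqueₚ.filter⁺ (rich? ℬ) (subsets-unique M (suc r)) ; ℬ-unique = ℬ!
      ; sizes = λ A∈ → subsets-size M (suc r) (proj₁ (∈-filter⁻ (rich? ℬ) {xs = subsets M (suc r)} A∈))
      ; covered = λ A∈ → proj₂ (∈-filter⁻ (rich? ℬ) {xs = subsets M (suc r)} A∈) }
    ; ℬ-sized = λ B∈ → cong suc (subsets-size M r (sub B∈)) })

  into : ∀ {𝒜 ℬ} → Admissible (suc r) k b 𝒜 ℬ → ∃ λ ℬ′ → ℬ′ ∈ candidates × length 𝒜 ≤ length (full ℬ′)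
  into {𝒜} {ℬ} adm = ℬ′
    , ∈-filter⁺ unique? (subst (λ b → ℬ′ ∈ tuples b (subsets M r)) ℬ-card (∈-tuples⁺ ℬ′ λ {B} B∈ →
        subsets-complete M r {B} (suc-injective (ℬ-sizes B∈)) (below (inj₂ B∈)))) ℬ-unique
    , ≤-trans (≤-reflexive (sym (length-map relabel 𝒜)))
        (⊆-length 𝒜-unique λ {A} A∈ → ∈-filter⁺ (rich? ℬ′)
          (subsets-complete M (suc r) {A} (𝒜-sizes A∈) (below (inj₁ A∈)))
          (Closed.covered (admissible⇒closed admissible′) A∈))
    where
    open Relabel adm
    open Admissible admissible′

  best = maximum (length ∘ full) candidates (proj₁ (proj₂ (into adm₀)))
  ℬ* = proj₁ best
  ℬ*∈ = proj₁ (proj₂ best)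
  bounded : ∀ 𝒜 ℬ → Admissible (suc r) k b 𝒜 ℬ → length 𝒜 ≤ length (full ℬ*)
  bounded 𝒜 ℬ adm = let ℬ′ , ℬ′∈ , 𝒜≤ = into adm in ≤-trans 𝒜≤ (proj₂ (proj₂ best) ℬ′∈)

-- The lower bound

∑choose : ∀ s {d} → (Fin d → ℕ) → ℕ
∑choose s {d} c = ∑[ i < d ] (c i choose (s + toℕ i))

∑choose-last : ∀ s {d} (c : Fin (suc d) → ℕ) →
  ∑choose s c ≡ ∑choose s (c ∘ inject₁) + c (fromℕ d) choose (s + d)
∑choose-last s {d} c = trans (sum-init-last (λ i → c i choose (s + toℕ i)))
  (cong₂ _+_ (sum-cong-≗ {d} λ i → cong (λ j → c (inject₁ i) choose (s + j)) (toℕ-inject₁ i))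
             (cong (λ j → c (fromℕ d) choose (s + j)) (toℕ-fromℕ d)))

Increasing : ∀ {d} → (Fin d → ℕ) → Set
Increasing c = c Preserves Fin._<_ ⟶ _<_

increasing-init : ∀ {d} {c : Fin (suc d) → ℕ} → Increasing c → Increasing (c ∘ inject₁)
increasing-init {c = c} inc {i} {j} i<j = inc (subst₂ _<_ (sym (toℕ-inject₁ i)) (sym (toℕ-inject₁ j)) i<j)

increasing-last : ∀ {d} {c : Fin (suc d) → ℕ} → Increasing c → ∀ i → c (inject₁ i) < c (fromℕ d)
increasing-last {d} inc i = inc (subst₂ _<_ (sym (toℕ-inject₁ i)) (sym (toℕ-fromℕ d)) (toℕ<n i))

∑choose-bound : ∀ {d} (c : Fin d → ℕ) → Increasing c → ∀ {N} → (∀ i → c i < N) → ∑choose 1 c ≤ N choose d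
∑choose-bound {zero} c inc {N} _ = ≤-trans z≤n (≤-reflexive (sym (choose-0 N)))
∑choose-bound {suc d} c inc {N} c<N = begin
  ∑choose 1 c                                     ≡⟨ ∑choose-last 1 c ⟩
  ∑choose 1 (c ∘ inject₁) + top choose suc d      ≤⟨ +-monoˡ-≤ (top choose suc d) (∑choose-bound (c ∘ inject₁) (increasing-init inc) (increasing-last inc)) ⟩
  top choose d + top choose suc d                 ≡⟨ +-comm (top choose d) _ ⟩
  top choose suc d + top choose d                 ≡⟨ pascal top d ⟨
  suc top choose suc d                            ≤⟨ choose-monoˡ (suc d) (c<N (fromℕ d)) ⟩
  N choose suc d                                  ∎
  where
  open ≤-Reasoning
  top = c (fromℕ d)

-- The largest term is taken off, and `∑choose-bound` says that the other terms form a permitted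
-- remainder for `kk-step`. This identifies the sum in the theorem with the Kruskal-Katona function.
kk-∑choose : ∀ e (c : Fin (suc e) → ℕ) → Increasing c → kk e (∑choose 1 c) ≡ ∑choose 2 c
kk-∑choose zero c inc = begin
  kk 0 (c Fin.zero choose 1 + 0)   ≡⟨ cong (kk 0) (trans (+-identityʳ _) (choose-1 _)) ⟩
  kk 0 (c Fin.zero)                ≡⟨ kk-zero _ ⟩
  c Fin.zero choose 2              ≡⟨ +-identityʳ _ ⟨
  c Fin.zero choose 2 + 0          ∎
  where open ≡-Reasoning
kk-∑choose (suc e) c inc = begin
  kk (suc e) (∑choose 1 c)                  ≡⟨ cong (kk (suc e)) (trans (∑choose-last 1 c) (+-comm rest _)) ⟩
  kk (suc e) (top choose (2 + e) + rest)    ≡⟨ kk-step e top (∑choose-bound (c ∘ inject₁) (increasing-init inc) (increasing-last inc)) ⟩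
  top choose (3 + e) + kk e rest            ≡⟨ cong (top choose (3 + e) +_) (kk-∑choose e (c ∘ inject₁) (increasing-init inc)) ⟩
  top choose (3 + e) + ∑choose 2 (c ∘ inject₁) ≡⟨ +-comm (top choose (3 + e)) _ ⟩
  ∑choose 2 (c ∘ inject₁) + top choose (3 + e) ≡⟨ ∑choose-last 2 c ⟨
  ∑choose 2 c                               ∎
  where
  open ≡-Reasoning
  top = c (fromℕ (suc e))
  rest = ∑choose 1 (c ∘ inject₁)

record Family (d N : ℕ) (𝒜 ℬ : List FinSet) : Set where
  field
    𝒜!      : Unique 𝒜
    ℬ!      : Unique ℬ
    𝒜-size  : ∀ {A} → A ∈ 𝒜 → ∣ A ∣ ≡ suc d
    ℬ-size  : ∀ {B} → B ∈ ℬ → ∣ B ∣ ≡ d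
    𝒜-below : ∀ {A} → A ∈ 𝒜 → Below N A
    ℬ-below : ∀ {B} → B ∈ ℬ → Below N B
    facets  : ∀ {A v} → A ∈ 𝒜 → v ∈ elements A → A - v ∈ ℬ

-- Initial segments of the colexicographic order: all sets below `t`, then sets with maximum `t`.
-- Removing `t` from one of the latter gives a set below `t`, and those are all present; removing
-- another element is left to the smaller family.
family-step : ∀ {d t N 𝒜 ℬ} → t < N → Family d t 𝒜 ℬ →
  Family (suc d) N (subsets t (2 + d) ++ map (insert t) 𝒜) (subsets t (suc d) ++ map (insert t) ℬ)
family-step {d} {t} {N} {𝒜} {ℬ} t<N fam = record
  { 𝒜! = with-top-unique (subsets-unique t (2 + d)) 𝒜! (subsets-below t (2 + d)) 𝒜-below
  ; ℬ! = with-top-unique (subsets-unique t (suc d)) ℬ! (subsets-below t (suc d)) ℬ-below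
  ; 𝒜-size = step-size (subsets-size t (2 + d)) 𝒜-below 𝒜-size
  ; ℬ-size = step-size (subsets-size t (suc d)) ℬ-below ℬ-size
  ; 𝒜-below = step-below (subsets-below t (2 + d)) 𝒜-below
  ; ℬ-below = step-below (subsets-below t (suc d)) ℬ-below
  ; facets = step-facets }
  where
  open Family fam
  step-size : ∀ {j 𝒞 𝒟} → (∀ {A} → A ∈ 𝒞 → ∣ A ∣ ≡ suc j) → (∀ {A} → A ∈ 𝒟 → Below t A) → (∀ {A} → A ∈ 𝒟 → ∣ A ∣ ≡ j) →
    ∀ {A} → A ∈ 𝒞 ++ map (insert t) 𝒟 → ∣ A ∣ ≡ suc j
  step-size {𝒞 = 𝒞} 𝒞-size 𝒟<t 𝒟-size A∈ with ∈-++⁻ 𝒞 A∈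
  ... | inj₁ A∈𝒞 = 𝒞-size A∈𝒞
  ... | inj₂ A∈ʳ with ∈-map⁻ (insert t) A∈ʳ
  ... | A , A∈𝒟 , refl = trans (size-insert {A = A} (𝒟<t A∈𝒟)) (cong suc (𝒟-size A∈𝒟))
  step-below : ∀ {𝒞 𝒟} → (∀ {A} → A ∈ 𝒞 → Below t A) → (∀ {A} → A ∈ 𝒟 → Below t A) →
    ∀ {A} → A ∈ 𝒞 ++ map (insert t) 𝒟 → Below N A
  step-below {𝒞} 𝒞<t 𝒟<t A∈ x∈ with ∈-++⁻ 𝒞 A∈
  ... | inj₁ A∈𝒞 = <-trans (𝒞<t A∈𝒞 x∈) t<N
  ... | inj₂ A∈ʳ with ∈-map⁻ (insert t) A∈ʳ
  ... | A , A∈𝒟 , refl = <-≤-trans (insert-below {A = A} (𝒟<t A∈𝒟) x∈) t<N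
  step-facets : ∀ {A v} → A ∈ subsets t (2 + d) ++ map (insert t) 𝒜 → v ∈ elements A →
    A - v ∈ subsets t (suc d) ++ map (insert t) ℬ
  step-facets {A} {v} A∈ v∈ with ∈-++⁻ (subsets t (2 + d)) A∈
  ... | inj₁ A∈ˡ = ∈-++⁺ˡ (subsets-complete t (suc d) {A - v}
    (suc-injective (trans (size-minus v∈) (subsets-size t (2 + d) A∈ˡ)))
    (λ x∈ → subsets-below t (2 + d) A∈ˡ (proj₁ (∈-minus⁻ A x∈))))
  ... | inj₂ A∈ʳ with ∈-map⁻ (insert t) A∈ʳ
  ... | A′ , A′∈ , refl with v ≟ t
  ... | yes refl = ∈-++⁺ˡ (subst (_∈ subsets t (suc d)) (sym (insert-minus {A = A′} (𝒜-below A′∈)))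
    (subsets-complete t (suc d) {A′} (𝒜-size A′∈) (𝒜-below A′∈)))
  ... | no v≢t with ∈-insert⁻ A′ v∈
  ... | inj₁ v≡t = contradiction v≡t v≢t
  ... | inj₂ v∈A′ = ∈-++⁺ʳ (subsets t (suc d)) (subst (_∈ map (insert t) ℬ) (minus-insert {A = A′} v≢t)
    (∈-map⁺ (insert t) (facets A′∈ v∈A′)))

cascade-family : ∀ d (c : Fin d → ℕ) → Increasing c → ∀ N → (∀ i → c i < N) →
  ∃₂ λ 𝒜 ℬ → Family d N 𝒜 ℬ × length 𝒜 ≡ ∑choose 2 c × length ℬ ≡ ∑choose 1 c
cascade-family zero c inc N _ = [] , [] , record
  { 𝒜! = [] ; ℬ! = [] ; 𝒜-size = λ () ; ℬ-size = λ () ; 𝒜-below = λ () ; ℬ-below = λ () ; facets = λ () } , refl , refl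
cascade-family (suc d) c inc N c<N with cascade-family d (c ∘ inject₁) (increasing-init inc) (c (fromℕ d)) (increasing-last inc)
... | 𝒜 , ℬ , fam , 𝒜-len , ℬ-len = _ , _ , family-step (c<N (fromℕ d)) fam , len 2 𝒜 𝒜-len , len 1 ℬ ℬ-len
  where
  top = c (fromℕ d)
  len : ∀ s 𝒟 → length 𝒟 ≡ ∑choose s (c ∘ inject₁) → length (subsets top (s + d) ++ map (insert top) 𝒟) ≡ ∑choose s c
  len s 𝒟 eq = begin
    length (subsets top (s + d) ++ map (insert top) 𝒟)    ≡⟨ length-++ (subsets top (s + d)) ⟩
    length (subsets top (s + d)) + length (map (insert top) 𝒟)
      ≡⟨ cong₂ _+_ (subsets-length top (s + d)) (trans (length-map (insert top) 𝒟) eq) ⟩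
    top choose (s + d) + ∑choose s (c ∘ inject₁)          ≡⟨ +-comm (top choose (s + d)) _ ⟩
    ∑choose s (c ∘ inject₁) + top choose (s + d)          ≡⟨ ∑choose-last s c ⟨
    ∑choose s c                                           ∎
    where open ≡-Reasoning

BelowAll : ℕ → List FinSet → Set
BelowAll N 𝒟 = ∀ {A} → A ∈ 𝒟 → Below N A

family⇒closed : ∀ {d N 𝒜 ℬ} → Family d N 𝒜 ℬ → Closed (suc d) (suc d) 𝒜 ℬ
family⇒closed {d} {𝒜 = 𝒜} {ℬ} fam = record
  { system = record { 𝒜-unique = 𝒜! ; ℬ-unique = ℬ! ; sizes = 𝒜-size ; covered = covered }
  ; ℬ-sized = cong suc ∘ ℬ-size }
  where
  open Family fam
  covered : ∀ {A} → A ∈ 𝒜 → suc d ≤ count (in? ℬ A) (elements A)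
  covered {A} A∈ = ≤-trans (≤-reflexive (sym (𝒜-size A∈)))
    (⊆-length (unique-elements A) λ v∈ → ∈-filter⁺ (in? ℬ A) v∈ (facets A∈ v∈))

-- Removing an old element commutes with adjoining `N`, so each removable element stays removable.
-- This raises `r` while `k` and both cardinalities stay fixed.
closed-cone : ∀ {r k N 𝒜 ℬ} → BelowAll N 𝒜 → BelowAll N ℬ → Closed r k 𝒜 ℬ →
  Closed (suc r) k (map (insert N) 𝒜) (map (insert N) ℬ)
closed-cone {r} {k} {N} {𝒜} {ℬ} 𝒜<N ℬ<N closed = record
  { system = record
    { 𝒜-unique = map-unique 𝒜-unique λ {A} {B} A∈ B∈ → insert-injective {A = A} {B} (𝒜<N A∈) (𝒜<N B∈)
    ; ℬ-unique = map-unique ℬ-unique λ {A} {B} A∈ B∈ → insert-injective {A = A} {B} (ℬ<N A∈) (ℬ<N B∈)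
    ; sizes = sizes′ ; covered = covered′ }
  ; ℬ-sized = ℬ-sized′ }
  where
  open Closed closed
  sizes′ : ∀ {A} → A ∈ map (insert N) 𝒜 → ∣ A ∣ ≡ suc r
  sizes′ A∈ with ∈-map⁻ (insert N) A∈
  ... | A , A∈𝒜 , refl = trans (size-insert {A = A} (𝒜<N A∈𝒜)) (cong suc (sizes A∈𝒜))
  ℬ-sized′ : ∀ {B} → B ∈ map (insert N) ℬ → suc ∣ B ∣ ≡ suc r
  ℬ-sized′ B∈ with ∈-map⁻ (insert N) B∈
  ... | B , B∈ℬ , refl = cong suc (trans (size-insert {A = B} (ℬ<N B∈ℬ)) (ℬ-sized B∈ℬ))
  covered′ : ∀ {A} → A ∈ map (insert N) 𝒜 → k ≤ count (in? (map (insert N) ℬ) A) (elements A)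
  covered′ A∈ with ∈-map⁻ (insert N) A∈
  ... | A , A∈𝒜 , refl = ≤-trans (covered A∈𝒜) (⊆-count (in? ℬ A) (in? (map (insert N) ℬ) (insert N A)) (unique-elements A)
    λ {v} v∈A A-v∈ → ∈-fromList⁺ (there v∈A)
      , subst (_∈ map (insert N) ℬ) (minus-insert {A = A} λ { refl → top-∉ {A = A} (𝒜<N A∈𝒜) v∈A }) (∈-map⁺ (insert N) A-v∈))

closed-cones : ∀ j {r k N 𝒜 ℬ} → BelowAll N 𝒜 → BelowAll N ℬ → Closed r k 𝒜 ℬ →
  ∃₂ λ 𝒜′ ℬ′ → Closed (j + r) k 𝒜′ ℬ′ × length 𝒜′ ≡ length 𝒜 × length ℬ′ ≡ length ℬ
closed-cones zero _ _ closed = _ , _ , closed , refl , refl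
closed-cones (suc j) {r} {k} {N} {𝒜} {ℬ} 𝒜<N ℬ<N closed
  with closed-cones j (above 𝒜<N) (above ℬ<N) (closed-cone {N = N} 𝒜<N ℬ<N closed)
  where
  above : ∀ {𝒟} → BelowAll N 𝒟 → BelowAll (suc N) (map (insert N) 𝒟)
  above 𝒟<N A∈ x∈ with ∈-map⁻ (insert N) A∈
  ... | A , A∈𝒟 , refl = insert-below {A = A} (𝒟<N A∈𝒟) x∈
... | 𝒜′ , ℬ′ , closed′ , len , len′ = 𝒜′ , ℬ′
  , subst (λ r → Closed r k 𝒜′ ℬ′) (+-suc j r) closed′
  , trans len (length-map (insert N) 𝒜) , trans len′ (length-map (insert N) ℬ)

cascade-admissible : ∀ {r e} → 2 + e ≤ r → (c : Fin (suc e) → ℕ) → Increasing c →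
  ∃₂ λ 𝒜 ℬ → Admissible r (2 + e) (∑choose 1 c) 𝒜 ℬ × length 𝒜 ≡ ∑choose 2 c
cascade-admissible {r} {e} k≤r c inc with cascade-family (suc e) c inc (suc (c (fromℕ e))) below-last
  where
  below-last : ∀ i → c i < suc (c (fromℕ e))
  below-last i = s≤s (≮⇒≥ λ c< → <-irrefl refl (<-≤-trans c< (c-max i)))
    where
    c-max : ∀ i → c i ≤ c (fromℕ e)
    c-max i with m≤n⇒m<n∨m≡n (subst (toℕ i ≤_) (sym (toℕ-fromℕ e)) (≤-pred (toℕ<n i)))
    ... | inj₁ i< = <⇒≤ (inc i<)
    ... | inj₂ i≡ = ≤-reflexive (cong c (toℕ-injective i≡))
... | 𝒜 , ℬ , fam , 𝒜-len , ℬ-len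
  with closed-cones (r ∸ (2 + e)) (Family.𝒜-below fam) (Family.ℬ-below fam) (family⇒closed fam)
... | 𝒜′ , ℬ′ , closed , 𝒜′-len , ℬ′-len = 𝒜′ , ℬ′
  , subst₂ (λ r b → Admissible r (2 + e) b 𝒜′ ℬ′) (m∸n+n≡m k≤r) (trans ℬ′-len ℬ-len) (closed⇒admissible closed)
  , trans 𝒜′-len 𝒜-len

-- The cases k = 0 and k = 1, and the theorem

choose-grows : ∀ r m → suc m ≤ (m + suc r) choose suc r
choose-grows r zero = ≤-reflexive (sym (choose-self (suc r)))
choose-grows r (suc m) = begin
  suc (suc m)                                       ≡⟨ +-comm 1 (suc m) ⟩
  suc m + 1                                         ≤⟨ +-mono-≤ (choose-grows r m) (choose-pos (≤-trans (n≤1+n r) (m≤n+m (suc r) m))) ⟩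
  (m + suc r) choose suc r + (m + suc r) choose r   ≡⟨ pascal (m + suc r) r ⟨
  suc (m + suc r) choose suc r                      ∎
  where open ≤-Reasoning

-- For r = 0 the empty set is the only possible member. For r > 0 nothing constrains `𝒜`, so no
-- maximum exists: the r-subsets of a large enough segment number more than any proposed `m`.
f-k≡0 : ∀ r m → f[ r , 0 , 0 ]≡ m → m ≤ 1
f-k≡0 zero m ((𝒜 , ℬ , adm , refl) , _) = injection-length {ys = fromList [] ∷ []} {R = λ _ _ → ⊤} 𝒜-unique
  (λ _ → _ , here refl , tt)
  (λ {A} {A′} A∈ A′∈ _ _ → set-ext {A} {A′} (empty {A} {A′} A∈) (empty {A′} {A} A′∈))
  where
  open Admissible adm
  empty : ∀ {A B} → A ∈ 𝒜 → A ⊆ B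
  empty A∈ x∈ = contradiction (∈-length x∈) λ 0< → <-irrefl (sym (𝒜-sizes A∈)) 0<
f-k≡0 (suc r) m (_ , bounded) = contradiction
  (≤-trans (choose-grows r m) (≤-trans (≤-reflexive (sym (subsets-length (m + suc r) (suc r)))) (bounded _ [] adm))) (<-irrefl refl)
  where
  adm : Admissible (suc r) 0 0 (subsets (m + suc r) (suc r)) []
  adm = record
    { 𝒜-unique = subsets-unique (m + suc r) (suc r) ; ℬ-unique = []
    ; 𝒜-sizes = subsets-size (m + suc r) (suc r) ; ℬ-sizes = λ () ; ℬ-card = refl
    ; covers = λ _ → (λ ()) , (λ { {()} }) , λ () }

f-k≡1 : ∀ {r 𝒜 ℬ} → Admissible r 1 0 𝒜 ℬ → length 𝒜 ≤ 0
f-k≡1 {𝒜 = []} _ = z≤n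
f-k≡1 {𝒜 = A ∷ _} {[]} adm with Admissible.covers adm (here refl)
... | _ , _ , Bs-in with () ← proj₁ (Bs-in Fin.zero)
f-k≡1 {𝒜 = A ∷ _} {_ ∷ _} adm with () ← Admissible.ℬ-card adm

∑C≡∑choose : ∀ s {d} (c : Fin d → ℕ) → ∑[ i < d ] (c i C (s + toℕ i)) ≡ ∑choose s c
∑C≡∑choose s {d} c = sum-cong-≗ {d} λ i → sym (choose-C (c i) (s + toℕ i))

-- As `f` is given by its graph, the bounds alone would hold vacuously if no maximum existed;
-- therefore existence is asserted as well for k ≥ 1. For k = 0 and r > 0 there is no maximum, and τ
-- = 1 comes from r = 0.
theorem3 : ∀ (k : ℕ) → ∃[ τ ] (∀ (r : ℕ) → k ≤ r →
    ∀ (c : Fin (k ∸ 1) → ℕ) → c Preserves Fin._<_ ⟶ _<_ →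
    ∀ (b : ℕ) → b ≡ ∑[ i < k ∸ 1 ] (c i C (1 + toℕ i)) →
    (1 ≤ k → ∃[ m ] (f[ r , k , b ]≡ m)) ×
    (∀ (m : ℕ) → f[ r , k , b ]≡ m →
    ∑[ i < k ∸ 1 ] (c i C (2 + toℕ i)) ≤ m ×
    m ≤ ∑[ i < k ∸ 1 ] (c i C (2 + toℕ i)) + τ))
theorem3 zero = 1 , λ { r _ c _ _ refl → (λ ()) , λ m f≡m → z≤n , f-k≡0 r m f≡m }
theorem3 (suc zero) = 0 , λ { r _ c _ _ refl →
  (λ _ → 0 , (([] , [] , record
    { 𝒜-unique = [] ; ℬ-unique = [] ; 𝒜-sizes = λ () ; ℬ-sizes = λ () ; ℬ-card = refl ; covers = λ () } , refl)
    , λ _ _ → f-k≡1)) ,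
  λ { m ((_ , _ , adm , refl) , _) → z≤n , f-k≡1 adm } }
theorem3 (suc (suc e)) with upper-bound e
... | τ , upper = τ , λ { r@(suc _) k≤r c inc _ refl → existence r k≤r c inc , bounds r k≤r c inc }
  where
  existence : ∀ r → 2 + e ≤ r → (c : Fin (suc e) → ℕ) → Increasing c → 1 ≤ 2 + e →
    ∃[ m ] (f[ r , 2 + e , ∑[ i < suc e ] (c i C (1 + toℕ i)) ]≡ m)
  existence r@(suc _) k≤r c inc _ = subst (λ b → ∃[ m ] (f[ r , 2 + e , b ]≡ m)) (sym (∑C≡∑choose 1 c))
    (maximum-exists (proj₁ (proj₂ (proj₂ (cascade-admissible k≤r c inc)))))
  bounds : ∀ r → 2 + e ≤ r → (c : Fin (suc e) → ℕ) → Increasing c →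
    ∀ m → f[ r , 2 + e , ∑[ i < suc e ] (c i C (1 + toℕ i)) ]≡ m →
    ∑[ i < suc e ] (c i C (2 + toℕ i)) ≤ m × m ≤ ∑[ i < suc e ] (c i C (2 + toℕ i)) + τ
  bounds r k≤r c inc m ((𝒜 , ℬ , adm , refl) , bounded) rewrite ∑C≡∑choose 2 c | ∑C≡∑choose 1 c
    with cascade-admissible k≤r c inc
  ... | 𝒜₀ , ℬ₀ , adm₀ , 𝒜₀-len = ≤-trans (≤-reflexive (sym 𝒜₀-len)) (bounded 𝒜₀ ℬ₀ adm₀)
    , ≤-trans (upper (Closed.system (admissible⇒closed adm)))
        (≤-reflexive (cong (_+ τ) (trans (cong (kk e) (Admissible.ℬ-card adm)) (kk-∑choose e c inc))))
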